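{- Let $\Sigma=(\Gamma,\sigma)$ be a signed graph with underlying graph $\Gamma=(V,E)$ and $G$ a finite additive abelian group. The number of $G$-tensions of $\Sigma$ is $t^0_\Sigma(G)=|G|^{|V|-k_b(\Sigma)}$, and the number of $G$-potential differences of $\Sigma$ is $p^0_\Sigma(G)=|G|^{|V|-k(\Sigma)}|2G|^{k_u(\Sigma)}$.
   Context: A signed graph $\Sigma=(\Gamma,\sigma)$: finite graph $\Gamma=(V,E)$ (loops, multiple edges allowed), $\sigma:E\to\{ -1,1\}$. A cycle (loops included) is balanced if the product of its edge signs is $1$, unbalanced otherwise. $k,k_b,k_u$: numbers of connected components, balanced components (all cycles balanced), unbalanced components. Each edge $e$ with endpoints $u,v$ has half-edges $(u,e),(v,e)$; an orientation $\omega$ assigns $\pm1$ to each half-edge, compatible with $\sigma$ if $\sigma(e)=-\omega(u,e)\omega(v,e)$; fix one (counts do not depend on it). A walk $(v_1,e_1,\dots,v_k,e_k,v_{k+1})$ has $e_i$ joining $v_i,v_{i+1}$; $\omega(v_i,e_i)$ is the orientation of the half-edge of $e_i$ at $v_i$ by which the walk leaves $v_i$. Circuits of $\Sigma$: edge sets of balanced cycles, of unbalanced tight handcuffs (two unbalanced cycles sharing exactly one vertex) and of unbalanced loose handcuffs (two vertex-disjoint unbalanced cycles joined by a path meeting them only at its endpoints, whose edges are circuit path edges). A circuit walk is a closed walk traversing a circuit using circuit path edges twice and other edges once. $f:E\to G$ is a $G$-tension if for every circuit walk $(v_1,e_1,\dots,v_k,e_k,v_1)$, $\sum_{i=1}^k\big(\omega(v_i,e_i)\prod_{j<i}\sigma(e_j)\big)f(e_i)=0$;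 a $G$-potential difference if additionally $\sum_if(e_i)\in2G=\{x+x:x\in G\}$ for every closed walk around an unbalanced cycle. Zero values are allowed. -}

module Defs where

open import Level using (0ℓ)
open import Data.Nat using (ℕ; zero; suc; _+_; _*_)
open import Data.Bool using (Bool; true; false; not; if_then_else_)
open import Data.Fin using (Fin; _≟_)
open import Data.Fin.Properties using (any?)
open import Data.Product using (Σ; ∃; ∃-syntax; _×_; _,_; proj₁; proj₂)
open import Data.Unit using (⊤)
open import Data.Empty using (⊥)
open import Data.Sign using (Sign; opposite) renaming (_*_ to _·_)
open import Data.List using (List; []; _∷_; map; length; filter; _++_)
open import Data.List.Membership.Propositional using (_∈_)
open import Data.List.Relation.Unary.Unique.Propositional using (Unique)
open import Data.List.Relation.Unary.AllPairs using (AllPairs)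
open import Data.Vec using (Vec; lookup)
open import Relation.Nullary using (¬_; does)
open import Relation.Binary.PropositionalEquality using (_≡_)
open import Function.Bundles using (_⇔_)

------------------------------------------------------------------------
-- Finite cardinality of a subset {a : A | P a} of a type A with
-- propositional equality: there is a duplicate-free list enumerating
-- exactly the elements satisfying P, of length N.

HasSize : (A : Set) → (A → Set) → ℕ → Set
HasSize A P N =
  Σ (List A) λ L → Unique L × (∀ a → (a ∈ L) ⇔ P a) × length L ≡ N

------------------------------------------------------------------------
-- Signed graphs.  V = Fin nV, E = Fin nE.  Each edge e has two
-- half-edges, indexed by a Bool "side"; endpoint e b is the vertex of
-- the half-edge (e , b).  Loops (endpoint e false ≡ endpoint e true) and
-- multiple edges are allowed.

record SignedGraph : Set where
  field
    nV       : ℕ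
    nE       : ℕ
    endpoint : Fin nE → Bool → Fin nV
    σ        : Fin nE → Sign

-- an orientation assigns a sign to each half-edge
Orientation : SignedGraph → Set
Orientation Σg = Fin (SignedGraph.nE Σg) → Bool → Sign

-- σ(e) = - ω(u,e) ω(v,e)
Compatible : (Σg : SignedGraph) → Orientation Σg → Set
Compatible Σg ω = ∀ e → SignedGraph.σ Σg e ≡ opposite (ω e false · ω e true)

module _ (Σg : SignedGraph) where
  open SignedGraph Σg

  Vertex : Set
  Vertex = Fin nV

  Edge : Set
  Edge = Fin nE

  -- a step of a walk: edge e, left through its half-edge on side b
  Step : Set
  Step = Edge × Bool

  src : Step → Vertex
  src (e , b) = endpoint e b

  tgt : Step → Vertex
  tgt (e , b) = endpoint e (not b)

  -- consecutive steps are joined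
  Chain : List Step → Set
  Chain []           = ⊤
  Chain (s ∷ [])     = ⊤
  Chain (s ∷ t ∷ ws) = tgt s ≡ src t × Chain (t ∷ ws)

  lastStep : Step → List Step → Step
  lastStep s []       = s
  lastStep s (t ∷ ws) = lastStep t ws

  -- walk from u to v (possibly empty, then u ≡ v)
  WalkFromTo : Vertex → Vertex → List Step → Set
  WalkFromTo u v []       = u ≡ v
  WalkFromTo u v (s ∷ ws) = src s ≡ u × Chain (s ∷ ws) × tgt (lastStep s ws) ≡ v

  Connected : Vertex → Vertex → Set
  Connected u v = ∃[ W ] WalkFromTo u v W

  -- a nonempty closed walk
  ClosedWalk : List Step → Set
  ClosedWalk []       = ⊥
  ClosedWalk (s ∷ ws) = Chain (s ∷ ws) × tgt (lastStep s ws) ≡ src s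

  vertices : List Step → List Vertex      -- v₁ … vₖ (leaving vertices)
  vertices = map src

  edges : List Step → List Edge
  edges = map proj₁

  -- closed walk around a cycle: distinct vertices and distinct edges
  -- (loops: length 1; digons of parallel edges: length 2)
  IsCycle : List Step → Set
  IsCycle W = ClosedWalk W × Unique (vertices W) × Unique (edges W)

  signProd : List Step → Sign
  signProd []             = Sign.+
  signProd ((e , _) ∷ ws) = σ e · signProd ws

  Balanced : List Step → Set
  Balanced W = signProd W ≡ Sign.+

  -- path (with at least one edge) from its first to its last vertex,
  -- with pairwise distinct vertices
  pathVertices : Step → List Step → List Vertex
  pathVertices s ws = src s ∷ map tgt (s ∷ ws)

  IsPath : Step → List Step → Set
  IsPath s ws = Chain (s ∷ ws) × Unique (pathVertices s ws)

  -- number of occurrences of the edge e in a walk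
  countE : Edge → List Step → ℕ
  countE e []             = 0
  countE e ((e' , _) ∷ ws) =
    if does (e ≟ e') then suc (countE e ws) else countE e ws

  -- Circuits, described by their multiplicity function:
  -- m e = 0 if e is not in the circuit, 2 if e is a circuit path edge,
  -- 1 for the other edges of the circuit.
  data CircuitMult : (Edge → ℕ) → Set where
    balancedCycle : (W : List Step) → IsCycle W → Balanced W →
      CircuitMult (λ e → countE e W)
    tightHandcuff : (W₁ W₂ : List Step) → IsCycle W₁ → IsCycle W₂ →
      ¬ Balanced W₁ → ¬ Balanced W₂ →
      (∀ e → e ∈ edges W₁ → e ∈ edges W₂ → ⊥) →
      (v : Vertex) → v ∈ vertices W₁ → v ∈ vertices W₂ →
      (∀ u → u ∈ vertices W₁ → u ∈ vertices W₂ → u ≡ v) →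
      CircuitMult (λ e → countE e W₁ + countE e W₂)
    looseHandcuff : (W₁ W₂ : List Step) → IsCycle W₁ → IsCycle W₂ →
      ¬ Balanced W₁ → ¬ Balanced W₂ →
      (∀ u → u ∈ vertices W₁ → u ∈ vertices W₂ → ⊥) →
      (s : Step) (ws : List Step) → IsPath s ws →
      src s ∈ vertices W₁ → tgt (lastStep s ws) ∈ vertices W₂ →
      (∀ u → u ∈ pathVertices s ws → u ∈ vertices W₁ → u ≡ src s) →
      (∀ u → u ∈ pathVertices s ws → u ∈ vertices W₂ → u ≡ tgt (lastStep s ws)) →
      CircuitMult (λ e → countE e W₁ + countE e W₂ + 2 * countE e (s ∷ ws))

  -- closed walk traversing a circuit, path edges twice, others once
  CircuitWalk : List Step → Set
  CircuitWalk W = ClosedWalk W × ∃[ m ] (CircuitMult m × (∀ e → countE e W ≡ m e))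

  -- components
  BalancedComponent : Vertex → Set
  BalancedComponent r = ∀ W → IsCycle W → (v : Vertex) → v ∈ vertices W →
    Connected r v → Balanced W

  -- Rb ++ Ru is a system of representatives of the connected components
  -- (one vertex per component); Rb are those of the balanced components,
  -- Ru those of the unbalanced ones.  So k = |Rb|+|Ru|, k_b = |Rb|,
  -- k_u = |Ru|.
  ComponentReps : List Vertex → List Vertex → Set
  ComponentReps Rb Ru =
    AllPairs (λ u v → ¬ Connected u v) (Rb ++ Ru) ×
    (∀ v → ∃[ r ] (r ∈ Rb ++ Ru × Connected r v)) ×
    (∀ r → r ∈ Rb → BalancedComponent r) ×
    (∀ r → r ∈ Ru → ¬ BalancedComponent r)

  ----------------------------------------------------------------------
  -- G-valued functions on E, G = (Fin n, _⊕_, 0#, ⊖_) a finite abelian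
  -- group; f(e) = lookup f e.
  module _ (ω : Orientation Σg) {n : ℕ} (_⊕_ : Fin n → Fin n → Fin n)
           (0# : Fin n) (⊖_ : Fin n → Fin n) where

    act : Sign → Fin n → Fin n
    act Sign.+ x = x
    act Sign.- x = ⊖ x

    -- Σᵢ ω(vᵢ,eᵢ) (∏_{j<i} σ(eⱼ)) f(eᵢ), with accumulated sign s
    twistedSum : Vec (Fin n) nE → Sign → List Step → Fin n
    twistedSum f s []             = 0#
    twistedSum f s ((e , b) ∷ ws) =
      act (ω e b · s) (lookup f e) ⊕ twistedSum f (s · σ e) ws

    plainSum : Vec (Fin n) nE → List Step → Fin n
    plainSum f []             = 0#
    plainSum f ((e , _) ∷ ws) = lookup f e ⊕ plainSum f ws

    In2G : Fin n → Set
    In2G x = ∃[ y ] x ≡ y ⊕ y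

    IsTension : Vec (Fin n) nE → Set
    IsTension f = ∀ W → CircuitWalk W → twistedSum f Sign.+ W ≡ 0#

    IsPotentialDifference : Vec (Fin n) nE → Set
    IsPotentialDifference f = IsTension f ×
      (∀ W → IsCycle W → ¬ Balanced W → In2G (plainSum f W))

-- |2G| for G = (Fin n, _⊕_)
size2G : {n : ℕ} → (Fin n → Fin n → Fin n) → ℕ
size2G {n} _⊕_ = length (filter (λ x → any? (λ y → x ≟ (y ⊕ y))) (Data.List.tabulate {n = n} (λ i → i)))
  where import Data.List

-- A function f on the edges is a tension exactly when its twisted sum τ vanishes
-- on every balanced closed walk and takes one common value on all unbalanced
-- closed walks at a given vertex.  The circuit equations imply this by induction
-- on the length of the walk: a closed walk is a cycle, or it splits off a shorter
-- closed subwalk, and two unbalanced cycles are compared through the tight or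
-- loose handcuff that joins them.
--
-- Fix a representative of every component and a walk from it to every vertex.
-- A tension is then determined by its twisted sums along these walks, i.e. by a
-- "potential" at every vertex other than a representative, together with the
-- common value of τ on the unbalanced closed walks at each representative of an
-- unbalanced component; conversely every such choice of elements of G comes from
-- an explicit tension.  This gives |G|^(|V| - k_b) tensions.  The plain sum of
-- that tension around an unbalanced cycle is the value at its representative
-- modulo 2G, so the potential differences correspond to the choices in which
-- these k_u values lie in 2G, giving |G|^(|V| - k) |2G|^(k_u).

module Submission where

open import Defs
open import Data.Nat using (ℕ; _+_; _*_; _∸_; _^_)
open import Data.Fin using (Fin)
open import Data.List using (List; length)
open import Data.Vec using (Vec)
open import Data.Product using (_×_)
open import Algebra.Structures using (IsAbelianGroup)
open import Relation.Binary.PropositionalEquality using (_≡_)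

module AbelianGroupSolver {A : Set} (plus : A → A → A) (0# : A) (neg : A → A)
                          (isAG : IsAbelianGroup _≡_ plus 0# neg) where

  open import Relation.Binary.PropositionalEquality
  open import Data.Nat using (ℕ; zero; suc; _+_; _≡ᵇ_)
  open import Data.Nat.Properties using (≡ᵇ⇒≡)
  open import Data.Bool using (Bool; true; T; _∧_)
  open import Data.Fin using (Fin)
  open import Data.Vec using (Vec; []; _∷_; lookup; replicate; zipWith; map)
  open import Data.Product using (_×_; _,_; proj₁; proj₂)
  open import Data.Unit using (tt)
  open import Algebra.Bundles using (AbelianGroup)

  infixl 6 _⊕_
  infix 8 ⊖_

  _⊕_ : A → A → A
  _⊕_ = plus

  ⊖_ : A → A
  ⊖_ = neg

  open IsAbelianGroup isAG public
    using (assoc; comm; identityˡ; identityʳ; inverseˡ; inverseʳ)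

  abelianGroup : AbelianGroup _ _
  abelianGroup = record { isAbelianGroup = isAG }

  open import Algebra.Properties.AbelianGroup abelianGroup public
    using (⁻¹-∙-comm; ⁻¹-involutive; ε⁻¹≈ε; ∙-cancelˡ; ∙-cancelʳ)

  open ≡-Reasoning

  medial : ∀ a b c d → (a ⊕ b) ⊕ (c ⊕ d) ≡ (a ⊕ c) ⊕ (b ⊕ d)
  medial a b c d = begin
    (a ⊕ b) ⊕ (c ⊕ d)   ≡⟨ assoc a b (c ⊕ d) ⟩
    a ⊕ (b ⊕ (c ⊕ d))   ≡⟨ cong (a ⊕_) (sym (assoc b c d)) ⟩
    a ⊕ ((b ⊕ c) ⊕ d)   ≡⟨ cong (λ z → a ⊕ (z ⊕ d)) (comm b c) ⟩
    a ⊕ ((c ⊕ b) ⊕ d)   ≡⟨ cong (a ⊕_) (assoc c b d) ⟩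
    a ⊕ (c ⊕ (b ⊕ d))   ≡⟨ sym (assoc a c (b ⊕ d)) ⟩
    (a ⊕ c) ⊕ (b ⊕ d)   ∎

  ⊖-distrib-⊕ : ∀ x y → ⊖ (x ⊕ y) ≡ ⊖ x ⊕ ⊖ y
  ⊖-distrib-⊕ x y = sym (⁻¹-∙-comm x y)

  -- A normal form assigns to each variable a coefficient a − b, kept as the
  -- pair (a , b) of naturals; two normal forms are compared by a + d ≟ c + b.

  multiple : ℕ → A → A
  multiple zero    x = 0#
  multiple (suc k) x = x ⊕ multiple k x

  multiple-+ : ∀ a b x → multiple (a + b) x ≡ multiple a x ⊕ multiple b x
  multiple-+ zero    b x = sym (identityˡ _)
  multiple-+ (suc a) b x = trans (cong (x ⊕_) (multiple-+ a b x)) (sym (assoc x _ _))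

  term : ℕ × ℕ → A → A
  term (a , b) x = multiple a x ⊕ ⊖ multiple b x

  term-+ : ∀ a b c d x → term (a + c , b + d) x ≡ term (a , b) x ⊕ term (c , d) x
  term-+ a b c d x = begin
    multiple (a + c) x ⊕ ⊖ multiple (b + d) x
      ≡⟨ cong₂ (λ u v → u ⊕ ⊖ v) (multiple-+ a c x) (multiple-+ b d x) ⟩
    (multiple a x ⊕ multiple c x) ⊕ ⊖ (multiple b x ⊕ multiple d x)
      ≡⟨ cong ((multiple a x ⊕ multiple c x) ⊕_) (⊖-distrib-⊕ _ _) ⟩
    (multiple a x ⊕ multiple c x) ⊕ (⊖ multiple b x ⊕ ⊖ multiple d x)
      ≡⟨ medial _ _ _ _ ⟩
    term (a , b) x ⊕ term (c , d) x ∎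

  term-swap : ∀ a b x → term (b , a) x ≡ ⊖ term (a , b) x
  term-swap a b x = begin
    multiple b x ⊕ ⊖ multiple a x        ≡⟨ comm _ _ ⟩
    ⊖ multiple a x ⊕ multiple b x        ≡⟨ cong (⊖ multiple a x ⊕_) (sym (⁻¹-involutive _)) ⟩
    ⊖ multiple a x ⊕ ⊖ ⊖ multiple b x    ≡⟨ sym (⊖-distrib-⊕ _ _) ⟩
    ⊖ term (a , b) x                     ∎

  term-cong : ∀ a b c d x → a + d ≡ c + b → term (a , b) x ≡ term (c , d) x
  term-cong a b c d x e = ∙-cancelʳ (multiple b x ⊕ multiple d x) _ _ (begin
    (multiple a x ⊕ ⊖ multiple b x) ⊕ (multiple b x ⊕ multiple d x)
      ≡⟨ cong ((multiple a x ⊕ ⊖ multiple b x) ⊕_) (comm _ _) ⟩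
    (multiple a x ⊕ ⊖ multiple b x) ⊕ (multiple d x ⊕ multiple b x)
      ≡⟨ medial _ _ _ _ ⟩
    (multiple a x ⊕ multiple d x) ⊕ (⊖ multiple b x ⊕ multiple b x)
      ≡⟨ cong₂ _⊕_ (sym (multiple-+ a d x)) (inverseˡ _) ⟩
    multiple (a + d) x ⊕ 0#
      ≡⟨ cong (λ z → multiple z x ⊕ 0#) e ⟩
    multiple (c + b) x ⊕ 0#
      ≡⟨ cong₂ _⊕_ (multiple-+ c b x) (sym (inverseˡ _)) ⟩
    (multiple c x ⊕ multiple b x) ⊕ (⊖ multiple d x ⊕ multiple d x)
      ≡⟨ medial _ _ _ _ ⟩
    (multiple c x ⊕ ⊖ multiple d x) ⊕ (multiple b x ⊕ multiple d x) ∎)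

  infixl 6 _:+_ _:-_
  infix 8 :-_

  data Expr (k : ℕ) : Set where
    var  : Fin k → Expr k
    :0   : Expr k
    _:+_ : Expr k → Expr k → Expr k
    :-_  : Expr k → Expr k

  _:-_ : ∀ {k} → Expr k → Expr k → Expr k
  a :- b = a :+ :- b

  x0 : ∀ {k} → Expr (suc k)
  x0 = var Fin.zero

  x1 : ∀ {k} → Expr (suc (suc k))
  x1 = var (Fin.suc Fin.zero)

  x2 : ∀ {k} → Expr (suc (suc (suc k)))
  x2 = var (Fin.suc (Fin.suc Fin.zero))

  x3 : ∀ {k} → Expr (suc (suc (suc (suc k))))
  x3 = var (Fin.suc (Fin.suc (Fin.suc Fin.zero)))

  ⟦_⟧ : ∀ {k} → Expr k → Vec A k → A
  ⟦ var i  ⟧ ρ = lookup ρ i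
  ⟦ :0     ⟧ ρ = 0#
  ⟦ a :+ b ⟧ ρ = ⟦ a ⟧ ρ ⊕ ⟦ b ⟧ ρ
  ⟦ :- a   ⟧ ρ = ⊖ ⟦ a ⟧ ρ

  Normal : ℕ → Set
  Normal k = Vec (ℕ × ℕ) k

  zeroN : ∀ {k} → Normal k
  zeroN = replicate _ (0 , 0)

  varN : ∀ {k} → Fin k → Normal k
  varN Fin.zero    = (1 , 0) ∷ zeroN
  varN (Fin.suc i) = (0 , 0) ∷ varN i

  addN : ∀ {k} → Normal k → Normal k → Normal k
  addN = zipWith (λ p q → proj₁ p + proj₁ q , proj₂ p + proj₂ q)

  negN : ∀ {k} → Normal k → Normal k
  negN = map (λ p → proj₂ p , proj₁ p)

  normalise : ∀ {k} → Expr k → Normal k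
  normalise (var i)  = varN i
  normalise :0       = zeroN
  normalise (a :+ b) = addN (normalise a) (normalise b)
  normalise (:- a)   = negN (normalise a)

  ⟦_⟧N : ∀ {k} → Normal k → Vec A k → A
  ⟦ []     ⟧N []       = 0#
  ⟦ c ∷ cs ⟧N (x ∷ xs) = term c x ⊕ ⟦ cs ⟧N xs

  ⟦zeroN⟧ : ∀ {k} (ρ : Vec A k) → ⟦ zeroN ⟧N ρ ≡ 0#
  ⟦zeroN⟧ []      = refl
  ⟦zeroN⟧ (x ∷ ρ) = trans (cong₂ _⊕_ (inverseʳ 0#) (⟦zeroN⟧ ρ)) (identityˡ 0#)

  ⟦varN⟧ : ∀ {k} (i : Fin k) ρ → ⟦ varN i ⟧N ρ ≡ lookup ρ i
  ⟦varN⟧ Fin.zero (x ∷ ρ) = begin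
    ((x ⊕ 0#) ⊕ ⊖ 0#) ⊕ ⟦ zeroN ⟧N ρ ≡⟨ cong₂ (λ u v → (u ⊕ ⊖ 0#) ⊕ v) (identityʳ x) (⟦zeroN⟧ ρ) ⟩
    (x ⊕ ⊖ 0#) ⊕ 0#                  ≡⟨ identityʳ _ ⟩
    x ⊕ ⊖ 0#                         ≡⟨ cong (x ⊕_) ε⁻¹≈ε ⟩
    x ⊕ 0#                           ≡⟨ identityʳ x ⟩
    x                                ∎
  ⟦varN⟧ (Fin.suc i) (x ∷ ρ) =
    trans (cong₂ _⊕_ (inverseʳ 0#) (⟦varN⟧ i ρ)) (identityˡ _)

  ⟦addN⟧ : ∀ {k} (p q : Normal k) ρ → ⟦ addN p q ⟧N ρ ≡ ⟦ p ⟧N ρ ⊕ ⟦ q ⟧N ρ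
  ⟦addN⟧ [] [] [] = sym (identityˡ 0#)
  ⟦addN⟧ ((a , b) ∷ p) ((c , d) ∷ q) (x ∷ ρ) =
    trans (cong₂ _⊕_ (term-+ a b c d x) (⟦addN⟧ p q ρ)) (medial _ _ _ _)

  ⟦negN⟧ : ∀ {k} (p : Normal k) ρ → ⟦ negN p ⟧N ρ ≡ ⊖ ⟦ p ⟧N ρ
  ⟦negN⟧ [] [] = sym ε⁻¹≈ε
  ⟦negN⟧ ((a , b) ∷ p) (x ∷ ρ) =
    trans (cong₂ _⊕_ (term-swap a b x) (⟦negN⟧ p ρ)) (sym (⊖-distrib-⊕ _ _))

  ⟦normalise⟧ : ∀ {k} (e : Expr k) ρ → ⟦ e ⟧ ρ ≡ ⟦ normalise e ⟧N ρ
  ⟦normalise⟧ (var i)  ρ = sym (⟦varN⟧ i ρ)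
  ⟦normalise⟧ :0       ρ = sym (⟦zeroN⟧ ρ)
  ⟦normalise⟧ (a :+ b) ρ =
    trans (cong₂ _⊕_ (⟦normalise⟧ a ρ) (⟦normalise⟧ b ρ)) (sym (⟦addN⟧ (normalise a) (normalise b) ρ))
  ⟦normalise⟧ (:- a)   ρ = trans (cong ⊖_ (⟦normalise⟧ a ρ)) (sym (⟦negN⟧ (normalise a) ρ))

  sameNormal : ∀ {k} → Normal k → Normal k → Bool
  sameNormal []            []            = true
  sameNormal ((a , b) ∷ p) ((c , d) ∷ q) = (a + d ≡ᵇ c + b) ∧ sameNormal p q

  sameNormal-sound : ∀ {k} (p q : Normal k) ρ → T (sameNormal p q) → ⟦ p ⟧N ρ ≡ ⟦ q ⟧N ρ
  sameNormal-sound [] [] [] _ = refl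
  sameNormal-sound ((a , b) ∷ p) ((c , d) ∷ q) (x ∷ ρ) t with a + d ≡ᵇ c + b in eq
  ... | true = cong₂ _⊕_ (term-cong a b c d x (≡ᵇ⇒≡ (a + d) (c + b) (subst T (sym eq) tt)))
                         (sameNormal-sound p q ρ t)

  prove : ∀ {k} (e₁ e₂ : Expr k) → T (sameNormal (normalise e₁) (normalise e₂)) →
    ∀ ρ → ⟦ e₁ ⟧ ρ ≡ ⟦ e₂ ⟧ ρ
  prove e₁ e₂ t ρ = begin
    ⟦ e₁ ⟧ ρ              ≡⟨ ⟦normalise⟧ e₁ ρ ⟩
    ⟦ normalise e₁ ⟧N ρ   ≡⟨ sameNormal-sound (normalise e₁) (normalise e₂) ρ t ⟩
    ⟦ normalise e₂ ⟧N ρ   ≡⟨ ⟦normalise⟧ e₂ ρ ⟨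
    ⟦ e₂ ⟧ ρ              ∎

module ListFacts where

  open import Data.List using (List; []; _∷_; _++_)
  open import Data.List.Membership.Propositional using (_∈_; _∉_; find; lose)
  open import Data.List.Membership.Propositional.Properties using (∈-++⁺ˡ; ∈-++⁺ʳ)
  open import Data.List.Membership.DecPropositional using (_∈?_)
  open import Data.List.Relation.Unary.Any using (here; there; any?)
  open import Data.List.Relation.Unary.All.Properties using (¬Any⇒All¬)
  open import Data.List.Relation.Unary.AllPairs using (AllPairs; []; _∷_)
  open import Data.List.Relation.Unary.All using (lookup)
  open import Data.List.Relation.Unary.Unique.Propositional using (Unique)
  open import Data.List.Relation.Unary.Unique.Propositional.Properties using (++⁺; Unique[x∷xs]⇒x∉xs)
  open import Data.Product using (Σ; _×_; _,_)
  open import Data.Sum using (_⊎_; inj₁; inj₂)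
  open import Data.Empty using (⊥)
  open import Relation.Nullary using (¬_; yes; no)
  open import Relation.Nullary.Decidable using (_×-dec_; ¬?; decidable-stable)
  open import Relation.Binary.Definitions using (DecidableEquality)
  open import Relation.Binary.PropositionalEquality using (_≡_; refl)

  module _ {A : Set} where

    unique-∷ : ∀ {a : A} {xs} → a ∉ xs → Unique xs → Unique (a ∷ xs)
    unique-∷ {xs = xs} a∉xs u = ¬Any⇒All¬ xs a∉xs ∷ u

    unique-++⁻ˡ : ∀ (xs : List A) {ys} → Unique (xs ++ ys) → Unique xs
    unique-++⁻ˡ []       u        = []
    unique-++⁻ˡ (x ∷ xs) u@(_ ∷ v) =
      unique-∷ (λ m → Unique[x∷xs]⇒x∉xs u (∈-++⁺ˡ m)) (unique-++⁻ˡ xs v)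

    unique-++⁻ʳ : ∀ (xs : List A) {ys} → Unique (xs ++ ys) → Unique ys
    unique-++⁻ʳ []       u       = u
    unique-++⁻ʳ (x ∷ xs) (_ ∷ u) = unique-++⁻ʳ xs u

    unique-++⇒disjoint : ∀ (xs : List A) {ys a} → Unique (xs ++ ys) → a ∈ xs → a ∈ ys → ⊥
    unique-++⇒disjoint (x ∷ xs) u       (here refl) m = Unique[x∷xs]⇒x∉xs u (∈-++⁺ʳ xs m)
    unique-++⇒disjoint (x ∷ xs) (_ ∷ u) (there a∈xs) m = unique-++⇒disjoint xs u a∈xs m

    unique-++-comm : ∀ (xs : List A) {ys} → Unique (xs ++ ys) → Unique (ys ++ xs)
    unique-++-comm xs u =
      ++⁺ (unique-++⁻ʳ xs u) (unique-++⁻ˡ xs u) (λ (m₁ , m₂) → unique-++⇒disjoint xs u m₂ m₁)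

    allPairs-lookup : ∀ {R : A → A → Set} {xs a b} → AllPairs R xs → a ∈ xs → b ∈ xs → a ≡ b ⊎ R a b ⊎ R b a
    allPairs-lookup (_  ∷ _)  (here refl) (here refl) = inj₁ refl
    allPairs-lookup (px ∷ _)  (here refl) (there b∈)  = inj₂ (inj₁ (lookup px b∈))
    allPairs-lookup (px ∷ _)  (there a∈)  (here refl) = inj₂ (inj₂ (lookup px a∈))
    allPairs-lookup (_  ∷ ps) (there a∈)  (there b∈)  = allPairs-lookup ps a∈ b∈

    module _ (_≟_ : DecidableEquality A) where

      common? : (xs ys : List A) → (Σ A λ a → a ∈ xs × a ∈ ys) ⊎ (∀ a → a ∈ xs → a ∈ ys → ⊥)
      common? xs ys with any? (λ a → _∈?_ _≟_ a ys) xs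
      ... | yes p = inj₁ (find p)
      ... | no ¬p = inj₂ (λ a a∈xs a∈ys → ¬p (lose a∈xs a∈ys))

      commonOtherThan? : (b : A) (xs ys : List A) →
        (Σ A λ a → a ∈ xs × a ∈ ys × ¬ a ≡ b) ⊎ (∀ a → a ∈ xs → a ∈ ys → a ≡ b)
      commonOtherThan? b xs ys with any? (λ a → _∈?_ _≟_ a ys ×-dec ¬? (a ≟ b)) xs
      ... | yes p = let a , a∈xs , a∈ys , a≢b = find p in inj₁ (a , a∈xs , a∈ys , a≢b)
      ... | no ¬p = inj₂ λ a a∈xs a∈ys → decidable-stable (a ≟ b) (λ a≢b → ¬p (lose a∈xs (a∈ys , a≢b)))

module SignFacts where

  open import Data.Sign using (Sign; +; -; opposite) renaming (_*_ to _·_)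
  open import Relation.Nullary using (¬_)
  open import Relation.Binary.PropositionalEquality using (_≡_; refl)

  +≢- : ¬ + ≡ -
  +≢- ()

  ≢+⇒≡- : ∀ {s} → ¬ s ≡ + → s ≡ -
  ≢+⇒≡- {Sign.+} s≢+ with () ← s≢+ refl
  ≢+⇒≡- {Sign.-} _ = refl

  ≢⇒≡opposite : ∀ a b → ¬ a ≡ b → b ≡ opposite a
  ≢⇒≡opposite + + a≢b with () ← a≢b refl
  ≢⇒≡opposite - - a≢b with () ← a≢b refl
  ≢⇒≡opposite + - _ = refl
  ≢⇒≡opposite - + _ = refl

  ·≡+⇒≡ : ∀ a b → a · b ≡ + → a ≡ b
  ·≡+⇒≡ + + _ = refl
  ·≡+⇒≡ - - _ = refl

  ·≡-⇒≡opposite : ∀ a b → a · b ≡ - → b ≡ opposite a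
  ·≡-⇒≡opposite + - _ = refl
  ·≡-⇒≡opposite - + _ = refl

  -≡opposite·⇒≡ : ∀ a b → - ≡ opposite (a · b) → a ≡ b
  -≡opposite·⇒≡ + + _ = refl
  -≡opposite·⇒≡ - - _ = refl

  ·-·-≡+⇒≡opposite : ∀ a d → a · (- · d) ≡ + → d ≡ opposite a
  ·-·-≡+⇒≡opposite + - _ = refl
  ·-·-≡+⇒≡opposite - + _ = refl

  ·-·-≡-⇒·≡+ : ∀ a d → a · (- · d) ≡ - → a · d ≡ +
  ·-·-≡-⇒·≡+ + + _ = refl
  ·-·-≡-⇒·≡+ - - _ = refl

module Walks (Σg : SignedGraph) where

  open import Data.Nat using (ℕ; suc; _+_; _*_; _≤_; s≤s; z≤n)
  open import Data.Nat.Tactic.RingSolver using (solve-∀)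
  open import Data.Nat.Properties using (+-comm; +-assoc; +-identityʳ)
  open import Data.Bool using (Bool; true; false; not; if_then_else_)
  open import Data.Bool.Properties using (not-involutive)
  open import Data.Fin using (Fin; _≟_)
  open import Data.Product using (Σ; _×_; _,_; proj₁)
  open import Data.Sum using (_⊎_; inj₁; inj₂)
  open import Data.Unit using (tt)
  open import Data.List using (List; []; _∷_; _++_; map; length; [_])
  open import Data.List.Properties using (length-++)
  open import Data.List.Membership.Propositional using (_∈_)
  open import Data.List.Membership.DecPropositional using (_∈?_)
  open import Data.List.Relation.Unary.Any using (here; there)
  open import Data.List.Relation.Unary.AllPairs using ([])
  open import Data.List.Relation.Unary.Unique.Propositional using (Unique)
  open import Relation.Nullary using (yes; no; does)
  open import Data.Sign using (Sign) renaming (_*_ to _·_)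
  open import Data.Sign.Properties using (*-comm; *-assoc; *-identityʳ)
  open import Relation.Binary.PropositionalEquality hiding ([_])
  open ListFacts

  open SignedGraph Σg

  V : Set
  V = Vertex Σg

  St : Set
  St = Step Σg

  srcS : St → V
  srcS = src Σg

  tgtS : St → V
  tgtS = tgt Σg

  data Walk (u v : V) : Set where
    nil  : u ≡ v → Walk u v
    cons : (s : St) → srcS s ≡ u → Walk (tgtS s) v → Walk u v

  steps : ∀ {u v} → Walk u v → List St
  steps (nil _)      = []
  steps (cons s _ w) = s ∷ steps w

  len : ∀ {u v} → Walk u v → ℕ
  len w = length (steps w)

  sources : ∀ {u v} → Walk u v → List V
  sources w = map srcS (steps w)

  targets : ∀ {u v} → Walk u v → List V
  targets w = map tgtS (steps w)

  edgesʷ : ∀ {u v} → Walk u v → List (Fin nE)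
  edgesʷ w = map proj₁ (steps w)

  castˡ : ∀ {u u' v} → u ≡ u' → Walk u' v → Walk u v
  castˡ p (nil q)      = nil (trans p q)
  castˡ p (cons s q w) = cons s (trans q (sym p)) w

  steps-castˡ : ∀ {u u' v} (p : u ≡ u') (w : Walk u' v) → steps (castˡ p w) ≡ steps w
  steps-castˡ p (nil q)      = refl
  steps-castˡ p (cons s q w) = refl

  castʳ : ∀ {u v v'} → Walk u v → v ≡ v' → Walk u v'
  castʳ (nil q)      p = nil (trans q p)
  castʳ (cons s q w) p = cons s q (castʳ w p)

  steps-castʳ : ∀ {u v v'} (w : Walk u v) (p : v ≡ v') → steps (castʳ w p) ≡ steps w
  steps-castʳ (nil q)      p = refl
  steps-castʳ (cons s q w) p = cong (s ∷_) (steps-castʳ w p)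

  infixr 5 _++ʷ_

  _++ʷ_ : ∀ {u v w} → Walk u v → Walk v w → Walk u w
  nil p      ++ʷ b = castˡ p b
  cons s p a ++ʷ b = cons s p (a ++ʷ b)

  steps-++ʷ : ∀ {u v w} (a : Walk u v) (b : Walk v w) → steps (a ++ʷ b) ≡ steps a ++ steps b
  steps-++ʷ (nil p)      b = steps-castˡ p b
  steps-++ʷ (cons s p a) b = cong (s ∷_) (steps-++ʷ a b)

  len-++ʷ : ∀ {u v w} (a : Walk u v) (b : Walk v w) → len (a ++ʷ b) ≡ len a + len b
  len-++ʷ a b = trans (cong length (steps-++ʷ a b)) (length-++ (steps a))

  reverseStep : St → St
  reverseStep (e , b) = e , not b

  tgt-reverseStep : ∀ s → tgtS (reverseStep s) ≡ srcS s
  tgt-reverseStep (e , b) = cong (endpoint e) (not-involutive b)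

  reverseSteps : List St → List St
  reverseSteps []      = []
  reverseSteps (s ∷ l) = reverseSteps l ++ [ reverseStep s ]

  length-reverseSteps : ∀ l → length (reverseSteps l) ≡ length l
  length-reverseSteps []      = refl
  length-reverseSteps (s ∷ l) = begin
    length (reverseSteps l ++ [ reverseStep s ]) ≡⟨ length-++ (reverseSteps l) ⟩
    length (reverseSteps l) + 1                  ≡⟨ +-comm (length (reverseSteps l)) 1 ⟩
    suc (length (reverseSteps l))                ≡⟨ cong suc (length-reverseSteps l) ⟩
    suc (length l)                               ∎
    where open ≡-Reasoning

  reverseʷ : ∀ {u v} → Walk u v → Walk v u
  reverseʷ (nil p)      = nil (sym p)
  reverseʷ (cons s p w) = reverseʷ w ++ʷ cons (reverseStep s) refl (nil (trans (tgt-reverseStep s) p))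

  steps-reverseʷ : ∀ {u v} (w : Walk u v) → steps (reverseʷ w) ≡ reverseSteps (steps w)
  steps-reverseʷ (nil p)      = refl
  steps-reverseʷ (cons s p w) =
    trans (steps-++ʷ (reverseʷ w) _) (cong (_++ [ reverseStep s ]) (steps-reverseʷ w))

  len-reverseʷ : ∀ {u v} (w : Walk u v) → len (reverseʷ w) ≡ len w
  len-reverseʷ w = trans (cong length (steps-reverseʷ w)) (length-reverseSteps (steps w))

  tgt-lastStep : ∀ {u v} (s : St) (p : srcS s ≡ u) (w : Walk (tgtS s) v) →
    tgtS (lastStep Σg s (steps w)) ≡ v
  tgt-lastStep s p (nil q)      = q
  tgt-lastStep s p (cons t q w) = tgt-lastStep t q w

  chain-steps : ∀ {u v} (s : St) (p : srcS s ≡ u) (w : Walk (tgtS s) v) → Chain Σg (s ∷ steps w)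
  chain-steps s p (nil q)      = tt
  chain-steps s p (cons t q w) = sym q , chain-steps t q w

  toWalkFromTo : ∀ {u v} (w : Walk u v) → WalkFromTo Σg u v (steps w)
  toWalkFromTo (nil p)      = p
  toWalkFromTo (cons s p w) = p , chain-steps s p w , tgt-lastStep s p w

  toClosedWalk : ∀ {u} (s : St) (p : srcS s ≡ u) (w : Walk (tgtS s) u) →
    ClosedWalk Σg (steps (cons s p w))
  toClosedWalk s p w = chain-steps s p w , trans (tgt-lastStep s p w) (sym p)

  fromChain : ∀ {v} (s : St) (ws : List St) → Chain Σg (s ∷ ws) → tgtS (lastStep Σg s ws) ≡ v →
    Σ (Walk (tgtS s) v) λ w → steps w ≡ ws
  fromChain s []       c       e = nil e , refl
  fromChain s (t ∷ ws) (q , c) e with fromChain t ws c e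
  ... | w , eq = cons t (sym q) w , cong (t ∷_) eq

  fromWalkFromTo : ∀ {u v} (l : List St) → WalkFromTo Σg u v l → Σ (Walk u v) λ w → steps w ≡ l
  fromWalkFromTo []      p           = nil p , refl
  fromWalkFromTo (s ∷ l) (p , c , e) with fromChain s l c e
  ... | w , eq = cons s p w , cong (s ∷_) eq

  fromClosedWalk : ∀ (s : St) (l : List St) → ClosedWalk Σg (s ∷ l) →
    Σ (Walk (srcS s) (srcS s)) λ w → steps w ≡ s ∷ l
  fromClosedWalk s l (c , e) with fromChain s l c e
  ... | w , eq = cons s refl w , cong (s ∷_) eq

  splitAtSource : ∀ {u v x} (w : Walk u v) → x ∈ sources w →
    Σ (Walk u x) λ A → Σ (Walk x v) λ D → (steps w ≡ steps A ++ steps D) × (1 ≤ len D)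
  splitAtSource (cons s p w) (here e)  = nil (trans (sym p) (sym e)) , cons s (sym e) w , refl , s≤s z≤n
  splitAtSource (cons s p w) (there m) with splitAtSource w m
  ... | A , D , eq , l = cons s p A , D , cong (s ∷_) eq , l

  splitAtTarget : ∀ {u v x} (w : Walk u v) → x ∈ targets w →
    Σ (Walk u x) λ A → Σ (Walk x v) λ D → (steps w ≡ steps A ++ steps D) × (1 ≤ len A)
  splitAtTarget (cons s p w) (here e) =
    cons s p (nil (sym e)) , castˡ e w , cong (s ∷_) (sym (steps-castˡ e w)) , s≤s z≤n
  splitAtTarget (cons s p w) (there m) with splitAtTarget w m
  ... | A , D , eq , l = cons s p A , D , cong (s ∷_) eq , s≤s z≤n

  sourcesUnique⊎closedSubwalk : ∀ {u v} (w : Walk u v) → Unique (sources w) ⊎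
    (Σ V λ x → Σ (Walk u x) λ A → Σ (Walk x x) λ B → Σ (Walk x v) λ D →
      (steps w ≡ steps A ++ steps B ++ steps D) × (1 ≤ len B) × (1 ≤ len D))
  sourcesUnique⊎closedSubwalk (nil p) = inj₁ []
  sourcesUnique⊎closedSubwalk {u} (cons s p w) with sourcesUnique⊎closedSubwalk w
  ... | inj₂ (x , A , B , D , eq , lB , lD) = inj₂ (x , cons s p A , B , D , cong (s ∷_) eq , lB , lD)
  ... | inj₁ uq with _∈?_ _≟_ (srcS s) (sources w)
  ...   | no s∉w = inj₁ (unique-∷ s∉w uq)
  ...   | yes s∈w with splitAtSource w s∈w
  ...     | A , D , eq , lD =
            inj₂ (u , nil refl , cons s p (castʳ A p) , castˡ (sym p) D ,
                  cong (s ∷_) (trans eq (sym (cong₂ _++_ (steps-castʳ A p) (steps-castˡ (sym p) D)))) ,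
                  s≤s z≤n , subst (1 ≤_) (sym (cong length (steps-castˡ (sym p) D))) lD)

  splitAtEdge : ∀ {u v} (w : Walk u v) {e} → e ∈ edgesʷ w →
    Σ Bool λ b → Σ V λ a → Σ (Walk u a) λ A → Σ (Walk (tgtS (e , b)) v) λ B →
      (srcS (e , b) ≡ a) × (steps w ≡ steps A ++ (e , b) ∷ steps B)
  splitAtEdge (cons (e , b) p w) (here refl) = b , _ , nil (sym p) , w , refl , refl
  splitAtEdge (cons s p w) (there m) with splitAtEdge w m
  ... | b , a , A , B , q , eq = b , a , cons s p A , B , q , cong (s ∷_) eq

  edgesUnique⊎repeatedEdge : ∀ {u v} (w : Walk u v) → Unique (edgesʷ w) ⊎
    (Σ St λ s → Σ St λ s' → Σ V λ a → Σ V λ a' → Σ (Walk u a) λ A → Σ (Walk (tgtS s) a') λ B →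
      Σ (Walk (tgtS s') v) λ D → (proj₁ s ≡ proj₁ s') × (srcS s ≡ a) × (srcS s' ≡ a') ×
      (steps w ≡ steps A ++ s ∷ steps B ++ s' ∷ steps D))
  edgesUnique⊎repeatedEdge (nil p) = inj₁ []
  edgesUnique⊎repeatedEdge (cons s p w) with edgesUnique⊎repeatedEdge w
  ... | inj₂ (s₁ , s₂ , a , a' , A , B , D , e , q₁ , q₂ , eq) =
        inj₂ (s₁ , s₂ , a , a' , cons s p A , B , D , e , q₁ , q₂ , cong (s ∷_) eq)
  ... | inj₁ uq with _∈?_ _≟_ (proj₁ s) (edgesʷ w)
  ...   | no e∉w = inj₁ (unique-∷ e∉w uq)
  ...   | yes e∈w with splitAtEdge w e∈w
  ...     | b , a , A , B , q , eq =
            inj₂ (s , (proj₁ s , b) , _ , a , nil (sym p) , A , B , refl , refl , q , cong (s ∷_) eq)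

  sgn : List St → Sign
  sgn = signProd Σg

  sgn-++ : ∀ A B → sgn (A ++ B) ≡ sgn A · sgn B
  sgn-++ []            B = refl
  sgn-++ ((e , b) ∷ A) B = trans (cong (σ e ·_) (sgn-++ A B)) (sym (*-assoc (σ e) (sgn A) (sgn B)))

  sgn-reverseSteps : ∀ A → sgn (reverseSteps A) ≡ sgn A
  sgn-reverseSteps []            = refl
  sgn-reverseSteps ((e , b) ∷ A) = begin
    sgn (reverseSteps A ++ [ e , not b ])  ≡⟨ sgn-++ (reverseSteps A) _ ⟩
    sgn (reverseSteps A) · (σ e · Sign.+)  ≡⟨ cong₂ _·_ (sgn-reverseSteps A) (*-identityʳ (σ e)) ⟩
    sgn A · σ e                            ≡⟨ *-comm (sgn A) (σ e) ⟩
    σ e · sgn A                            ∎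
    where open ≡-Reasoning

  count : Fin nE → List St → ℕ
  count = countE Σg

  count-∷ : ∀ e' e b A → count e' ((e , b) ∷ A) ≡ (if does (e' ≟ e) then 1 else 0) + count e' A
  count-∷ e' e b A with does (e' ≟ e)
  ... | true  = refl
  ... | false = refl

  count-++ : ∀ e A B → count e (A ++ B) ≡ count e A + count e B
  count-++ e []             B = refl
  count-++ e ((e' , b) ∷ A) B = begin
    count e ((e' , b) ∷ A ++ B)                          ≡⟨ count-∷ e e' b (A ++ B) ⟩
    (if does (e ≟ e') then 1 else 0) + count e (A ++ B)  ≡⟨ cong (_ +_) (count-++ e A B) ⟩
    (if does (e ≟ e') then 1 else 0) + (count e A + count e B)
      ≡⟨ sym (+-assoc (if does (e ≟ e') then 1 else 0) _ _) ⟩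
    (if does (e ≟ e') then 1 else 0) + count e A + count e B
      ≡⟨ cong (_+ count e B) (sym (count-∷ e e' b A)) ⟩
    count e ((e' , b) ∷ A) + count e B                   ∎
    where open ≡-Reasoning

  count-reverseSteps : ∀ e A → count e (reverseSteps A) ≡ count e A
  count-reverseSteps e []             = refl
  count-reverseSteps e ((e' , b) ∷ A) = begin
    count e (reverseSteps A ++ [ e' , not b ])                 ≡⟨ count-++ e (reverseSteps A) _ ⟩
    count e (reverseSteps A) + count e [ e' , not b ]          ≡⟨ cong₂ _+_ (count-reverseSteps e A) (count-∷ e e' (not b) []) ⟩
    count e A + ((if does (e ≟ e') then 1 else 0) + 0)        ≡⟨ +-comm (count e A) _ ⟩
    ((if does (e ≟ e') then 1 else 0) + 0) + count e A        ≡⟨ cong (_+ count e A) (+-identityʳ _) ⟩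
    (if does (e ≟ e') then 1 else 0) + count e A              ≡⟨ sym (count-∷ e e' b A) ⟩
    count e ((e' , b) ∷ A)                                     ∎
    where open ≡-Reasoning

  count-handcuff : ∀ e A Z B → count e (A ++ Z ++ B ++ reverseSteps Z) ≡ count e A + count e B + 2 * count e Z
  count-handcuff e A Z B = begin
    count e (A ++ Z ++ B ++ reverseSteps Z)                                ≡⟨ count-++ e A _ ⟩
    count e A + count e (Z ++ B ++ reverseSteps Z)                         ≡⟨ cong (count e A +_) (count-++ e Z _) ⟩
    count e A + (count e Z + count e (B ++ reverseSteps Z))                ≡⟨ cong (λ t → count e A + (count e Z + t)) (count-++ e B _) ⟩
    count e A + (count e Z + (count e B + count e (reverseSteps Z)))
      ≡⟨ cong (λ t → count e A + (count e Z + (count e B + t))) (count-reverseSteps e Z) ⟩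
    count e A + (count e Z + (count e B + count e Z))                      ≡⟨ arith (count e A) (count e Z) (count e B) ⟩
    count e A + count e B + 2 * count e Z                                  ∎
    where
    open ≡-Reasoning
    arith : ∀ a z b → a + (z + (b + z)) ≡ a + b + 2 * z
    arith = solve-∀

module Cycles (Σg : SignedGraph) where

  open import Data.Nat using (ℕ; suc; _+_; _*_; _≤_; _<_; s≤s; z≤n)
  open import Data.Nat.Properties
    using (+-comm; +-cancelˡ-≡; ≤-trans; <-≤-trans; m≤m+n; m≤n+m; m<m+n; m<n+m; +-monoʳ-<; ≤-pred)
  open import Data.Nat.Tactic.RingSolver using (solve-∀)
  open import Data.Bool using (Bool; true; false; not; if_then_else_)
  open import Data.Fin using (Fin; _≟_)
  open import Data.Product using (Σ; _×_; _,_; proj₁)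
  open import Data.Sum using (_⊎_; inj₁; inj₂)
  open import Data.Empty using (⊥-elim)
  open import Data.List using (List; []; _∷_; _++_; map; length; [_])
  open import Data.List.Properties using (map-++; length-++; ++-assoc)
  open import Data.List.Membership.Propositional using (_∈_)
  open import Data.List.Membership.Propositional.Properties using (∈-++⁺ˡ; ∈-++⁺ʳ; ∈-++⁻)
  open import Data.List.Relation.Unary.Any using (here; there)
  open import Data.List.Relation.Unary.Unique.Propositional using (Unique)
  open import Data.List.Relation.Unary.Unique.Propositional.Properties using (Unique[x∷xs]⇒x∉xs)
  open import Data.Sign using (Sign) renaming (_*_ to _·_)
  open import Data.Sign.Properties using (*-comm; *-assoc; *-identityʳ; s*s≡+) renaming (_≟_ to _≟ˢ_)
  open import Relation.Nullary using (¬_; yes; no; does)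
  open import Relation.Binary.PropositionalEquality hiding ([_])
  open ListFacts
  open SignFacts
  open Walks Σg public

  open SignedGraph Σg

  IsCycleʷ : ∀ {x} → Walk x x → Set
  IsCycleʷ c = (1 ≤ len c) × Unique (sources c) × Unique (edgesʷ c)

  closedWalk-steps : ∀ {x} (c : Walk x x) → 1 ≤ len c → ClosedWalk Σg (steps c)
  closedWalk-steps (cons s p w) _ = toClosedWalk s p w

  isCycle-steps : ∀ {x} (c : Walk x x) → IsCycleʷ c → IsCycle Σg (steps c)
  isCycle-steps c (l , uV , uE) = closedWalk-steps c l , uV , uE

  start∈sources : ∀ {x y} (c : Walk x y) → 1 ≤ len c → x ∈ sources c
  start∈sources (cons s p w) _ = here (sym p)

  sources-++ : ∀ A B → map srcS (A ++ B) ≡ map srcS A ++ map srcS B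
  sources-++ = map-++ srcS

  start∷targets : ∀ {a v} (w : Walk a v) → a ∷ targets w ≡ sources w ++ [ v ]
  start∷targets (nil p)      = cong (_∷ []) p
  start∷targets (cons s p w) = cong₂ _∷_ (sym p) (start∷targets w)

  unique⇒≢ : ∀ (pre : List V) {a b} (mid : List V) {post} → Unique (pre ++ a ∷ mid ++ b ∷ post) → ¬ a ≡ b
  unique⇒≢ pre mid u refl = Unique[x∷xs]⇒x∉xs (unique-++⁻ʳ pre u) (∈-++⁺ʳ mid (here refl))

  edgesUnique⊎backtrack : ∀ {x} (c : Walk x x) → Unique (sources c) →
    Unique (edgesʷ c) ⊎ (Σ (Fin nE) λ e → Σ Bool λ b → steps c ≡ (e , b) ∷ (e , not b) ∷ [])
  edgesUnique⊎backtrack c uc with edgesUnique⊎repeatedEdge c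
  ... | inj₁ ue = inj₁ ue
  ... | inj₂ ((e , b) , (.e , b') , a , a' , A , B , D , refl , _ , _ , eq) =
    inj₂ (e , analyse b b' A B D eq (subst Unique (sources-eq A B D eq) uc))
    where
    sources-eq : ∀ {u a a'} (A : Walk u a) (B : Walk (tgtS (e , b)) a') (D : Walk (tgtS (e , b')) u) →
      steps c ≡ steps A ++ (e , b) ∷ steps B ++ (e , b') ∷ steps D →
      sources c ≡ sources A ++ srcS (e , b) ∷ sources B ++ srcS (e , b') ∷ sources D
    sources-eq A B D eq = trans (cong (map srcS) eq)
      (trans (sources-++ (steps A) _) (cong (λ t → sources A ++ srcS (e , b) ∷ t) (sources-++ (steps B) _)))
    backtrack-inner : ∀ {u a a' t} b (A : Walk u a) (B : Walk (tgtS t) a') {post} →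
      Unique (sources A ++ srcS (e , b) ∷ srcS t ∷ sources B ++ srcS (e , not b) ∷ post) → ¬ srcS t ≡ srcS (e , not b)
    backtrack-inner b A B U =
      unique⇒≢ [] (sources B) (unique-++⁻ʳ (sources A ++ [ srcS (e , b) ]) (subst Unique (sym (++-assoc (sources A) _ _)) U))
    analyse : ∀ {u a a'} b b' (A : Walk u a) (B : Walk (tgtS (e , b)) a') (D : Walk (tgtS (e , b')) u) →
      steps c ≡ steps A ++ (e , b) ∷ steps B ++ (e , b') ∷ steps D →
      Unique (sources A ++ srcS (e , b) ∷ sources B ++ srcS (e , b') ∷ sources D) →
      Σ Bool λ b → steps c ≡ (e , b) ∷ (e , not b) ∷ []
    analyse true  true  A B D _ U = ⊥-elim (unique⇒≢ (sources A) (sources B) U refl)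
    analyse false false A B D _ U = ⊥-elim (unique⇒≢ (sources A) (sources B) U refl)
    analyse true false A (cons t q B) D _ U = ⊥-elim (backtrack-inner true A B U q)
    analyse false true A (cons t q B) D _ U = ⊥-elim (backtrack-inner false A B U q)
    analyse true false A (nil q) (cons t q' D) _ U = ⊥-elim (unique⇒≢ [] [ srcS (e , false) ] (unique-++⁻ʳ (sources A) U) (sym q'))
    analyse false true A (nil q) (cons t q' D) _ U = ⊥-elim (unique⇒≢ [] [ srcS (e , true) ] (unique-++⁻ʳ (sources A) U) (sym q'))
    analyse true false (cons t p' A) (nil q) (nil q') _ U = ⊥-elim (unique⇒≢ [] (sources A) U (trans p' (sym q')))
    analyse false true (cons t p' A) (nil q) (nil q') _ U = ⊥-elim (unique⇒≢ [] (sources A) U (trans p' (sym q')))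
    analyse true  false (nil p') (nil q) (nil q') eq U = true , eq
    analyse false true  (nil p') (nil q) (nil q') eq U = false , eq

  sgn-backtrack : ∀ e b → sgn ((e , b) ∷ (e , not b) ∷ []) ≡ Sign.+
  sgn-backtrack e b = trans (cong (σ e ·_) (*-identityʳ (σ e))) (s*s≡+ (σ e))

  len-split : ∀ {u v a} (w : Walk u v) (A : Walk u a) (B : Walk a v) → steps w ≡ steps A ++ steps B →
    len w ≡ len A + len B
  len-split w A B eq = trans (cong length eq) (length-++ (steps A))

  sgn-split : ∀ {u v a} (w : Walk u v) (A : Walk u a) (B : Walk a v) → steps w ≡ steps A ++ steps B →
    sgn (steps w) ≡ sgn (steps A) · sgn (steps B)
  sgn-split w A B eq = trans (cong sgn eq) (sgn-++ (steps A) (steps B))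

  module Split₃ {u a v} (X : Walk u v) (A : Walk u a) (B : Walk a a) (D : Walk a v)
                (eq : steps X ≡ steps A ++ steps B ++ steps D) where

    len-split₃ : len X ≡ len A + (len B + len D)
    len-split₃ = trans (cong length eq) (trans (length-++ (steps A)) (cong (len A +_) (length-++ (steps B))))

    len-middle< : 1 ≤ len D → len B < len X
    len-middle< lD = subst (len B <_) (sym len-split₃)
      (<-≤-trans (m<m+n (len B) lD) (m≤n+m (len B + len D) (len A)))

    len-outer< : 1 ≤ len B → len (A ++ʷ D) < len X
    len-outer< lB = subst₂ _<_ (sym (len-++ʷ A D)) (sym len-split₃) (+-monoʳ-< (len A) (m<n+m (len D) lB))

    sgn-split₃ : sgn (steps X) ≡ sgn (steps A) · (sgn (steps B) · sgn (steps D))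
    sgn-split₃ = trans (cong sgn eq) (trans (sgn-++ (steps A) _) (cong (sgn (steps A) ·_) (sgn-++ (steps B) (steps D))))

    sgn-outer : sgn (steps (A ++ʷ D)) ≡ sgn (steps A) · sgn (steps D)
    sgn-outer = trans (cong sgn (steps-++ʷ A D)) (sgn-++ (steps A) (steps D))

    sgn-outer-balanced : sgn (steps B) ≡ Sign.+ → sgn (steps (A ++ʷ D)) ≡ sgn (steps X)
    sgn-outer-balanced bB =
      trans sgn-outer (trans (cong (λ z → sgn (steps A) · (z · sgn (steps D))) (sym bB)) (sym sgn-split₃))

    sources-split₃ : sources X ≡ sources A ++ sources B ++ sources D
    sources-split₃ = trans (cong (map srcS) eq) (trans (sources-++ (steps A) _) (cong (sources A ++_) (sources-++ (steps B) (steps D))))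

    middle⊆ : ∀ {y} → y ∈ sources B → y ∈ sources X
    middle⊆ m = subst (_ ∈_) (sym sources-split₃) (∈-++⁺ʳ (sources A) (∈-++⁺ˡ m))

    outer⊆ : ∀ {y} → y ∈ sources (A ++ʷ D) → y ∈ sources X
    outer⊆ m with ∈-++⁻ (sources A) (subst (_ ∈_) (trans (cong (map srcS) (steps-++ʷ A D)) (sources-++ (steps A) (steps D))) m)
    ... | inj₁ m' = subst (_ ∈_) (sym sources-split₃) (∈-++⁺ˡ m')
    ... | inj₂ m' = subst (_ ∈_) (sym sources-split₃) (∈-++⁺ʳ (sources A) (∈-++⁺ʳ (sources B) m'))

  -- The first argument bounds the length of the walk and makes the recursion structural.
  unbalancedCycle : ∀ k {x} (X : Walk x x) → len X ≤ k → sgn (steps X) ≡ Sign.- →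
    Σ V λ y → Σ (Walk y y) λ C → IsCycleʷ C × (sgn (steps C) ≡ Sign.-) × (∀ {a} → a ∈ sources C → a ∈ sources X)
  unbalancedCycle k X@(cons _ _ _) l u with sourcesUnique⊎closedSubwalk X
  ... | inj₁ uV with edgesUnique⊎backtrack X uV
  ...   | inj₁ uE = _ , X , (s≤s z≤n , uV , uE) , u , λ m → m
  ...   | inj₂ (e , b , eq) = ⊥-elim (+≢- (trans (sym (sgn-backtrack e b)) (trans (cong sgn (sym eq)) u)))
  unbalancedCycle (suc k) X@(cons _ _ _) l u | inj₂ (_ , A , B , D , eq , lB , lD) with sgn (steps B) ≟ˢ Sign.+
  ... | no B-unbalanced =
    let y , C , cyc , uC , C⊆B = unbalancedCycle k B (≤-pred (≤-trans (len-middle< lD) l)) (≢+⇒≡- B-unbalanced)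
    in  y , C , cyc , uC , λ m → middle⊆ (C⊆B m)
    where open Split₃ X A B D eq
  ... | yes B-balanced =
    let y , C , cyc , uC , C⊆AD = unbalancedCycle k (A ++ʷ D) (≤-pred (≤-trans (len-outer< lB) l))
                                             (trans (sgn-outer-balanced B-balanced) u)
    in  y , C , cyc , uC , λ m → outer⊆ (C⊆AD m)
    where open Split₃ X A B D eq

  sources-around : ∀ {u v a} (A : Walk u a) (s : St) (B : Walk (tgtS s) v) l → l ≡ steps A ++ s ∷ steps B →
    map srcS l ≡ sources A ++ srcS s ∷ sources B
  sources-around A s B l eq = trans (cong (map srcS) eq) (sources-++ (steps A) _)

  endpoint∈sources : ∀ {x} (c : Walk x x) → 1 ≤ len c → ∀ {e} → e ∈ edgesʷ c → ∀ b → endpoint e b ∈ sources c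
  endpoint∈sources {x} c l {e} m b with splitAtEdge c m
  ... | b₀ , _ , A , B , _ , eq = go b b₀ B eq
    where
    src∈ : ∀ b₀ (B : Walk (tgtS (e , b₀)) x) → steps c ≡ steps A ++ (e , b₀) ∷ steps B → endpoint e b₀ ∈ sources c
    src∈ b₀ B eq = subst (endpoint e b₀ ∈_) (sym (sources-around A (e , b₀) B (steps c) eq)) (∈-++⁺ʳ (sources A) (here refl))
    tgt∈ : ∀ b₀ (B : Walk (tgtS (e , b₀)) x) → steps c ≡ steps A ++ (e , b₀) ∷ steps B → endpoint e (not b₀) ∈ sources c
    tgt∈ b₀ (nil q)      eq = subst (_∈ sources c) (sym q) (start∈sources c l)
    tgt∈ b₀ (cons t q B) eq = subst (endpoint e (not b₀) ∈_) (sym (sources-around A (e , b₀) (cons t q B) (steps c) eq))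
      (∈-++⁺ʳ (sources A) (there (here (sym q))))
    go : ∀ b b₀ (B : Walk (tgtS (e , b₀)) x) → steps c ≡ steps A ++ (e , b₀) ∷ steps B → endpoint e b ∈ sources c
    go true  true  = src∈ true
    go false false = src∈ false
    go false true  = tgt∈ true
    go true  false = tgt∈ false

  loop-cycle : ∀ {x} (c : Walk x x) → Unique (sources c) → ∀ {e} → e ∈ edgesʷ c →
    endpoint e false ≡ endpoint e true → Σ Bool λ b → steps c ≡ (e , b) ∷ []
  loop-cycle {x} c U {e} m loop with splitAtEdge c m
  ... | b₀ , _ , A , B , _ , eq = go A B eq (subst Unique (sources-around A (e , b₀) B (steps c) eq) U)
    where
    loop′ : endpoint e (not b₀) ≡ endpoint e b₀
    loop′ = flipped b₀
      where
      flipped : ∀ b → endpoint e (not b) ≡ endpoint e b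
      flipped true  = loop
      flipped false = sym loop
    go : ∀ {a} (A : Walk x a) (B : Walk (tgtS (e , b₀)) x) → steps c ≡ steps A ++ (e , b₀) ∷ steps B →
      Unique (sources A ++ srcS (e , b₀) ∷ sources B) → Σ Bool λ b → steps c ≡ (e , b) ∷ []
    go A (cons t q B) _ U = ⊥-elim (unique⇒≢ (sources A) [] U (sym (trans q loop′)))
    go (cons t p A) (nil q) _ U = ⊥-elim (unique⇒≢ [] (sources A) U (trans p (trans (sym q) loop′)))
    go (nil p) (nil q) eq U = b₀ , eq

  module Rotation {x y} (C : Walk x x) (A₁ : Walk x y) (A₂ : Walk y x) (eq : steps C ≡ steps A₁ ++ steps A₂) where

    len-rotate : len (A₂ ++ʷ A₁) ≡ len C
    len-rotate = trans (len-++ʷ A₂ A₁) (trans (+-comm (len A₂) (len A₁)) (sym (len-split C A₁ A₂ eq)))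

    sgn-rotate : sgn (steps (A₂ ++ʷ A₁)) ≡ sgn (steps C)
    sgn-rotate = trans (cong sgn (steps-++ʷ A₂ A₁))
      (trans (sgn-++ (steps A₂) (steps A₁)) (trans (*-comm (sgn (steps A₂)) (sgn (steps A₁))) (sym (sgn-split C A₁ A₂ eq))))

    isCycle-rotate : 1 ≤ len A₂ → IsCycleʷ C → IsCycleʷ (A₂ ++ʷ A₁)
    isCycle-rotate l (_ , uV , uE) =
      subst (1 ≤_) (sym (len-++ʷ A₂ A₁)) (≤-trans l (m≤m+n (len A₂) (len A₁))) ,
      subst Unique (sym (trans (cong (map srcS) (steps-++ʷ A₂ A₁)) (map-++ srcS (steps A₂) (steps A₁))))
        (unique-++-comm (sources A₁) (subst Unique (trans (cong (map srcS) eq) (map-++ srcS (steps A₁) (steps A₂))) uV)) ,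
      subst Unique (sym (trans (cong (map proj₁) (steps-++ʷ A₂ A₁)) (map-++ proj₁ (steps A₂) (steps A₁))))
        (unique-++-comm (edgesʷ A₁) (subst Unique (trans (cong (map proj₁) eq) (map-++ proj₁ (steps A₁) (steps A₂))) uE))

  occurrence : ∀ e B → 1 ≤ count e B → Σ (List St) λ B₁ → Σ Bool λ b → Σ (List St) λ B₂ → B ≡ B₁ ++ (e , b) ∷ B₂
  occurrence e ((e' , b') ∷ B) l with e ≟ e'
  ... | yes refl = [] , b' , B , refl
  ... | no _ with occurrence e B l
  ...   | B₁ , b , B₂ , eq = (e' , b') ∷ B₁ , b , B₂ , cong ((e' , b') ∷_) eq

  count-self : ∀ e b A → count e ((e , b) ∷ A) ≡ suc (count e A)
  count-self e b A with e ≟ e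
  ... | yes _ = refl
  ... | no e≢e = ⊥-elim (e≢e refl)

  sgn-count : ∀ A B → (∀ e → count e A ≡ count e B) → sgn A ≡ sgn B
  sgn-count [] [] _ = refl
  sgn-count [] ((e , b) ∷ B) h with () ← trans (h e) (count-self e b B)
  sgn-count ((e , b) ∷ A) B h with occurrence e B (subst (1 ≤_) (trans (sym (count-self e b A)) (h e)) (s≤s z≤n))
  ... | B₁ , b' , B₂ , refl = begin
    σ e · sgn A                    ≡⟨ cong (σ e ·_) (sgn-count A (B₁ ++ B₂) counts) ⟩
    σ e · sgn (B₁ ++ B₂)           ≡⟨ cong (σ e ·_) (sgn-++ B₁ B₂) ⟩
    σ e · (sgn B₁ · sgn B₂)        ≡⟨ sym (*-assoc (σ e) (sgn B₁) (sgn B₂)) ⟩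
    σ e · sgn B₁ · sgn B₂          ≡⟨ cong (_· sgn B₂) (*-comm (σ e) (sgn B₁)) ⟩
    sgn B₁ · σ e · sgn B₂          ≡⟨ *-assoc (sgn B₁) (σ e) (sgn B₂) ⟩
    sgn B₁ · sgn ((e , b') ∷ B₂)   ≡⟨ sym (sgn-++ B₁ ((e , b') ∷ B₂)) ⟩
    sgn (B₁ ++ (e , b') ∷ B₂)      ∎
    where
    open ≡-Reasoning
    δ : Fin nE → ℕ
    δ e' = if does (e' ≟ e) then 1 else 0
    counts : ∀ e' → count e' A ≡ count e' (B₁ ++ B₂)
    counts e' = +-cancelˡ-≡ (δ e') _ _ (begin
      δ e' + count e' A                        ≡⟨ sym (count-∷ e' e b A) ⟩
      count e' ((e , b) ∷ A)                   ≡⟨ h e' ⟩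
      count e' (B₁ ++ (e , b') ∷ B₂)           ≡⟨ count-++ e' B₁ _ ⟩
      count e' B₁ + count e' ((e , b') ∷ B₂)   ≡⟨ cong (count e' B₁ +_) (count-∷ e' e b' B₂) ⟩
      count e' B₁ + (δ e' + count e' B₂)       ≡⟨ swap (count e' B₁) (δ e') (count e' B₂) ⟩
      δ e' + (count e' B₁ + count e' B₂)       ≡⟨ cong (δ e' +_) (sym (count-++ e' B₁ B₂)) ⟩
      δ e' + count e' (B₁ ++ B₂)               ∎)
      where
      swap : ∀ a b c → a + (b + c) ≡ b + (a + c)
      swap = solve-∀

  sgn-unbalanced : ∀ l → ¬ Balanced Σg l → sgn l ≡ Sign.-
  sgn-unbalanced l = ≢+⇒≡-

  sgn≡-⇒unbalanced : ∀ {l} → sgn l ≡ Sign.- → ¬ Balanced Σg l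
  sgn≡-⇒unbalanced u b = +≢- (trans (sym b) u)

  -- Handcuffs consist of two unbalanced cycles and a path traversed twice.
  circuitWalk-balanced : ∀ m → CircuitMult Σg m → ∀ W → (∀ e → count e W ≡ m e) → sgn W ≡ Sign.+
  circuitWalk-balanced _ (balancedCycle W' _ bal) W h = trans (sgn-count W W' h) bal
  circuitWalk-balanced _ (tightHandcuff W₁ W₂ _ _ nb₁ nb₂ _ _ _ _ _) W h = begin
    sgn W               ≡⟨ sgn-count W (W₁ ++ W₂) (λ e → trans (h e) (sym (count-++ e W₁ W₂))) ⟩
    sgn (W₁ ++ W₂)      ≡⟨ sgn-++ W₁ W₂ ⟩
    sgn W₁ · sgn W₂     ≡⟨ cong₂ _·_ (sgn-unbalanced W₁ nb₁) (sgn-unbalanced W₂ nb₂) ⟩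
    Sign.+              ∎
    where open ≡-Reasoning
  circuitWalk-balanced _ (looseHandcuff W₁ W₂ _ _ nb₁ nb₂ _ s ws _ _ _ _ _) W h = begin
    sgn W                             ≡⟨ sgn-count W (W₁ ++ W₂ ++ P ++ P) (λ e → trans (h e) (sym (counts e))) ⟩
    sgn (W₁ ++ W₂ ++ P ++ P)          ≡⟨ sgn-++ W₁ _ ⟩
    sgn W₁ · sgn (W₂ ++ P ++ P)       ≡⟨ cong (sgn W₁ ·_) (sgn-++ W₂ _) ⟩
    sgn W₁ · (sgn W₂ · sgn (P ++ P))  ≡⟨ cong (λ z → sgn W₁ · (sgn W₂ · z)) (trans (sgn-++ P P) (s*s≡+ (sgn P))) ⟩
    sgn W₁ · (sgn W₂ · Sign.+)        ≡⟨ cong₂ (λ a b → a · (b · Sign.+)) (sgn-unbalanced W₁ nb₁) (sgn-unbalanced W₂ nb₂) ⟩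
    Sign.+                            ∎
    where
    open ≡-Reasoning
    P = s ∷ ws
    counts : ∀ e → count e (W₁ ++ W₂ ++ P ++ P) ≡ count e W₁ + count e W₂ + 2 * count e P
    counts e = trans (count-++ e W₁ _)
      (trans (cong (count e W₁ +_) (trans (count-++ e W₂ _) (cong (count e W₂ +_) (count-++ e P P))))
             (arith (count e W₁) (count e W₂) (count e P)))
      where
      arith : ∀ a b c → a + (b + (c + c)) ≡ a + b + 2 * c
      arith = solve-∀

module TwistedSums (Σg : SignedGraph) (ω : Orientation Σg) (compat : Compatible Σg ω)
                   {n : ℕ} (plus : Fin n → Fin n → Fin n) (0# : Fin n) (neg : Fin n → Fin n)
                   (isAG : IsAbelianGroup _≡_ plus 0# neg) where

  open import Relation.Binary.PropositionalEquality hiding ([_])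
  open import Data.Bool using (false; true; not)
  open import Data.Vec using (Vec; []; _∷_; lookup)
  open import Data.Product using (_×_; _,_)
  open import Data.Unit using (tt)
  open import Data.List using (List; []; _∷_; _++_; [_])
  open import Data.Sign using (Sign; opposite) renaming (_*_ to _·_)
  open import Data.Sign.Properties using (*-comm; *-assoc; *-identityʳ)
  open SignFacts

  open Cycles Σg public
  open AbelianGroupSolver plus 0# neg isAG public
  open SignedGraph Σg
  open ≡-Reasoning

  G : Set
  G = Fin n

  actS : Sign → G → G
  actS = act Σg ω plus 0# neg

  twistedFrom : Vec G nE → Sign → List St → G
  twistedFrom = twistedSum Σg ω plus 0# neg

  σ-via-ω : ∀ e b → σ e ≡ opposite (ω e b · ω e (not b))
  σ-via-ω e false = compat e
  σ-via-ω e true = trans (compat e) (cong opposite (*-comm (ω e false) (ω e true)))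

  σ≡-⇒ω≡ : ∀ e → σ e ≡ Sign.- → ω e false ≡ ω e true
  σ≡-⇒ω≡ e σe≡- = -≡opposite·⇒≡ (ω e false) (ω e true) (trans (sym σe≡-) (compat e))

  actS-⊕ : ∀ s x y → actS s (x ⊕ y) ≡ actS s x ⊕ actS s y
  actS-⊕ Sign.+ x y = refl
  actS-⊕ Sign.- x y = ⊖-distrib-⊕ x y

  actS-0# : ∀ s → actS s 0# ≡ 0#
  actS-0# Sign.+ = refl
  actS-0# Sign.- = ε⁻¹≈ε

  actS-· : ∀ a b x → actS (a · b) x ≡ actS a (actS b x)
  actS-· Sign.+ b x = refl
  actS-· Sign.- Sign.+ x = refl
  actS-· Sign.- Sign.- x = sym (⁻¹-involutive x)

  twistedFrom-sign : ∀ f s l → twistedFrom f s l ≡ actS s (twistedFrom f Sign.+ l)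
  twistedFrom-sign f s [] = sym (actS-0# s)
  twistedFrom-sign f s ((e , b) ∷ l) = begin
    actS (ω e b · s) (lookup f e) ⊕ twistedFrom f (s · σ e) l
      ≡⟨ cong₂ _⊕_ (trans (cong (λ z → actS z (lookup f e)) (*-comm (ω e b) s)) (actS-· s (ω e b) _))
                   (trans (twistedFrom-sign f (s · σ e) l) (actS-· s (σ e) _)) ⟩
    actS s (actS (ω e b) (lookup f e)) ⊕ actS s (actS (σ e) (twistedFrom f Sign.+ l))
      ≡⟨ sym (actS-⊕ s _ _) ⟩
    actS s (actS (ω e b) (lookup f e) ⊕ actS (σ e) (twistedFrom f Sign.+ l))
      ≡⟨ cong₂ (λ z w → actS s (actS z (lookup f e) ⊕ w)) (sym (*-identityʳ (ω e b))) (sym (twistedFrom-sign f (σ e) l)) ⟩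
    actS s (actS (ω e b · Sign.+) (lookup f e) ⊕ twistedFrom f (Sign.+ · σ e) l)  ∎

  twisted : Vec G nE → List St → G
  twisted f l = twistedFrom f Sign.+ l

  twistedFrom-++ : ∀ f s A B → twistedFrom f s (A ++ B) ≡ twistedFrom f s A ⊕ twistedFrom f (s · sgn A) B
  twistedFrom-++ f s [] B = trans (sym (identityˡ _)) (cong (λ z → 0# ⊕ twistedFrom f z B) (sym (*-identityʳ s)))
  twistedFrom-++ f s ((e , b) ∷ A) B = begin
    actS (ω e b · s) (lookup f e) ⊕ twistedFrom f (s · σ e) (A ++ B)
      ≡⟨ cong (actS (ω e b · s) (lookup f e) ⊕_) (twistedFrom-++ f (s · σ e) A B) ⟩
    actS (ω e b · s) (lookup f e) ⊕ (twistedFrom f (s · σ e) A ⊕ twistedFrom f (s · σ e · sgn A) B)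
      ≡⟨ sym (assoc _ _ _) ⟩
    (actS (ω e b · s) (lookup f e) ⊕ twistedFrom f (s · σ e) A) ⊕ twistedFrom f (s · σ e · sgn A) B
      ≡⟨ cong (λ z → (actS (ω e b · s) (lookup f e) ⊕ twistedFrom f (s · σ e) A) ⊕ twistedFrom f z B) (*-assoc s (σ e) (sgn A)) ⟩
    (actS (ω e b · s) (lookup f e) ⊕ twistedFrom f (s · σ e) A) ⊕ twistedFrom f (s · (σ e · sgn A)) B ∎

  twisted-reverseSteps : ∀ f A → twisted f (reverseSteps A) ≡ ⊖ actS (sgn A) (twisted f A)
  twisted-reverseSteps f [] = sym ε⁻¹≈ε
  twisted-reverseSteps f ((e , b) ∷ A) = begin
    twistedFrom f Sign.+ (reverseSteps A ++ [ (e , not b) ])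
      ≡⟨ twistedFrom-++ f Sign.+ (reverseSteps A) _ ⟩
    twistedFrom f Sign.+ (reverseSteps A) ⊕ (actS (ω e (not b) · sgn (reverseSteps A)) (lookup f e) ⊕ 0#)
      ≡⟨ cong₂ (λ u v → u ⊕ (actS (ω e (not b) · v) (lookup f e) ⊕ 0#)) (twisted-reverseSteps f A) (sgn-reverseSteps A) ⟩
    ⊖ actS (sgn A) (twistedFrom f Sign.+ A) ⊕ (actS (ω e (not b) · sgn A) (lookup f e) ⊕ 0#)
      ≡⟨ reverse-step (ω e b) (ω e (not b)) (σ e) (sgn A) (σ-via-ω e b) (lookup f e) (twistedFrom f Sign.+ A) ⟩
    ⊖ actS (σ e · sgn A) (actS (ω e b · Sign.+) (lookup f e) ⊕ actS (σ e) (twistedFrom f Sign.+ A))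
      ≡⟨ cong (λ z → ⊖ actS (σ e · sgn A) (actS (ω e b · Sign.+) (lookup f e) ⊕ z)) (sym (twistedFrom-sign f (σ e) A)) ⟩
    ⊖ actS (σ e · sgn A) (actS (ω e b · Sign.+) (lookup f e) ⊕ twistedFrom f (Sign.+ · σ e) A) ∎
    where
    reverse-step : ∀ a c sg s → sg ≡ opposite (a · c) → ∀ x y →
      ⊖ actS s y ⊕ (actS (c · s) x ⊕ 0#) ≡ ⊖ actS (sg · s) (actS (a · Sign.+) x ⊕ actS sg y)
    reverse-step Sign.+ Sign.+ .Sign.- Sign.+ refl x y = prove (:- x1 :+ (x0 :+ :0)) (:- (:- (x0 :+ :- x1))) tt (x ∷ y ∷ [])
    reverse-step Sign.+ Sign.+ .Sign.- Sign.- refl x y = prove (:- (:- x1) :+ (:- x0 :+ :0)) (:- (x0 :+ :- x1)) tt (x ∷ y ∷ [])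
    reverse-step Sign.+ Sign.- .Sign.+ Sign.+ refl x y = prove (:- x1 :+ (:- x0 :+ :0)) (:- (x0 :+ x1)) tt (x ∷ y ∷ [])
    reverse-step Sign.+ Sign.- .Sign.+ Sign.- refl x y = prove (:- (:- x1) :+ (x0 :+ :0)) (:- (:- (x0 :+ x1))) tt (x ∷ y ∷ [])
    reverse-step Sign.- Sign.+ .Sign.+ Sign.+ refl x y = prove (:- x1 :+ (x0 :+ :0)) (:- (:- x0 :+ x1)) tt (x ∷ y ∷ [])
    reverse-step Sign.- Sign.+ .Sign.+ Sign.- refl x y = prove (:- (:- x1) :+ (:- x0 :+ :0)) (:- (:- (:- x0 :+ x1))) tt (x ∷ y ∷ [])
    reverse-step Sign.- Sign.- .Sign.- Sign.+ refl x y = prove (:- x1 :+ (:- x0 :+ :0)) (:- (:- (:- x0 :+ :- x1))) tt (x ∷ y ∷ [])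
    reverse-step Sign.- Sign.- .Sign.- Sign.- refl x y = prove (:- (:- x1) :+ (x0 :+ :0)) (:- (:- x0 :+ :- x1)) tt (x ∷ y ∷ [])

  twisted-backtrack : ∀ f e b → twisted f ((e , b) ∷ (e , not b) ∷ []) ≡ 0#
  twisted-backtrack f e b = cancel (ω e b) (ω e (not b)) (σ e) (σ-via-ω e b) (lookup f e)
    where
    cancel : ∀ a c s → s ≡ opposite (a · c) → ∀ x → actS (a · Sign.+) x ⊕ (actS (c · s) x ⊕ 0#) ≡ 0#
    cancel Sign.+ Sign.+ .Sign.- refl x = prove (x0 :+ (:- x0 :+ :0)) :0 tt (x ∷ [])
    cancel Sign.+ Sign.- .Sign.+ refl x = prove (x0 :+ (:- x0 :+ :0)) :0 tt (x ∷ [])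
    cancel Sign.- Sign.+ .Sign.+ refl x = prove (:- x0 :+ (x0 :+ :0)) :0 tt (x ∷ [])
    cancel Sign.- Sign.- .Sign.- refl x = prove (:- x0 :+ (x0 :+ :0)) :0 tt (x ∷ [])

  twisted-++ : ∀ f A B → twisted f (A ++ B) ≡ twisted f A ⊕ actS (sgn A) (twisted f B)
  twisted-++ f A B = trans (twistedFrom-++ f Sign.+ A B) (cong (twisted f A ⊕_) (twistedFrom-sign f (sgn A) B))

  -- If P runs from x to y and C is an unbalanced closed walk at y, the closed walk
  -- P C P⁻¹ at x is unbalanced with twisted sum conjAlong f P (twisted f C).
  conj : G → Sign → G → G
  conj t s y = (t ⊕ t) ⊕ actS s y

  conjAlong : Vec G nE → List St → G → G
  conjAlong f P = conj (twisted f P) (sgn P)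

  conjAlong-++ : ∀ f A B y → conjAlong f (A ++ B) y ≡ conjAlong f A (conjAlong f B y)
  conjAlong-++ f A B y = begin
    conj (twisted f (A ++ B)) (sgn (A ++ B)) y
      ≡⟨ cong₂ (λ t s → conj t s y) (twisted-++ f A B) (sgn-++ A B) ⟩
    conj (twisted f A ⊕ actS (sgn A) (twisted f B)) (sgn A · sgn B) y
      ≡⟨ compose (sgn A) (sgn B) (twisted f A) (twisted f B) y ⟩
    conj (twisted f A) (sgn A) (conj (twisted f B) (sgn B) y) ∎
    where
    compose : ∀ a b ta tb y → conj (ta ⊕ actS a tb) (a · b) y ≡ conj ta a (conj tb b y)
    compose Sign.+ Sign.+ ta tb y = prove ((x0 :+ x1) :+ (x0 :+ x1) :+ x2) ((x0 :+ x0) :+ ((x1 :+ x1) :+ x2)) tt (ta ∷ tb ∷ y ∷ [])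
    compose Sign.+ Sign.- ta tb y = prove ((x0 :+ x1) :+ (x0 :+ x1) :+ (:- x2)) ((x0 :+ x0) :+ ((x1 :+ x1) :+ :- x2)) tt (ta ∷ tb ∷ y ∷ [])
    compose Sign.- Sign.+ ta tb y = prove ((x0 :+ :- x1) :+ (x0 :+ :- x1) :+ (:- x2)) ((x0 :+ x0) :+ :- ((x1 :+ x1) :+ x2)) tt (ta ∷ tb ∷ y ∷ [])
    compose Sign.- Sign.- ta tb y = prove ((x0 :+ :- x1) :+ (x0 :+ :- x1) :+ x2) ((x0 :+ x0) :+ :- ((x1 :+ x1) :+ :- x2)) tt (ta ∷ tb ∷ y ∷ [])

  conjAlong-trivial : ∀ f L y → twisted f L ≡ 0# → sgn L ≡ Sign.+ → conjAlong f L y ≡ y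
  conjAlong-trivial f L y t s rewrite t | s = prove ((:0 :+ :0) :+ x0) x0 tt (y ∷ [])

  twisted-cancel-reverse : ∀ f A B → twisted f (A ++ reverseSteps B) ≡ 0# → sgn (A ++ reverseSteps B) ≡ Sign.+ →
    (twisted f A ≡ twisted f B) × (sgn A ≡ sgn B)
  twisted-cancel-reverse f A B t s = cancel (sgn A) (sgn B) same-sign (twisted f A) (twisted f B) vanishes , same-sign
    where
    same-sign : sgn A ≡ sgn B
    same-sign = ·≡+⇒≡ (sgn A) (sgn B)
      (trans (cong (sgn A ·_) (sym (sgn-reverseSteps B))) (trans (sym (sgn-++ A (reverseSteps B))) s))
    vanishes : twisted f A ⊕ actS (sgn A) (⊖ actS (sgn B) (twisted f B)) ≡ 0#
    vanishes = trans (cong (λ z → twisted f A ⊕ actS (sgn A) z) (sym (twisted-reverseSteps f B)))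
               (trans (sym (twisted-++ f A (reverseSteps B))) t)
    cancel : ∀ a b → a ≡ b → ∀ x y → x ⊕ actS a (⊖ actS b y) ≡ 0# → x ≡ y
    cancel Sign.+ .Sign.+ refl x y e =
      trans (sym (prove ((x0 :+ :- x1) :+ x1) x0 tt (x ∷ y ∷ []))) (trans (cong (_⊕ y) e) (identityˡ y))
    cancel Sign.- .Sign.- refl x y e =
      trans (sym (prove ((x0 :+ :- (:- (:- x1))) :+ x1) x0 tt (x ∷ y ∷ []))) (trans (cong (_⊕ y) e) (identityˡ y))

module CircuitEquations (Σg : SignedGraph) (ω : Orientation Σg) (compat : Compatible Σg ω)
                        {n : ℕ} (plus : Fin n → Fin n → Fin n) (0# : Fin n) (neg : Fin n → Fin n)
                        (isAG : IsAbelianGroup _≡_ plus 0# neg)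
                        (f : Vec (Fin n) (SignedGraph.nE Σg)) (tension : IsTension Σg ω plus 0# neg f) where

  open import Relation.Binary.PropositionalEquality hiding ([_])
  open import Data.Nat using (_+_; _*_; _≤_)
  open import Data.Nat.Properties using (≤-trans; m≤m+n)
  open import Data.Product using (_,_; proj₁)
  open import Data.Empty using (⊥)
  open import Data.List using (List; _∷_; _++_; [_])
  open import Data.List.Membership.Propositional using (_∈_)
  open import Data.List.Relation.Unary.Unique.Propositional using (Unique)
  open import Data.Sign using (Sign)
  open TwistedSums Σg ω compat plus 0# neg isAG public

  1≤len-++ʷ : ∀ {x y z} (a : Walk x y) (b : Walk y z) → 1 ≤ len a → 1 ≤ len (a ++ʷ b)
  1≤len-++ʷ a b l = subst (1 ≤_) (sym (len-++ʷ a b)) (≤-trans l (m≤m+n (len a) (len b)))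

  twisted-balancedCycle : ∀ {x} (c : Walk x x) → IsCycleʷ c → sgn (steps c) ≡ Sign.+ → twisted f (steps c) ≡ 0#
  twisted-balancedCycle c cyc bal = tension (steps c)
    (closedWalk-steps c (proj₁ cyc) , (λ e → count e (steps c)) , balancedCycle (steps c) (isCycle-steps c cyc) bal , λ e → refl)

  twisted-tightHandcuff : ∀ {x} (c₁ c₂ : Walk x x) → IsCycleʷ c₁ → IsCycleʷ c₂ →
    sgn (steps c₁) ≡ Sign.- → sgn (steps c₂) ≡ Sign.- →
    (∀ u → u ∈ sources c₁ → u ∈ sources c₂ → u ≡ x) → (∀ e → e ∈ edgesʷ c₁ → e ∈ edgesʷ c₂ → ⊥) →
    twisted f (steps c₁ ++ steps c₂) ≡ 0#
  twisted-tightHandcuff {x} c₁ c₂ cyc₁ cyc₂ u₁ u₂ shared disjoint = subst (λ l → twisted f l ≡ 0#) (steps-++ʷ c₁ c₂)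
    (tension (steps (c₁ ++ʷ c₂))
      (closedWalk-steps (c₁ ++ʷ c₂) (1≤len-++ʷ c₁ c₂ (proj₁ cyc₁)) ,
       (λ e → count e (steps c₁) + count e (steps c₂)) ,
       tightHandcuff (steps c₁) (steps c₂) (isCycle-steps c₁ cyc₁) (isCycle-steps c₂ cyc₂)
         (sgn≡-⇒unbalanced {steps c₁} u₁) (sgn≡-⇒unbalanced {steps c₂} u₂) disjoint x
         (start∈sources c₁ (proj₁ cyc₁)) (start∈sources c₂ (proj₁ cyc₂)) shared ,
       λ e → trans (cong (count e) (steps-++ʷ c₁ c₂)) (count-++ e (steps c₁) (steps c₂))))

  twisted-looseHandcuff : ∀ {x y} (c₁ : Walk x x) (c₂ : Walk y y) (z : Walk x y) → IsCycleʷ c₁ → IsCycleʷ c₂ →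
    sgn (steps c₁) ≡ Sign.- → sgn (steps c₂) ≡ Sign.- →
    (∀ u → u ∈ sources c₁ → u ∈ sources c₂ → ⊥) → 1 ≤ len z → Unique (sources z ++ [ y ]) →
    (∀ u → u ∈ sources z ++ [ y ] → u ∈ sources c₁ → u ≡ x) →
    (∀ u → u ∈ sources z ++ [ y ] → u ∈ sources c₂ → u ≡ y) →
    twisted f (steps c₁ ++ steps z ++ steps c₂ ++ reverseSteps (steps z)) ≡ 0#
  twisted-looseHandcuff {x} {y} c₁ c₂ z@(cons s p w) cyc₁ cyc₂ u₁ u₂ disjoint _ uz meet₁ meet₂ =
    subst (λ l → twisted f l ≡ 0#) steps-walk
      (tension (steps walk)
        (closedWalk-steps walk (1≤len-++ʷ c₁ _ (proj₁ cyc₁)) , _ ,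
         looseHandcuff (steps c₁) (steps c₂) (isCycle-steps c₁ cyc₁) (isCycle-steps c₂ cyc₂)
           (sgn≡-⇒unbalanced {steps c₁} u₁) (sgn≡-⇒unbalanced {steps c₂} u₂) disjoint s (steps w)
           (chain-steps s p w , subst Unique (sym pathVertices-z) uz)
           (subst (_∈ sources c₁) (sym p) (start∈sources c₁ (proj₁ cyc₁)))
           (subst (_∈ sources c₂) (sym (tgt-lastStep s p w)) (start∈sources c₂ (proj₁ cyc₂)))
           (λ u m₁ m₂ → trans (meet₁ u (subst (u ∈_) pathVertices-z m₁) m₂) (sym p))
           (λ u m₁ m₂ → trans (meet₂ u (subst (u ∈_) pathVertices-z m₁) m₂) (sym (tgt-lastStep s p w))) ,
         counts))
    where
    walk = c₁ ++ʷ z ++ʷ c₂ ++ʷ reverseʷ z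
    steps-walk : steps walk ≡ steps c₁ ++ steps z ++ steps c₂ ++ reverseSteps (steps z)
    steps-walk = trans (steps-++ʷ c₁ _) (cong (steps c₁ ++_) (trans (steps-++ʷ z _) (cong (steps z ++_)
      (trans (steps-++ʷ c₂ (reverseʷ z)) (cong (steps c₂ ++_) (steps-reverseʷ z))))))
    pathVertices-z : pathVertices Σg s (steps w) ≡ sources z ++ [ y ]
    pathVertices-z = trans (cong (_∷ targets z) p) (start∷targets z)
    counts : ∀ e → count e (steps walk) ≡ count e (steps c₁) + count e (steps c₂) + 2 * count e (steps z)
    counts e = trans (cong (count e) steps-walk) (count-handcuff e (steps c₁) (steps z) (steps c₂))

module TensionWalks (Σg : SignedGraph) (ω : Orientation Σg) (compat : Compatible Σg ω)
                    {n : ℕ} (plus : Fin n → Fin n → Fin n) (0# : Fin n) (neg : Fin n → Fin n)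
                    (isAG : IsAbelianGroup _≡_ plus 0# neg)
                    (f : Vec (Fin n) (SignedGraph.nE Σg)) (tension : IsTension Σg ω plus 0# neg f) where

  open import Relation.Binary.PropositionalEquality hiding ([_])
  open import Data.Nat using (zero; suc; _+_; _≤_; _<_; s≤s; z≤n)
  open import Data.Nat.Properties
    using (+-comm; +-assoc; ≤-trans; ≤-refl; +-mono-≤; m≤m+n; m≤n+m; m<m+n; <⇒≤; +-monoʳ-≤; +-monoˡ-≤; +-monoˡ-<;
           ≤-<-trans; <-≤-trans; ≤-pred; ≤-reflexive)
  open import Data.Nat.Tactic.RingSolver using (solve-∀)
  open import Data.Bool using (true; false)
  open import Data.Fin using (_≟_)
  open import Data.Vec using ([]; _∷_; lookup)
  open import Data.Product using (Σ; _×_; _,_; proj₁; proj₂)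
  open import Data.Sum using (inj₁; inj₂)
  open import Data.Empty using (⊥; ⊥-elim)
  open import Data.Unit using (tt)
  open import Data.List using (List; []; _∷_; _++_; [_])
  open import Data.List.Properties using (++-identityʳ)
  open import Data.List.Membership.Propositional using (_∈_)
  open import Data.List.Membership.DecPropositional using (_∈?_)
  open import Data.List.Membership.Propositional.Properties using (∈-++⁻)
  open import Data.List.Relation.Unary.Any using (here; there)
  open import Data.List.Relation.Unary.AllPairs using ([]; _∷_)
  open import Data.List.Relation.Unary.All using ([])
  open import Data.List.Relation.Unary.Unique.Propositional using (Unique)
  open import Data.List.Relation.Unary.Unique.Propositional.Properties using (++⁺)
  open import Data.Sign using (Sign; opposite) renaming (_*_ to _·_)
  open import Data.Sign.Properties using (s*s≡+; *-identityʳ; opposite[s]*s≡-; opposite-involutive) renaming (_≟_ to _≟ˢ_)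
  open import Relation.Nullary using (¬_; yes; no)
  open ListFacts
  open SignFacts
  open CircuitEquations Σg ω compat plus 0# neg isAG f tension public

  open SignedGraph Σg
  open ≡-Reasoning

  τ : List St → G
  τ = twisted f

  cancel-0#ˡ : ∀ {x X Y} → x ≡ X ⊕ Y → X ≡ 0# → x ≡ Y
  cancel-0#ˡ {Y = Y} e z = trans e (trans (cong (_⊕ Y) z) (identityˡ Y))

  cancel-0#ˡ₂ : ∀ {x X Y R} → x ≡ (X ⊕ ⊖ Y) ⊕ R → X ≡ 0# → Y ≡ 0# → x ≡ R
  cancel-0#ˡ₂ {R = R} e refl refl = trans e (prove ((:0 :+ :- :0) :+ x0) x0 tt (R ∷ []))

  twisted-rotate : ∀ A₁ A₂ → sgn (A₁ ++ A₂) ≡ Sign.- → τ (A₁ ++ A₂) ≡ conjAlong f A₁ (τ (A₂ ++ A₁))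
  twisted-rotate A₁ A₂ u = begin
    τ (A₁ ++ A₂) ≡⟨ twisted-++ f A₁ A₂ ⟩
    τ A₁ ⊕ actS (sgn A₁) (τ A₂) ≡⟨ regroup (sgn A₁) (sgn A₂) (trans (sym (sgn-++ A₁ A₂)) u) (τ A₁) (τ A₂) ⟩
    conj (τ A₁) (sgn A₁) (τ A₂ ⊕ actS (sgn A₂) (τ A₁)) ≡⟨ cong (conj (τ A₁) (sgn A₁)) (sym (twisted-++ f A₂ A₁)) ⟩
    conj (τ A₁) (sgn A₁) (τ (A₂ ++ A₁)) ∎
    where
    regroup : ∀ a₁ a₂ → a₁ · a₂ ≡ Sign.- → ∀ t₁ t₂ → t₁ ⊕ actS a₁ t₂ ≡ conj t₁ a₁ (t₂ ⊕ actS a₂ t₁)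
    regroup Sign.+ Sign.- _ t₁ t₂ = prove (x0 :+ x1) ((x0 :+ x0) :+ (x1 :+ :- x0)) tt (t₁ ∷ t₂ ∷ [])
    regroup Sign.- Sign.+ _ t₁ t₂ = prove (x0 :+ :- x1) ((x0 :+ x0) :+ :- (x1 :+ x0)) tt (t₁ ∷ t₂ ∷ [])
    regroup Sign.+ Sign.+ ()
    regroup Sign.- Sign.- ()

  twisted-rotate⁻¹ : ∀ A₁ A₂ → sgn (A₁ ++ A₂) ≡ Sign.- → τ (A₁ ++ A₂) ≡ conjAlong f (reverseSteps A₂) (τ (A₂ ++ A₁))
  twisted-rotate⁻¹ A₁ A₂ u = begin
    τ (A₁ ++ A₂) ≡⟨ twisted-++ f A₁ A₂ ⟩
    τ A₁ ⊕ actS (sgn A₁) (τ A₂) ≡⟨ regroup (sgn A₁) (sgn A₂) (trans (sym (sgn-++ A₁ A₂)) u) (τ A₁) (τ A₂) ⟩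
    conj (⊖ actS (sgn A₂) (τ A₂)) (sgn A₂) (τ A₂ ⊕ actS (sgn A₂) (τ A₁))
      ≡⟨ cong₂ (λ t s → conj t s (τ A₂ ⊕ actS (sgn A₂) (τ A₁))) (sym (twisted-reverseSteps f A₂)) (sym (sgn-reverseSteps A₂)) ⟩
    conj (τ (reverseSteps A₂)) (sgn (reverseSteps A₂)) (τ A₂ ⊕ actS (sgn A₂) (τ A₁)) ≡⟨ cong (conjAlong f (reverseSteps A₂)) (sym (twisted-++ f A₂ A₁)) ⟩
    conjAlong f (reverseSteps A₂) (τ (A₂ ++ A₁)) ∎
    where
    regroup : ∀ a₁ a₂ → a₁ · a₂ ≡ Sign.- → ∀ t₁ t₂ → t₁ ⊕ actS a₁ t₂ ≡ conj (⊖ actS a₂ t₂) a₂ (t₂ ⊕ actS a₂ t₁)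
    regroup Sign.+ Sign.- _ t₁ t₂ = prove (x0 :+ x1) ((:- (:- x1) :+ :- (:- x1)) :+ :- (x1 :+ :- x0)) tt (t₁ ∷ t₂ ∷ [])
    regroup Sign.- Sign.+ _ t₁ t₂ = prove (x0 :+ :- x1) ((:- x1 :+ :- x1) :+ (x1 :+ x0)) tt (t₁ ∷ t₂ ∷ [])
    regroup Sign.+ Sign.+ ()
    regroup Sign.- Sign.- ()

  tight-agree : ∀ A B → sgn A ≡ Sign.- → τ (A ++ B) ≡ 0# → τ A ≡ τ B
  tight-agree A B u e = cancel-0#ˡ (regroup (τ A) (τ B)) (trans (cong (λ s → τ A ⊕ actS s (τ B)) (sym u)) (trans (sym (twisted-++ f A B)) e))
    where
    regroup : ∀ a b → a ≡ (a ⊕ ⊖ b) ⊕ b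
    regroup a b = prove x0 ((x0 :+ :- x1) :+ x1) tt (a ∷ b ∷ [])

  loose-agree : ∀ A Z B → sgn A ≡ Sign.- → sgn B ≡ Sign.- → τ (A ++ Z ++ B ++ reverseSteps Z) ≡ 0# → τ A ≡ conjAlong f Z (τ B)
  loose-agree A Z B uA uB e = cancel-0#ˡ (regroup (sgn Z) (τ A) (τ Z) (τ B)) (trans (sym expand) e)
    where
    expand : τ (A ++ Z ++ B ++ reverseSteps Z) ≡ τ A ⊕ actS Sign.- (τ Z ⊕ actS (sgn Z) (τ B ⊕ actS Sign.- (⊖ actS (sgn Z) (τ Z))))
    expand = begin
      τ (A ++ Z ++ B ++ reverseSteps Z) ≡⟨ twisted-++ f A _ ⟩
      τ A ⊕ actS (sgn A) (τ (Z ++ B ++ reverseSteps Z)) ≡⟨ cong₂ (λ s t → τ A ⊕ actS s t) uA (twisted-++ f Z _) ⟩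
      τ A ⊕ actS Sign.- (τ Z ⊕ actS (sgn Z) (τ (B ++ reverseSteps Z)))
        ≡⟨ cong (λ t → τ A ⊕ actS Sign.- (τ Z ⊕ actS (sgn Z) t)) (twisted-++ f B (reverseSteps Z)) ⟩
      τ A ⊕ actS Sign.- (τ Z ⊕ actS (sgn Z) (τ B ⊕ actS (sgn B) (τ (reverseSteps Z))))
        ≡⟨ cong₂ (λ s t → τ A ⊕ actS Sign.- (τ Z ⊕ actS (sgn Z) (τ B ⊕ actS s t))) uB (twisted-reverseSteps f Z) ⟩
      τ A ⊕ actS Sign.- (τ Z ⊕ actS (sgn Z) (τ B ⊕ actS Sign.- (⊖ actS (sgn Z) (τ Z)))) ∎
    regroup : ∀ z a t b → a ≡ (a ⊕ actS Sign.- (t ⊕ actS z (b ⊕ actS Sign.- (⊖ actS z t)))) ⊕ conj t z b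
    regroup Sign.+ a t b = prove x0 ((x0 :+ :- (x1 :+ (x2 :+ :- (:- x1)))) :+ ((x1 :+ x1) :+ x2)) tt (a ∷ t ∷ b ∷ [])
    regroup Sign.- a t b = prove x0 ((x0 :+ :- (x1 :+ :- (x2 :+ :- (:- (:- x1))))) :+ ((x1 :+ x1) :+ :- x2)) tt (a ∷ t ∷ b ∷ [])

  conjAlong-[] : ∀ y → y ≡ conjAlong f [] y
  conjAlong-[] y = sym (prove ((:0 :+ :0) :+ x0) x0 tt (y ∷ []))

  conjAlong-reverse : ∀ P y → conjAlong f P (conjAlong f (reverseSteps P) y) ≡ y
  conjAlong-reverse P y = trans (sym (conjAlong-++ f P (reverseSteps P) y)) (conjAlong-trivial f (P ++ reverseSteps P) y vanishes balanced)
    where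
    vanishes : τ (P ++ reverseSteps P) ≡ 0#
    vanishes = trans (twisted-++ f P (reverseSteps P)) (trans (cong (λ z → τ P ⊕ actS (sgn P) z) (twisted-reverseSteps f P)) (cancel (sgn P) (τ P)))
      where
      cancel : ∀ p t → t ⊕ actS p (⊖ actS p t) ≡ 0#
      cancel Sign.+ t = prove (x0 :+ :- x0) :0 tt (t ∷ [])
      cancel Sign.- t = prove (x0 :+ :- (:- (:- x0))) :0 tt (t ∷ [])
    balanced : sgn (P ++ reverseSteps P) ≡ Sign.+
    balanced = trans (sgn-++ P (reverseSteps P)) (trans (cong (sgn P ·_) (sgn-reverseSteps P)) (s*s≡+ (sgn P)))

  conjAlong-++ʷ : ∀ {u v w} (A : Walk u v) (B : Walk v w) y → conjAlong f (steps (A ++ʷ B)) y ≡ conjAlong f (steps A) (conjAlong f (steps B) y)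
  conjAlong-++ʷ A B y = trans (cong (λ l → conjAlong f l y) (steps-++ʷ A B)) (conjAlong-++ f (steps A) (steps B) y)

  twisted-rotateʷ : ∀ {x y} (C : Walk x x) (A₁ : Walk x y) (A₂ : Walk y x) → steps C ≡ steps A₁ ++ steps A₂ → sgn (steps C) ≡ Sign.- →
    τ (steps C) ≡ conjAlong f (steps A₁) (τ (steps (A₂ ++ʷ A₁)))
  twisted-rotateʷ C A₁ A₂ eq uC = trans (cong τ eq) (trans (twisted-rotate (steps A₁) (steps A₂) (trans (sym (cong sgn eq)) uC))
    (cong (λ l → conjAlong f (steps A₁) (τ l)) (sym (steps-++ʷ A₂ A₁))))

  τ-split : ∀ {u v a} (w : Walk u v) (A : Walk u a) (B : Walk a v) → steps w ≡ steps A ++ steps B →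
    τ (steps w) ≡ τ (steps A) ⊕ actS (sgn (steps A)) (τ (steps B))
  τ-split w A B eq = trans (cong τ eq) (twisted-++ f (steps A) (steps B))

  distinct⇒1≤len : ∀ {u v} (A : Walk u v) → ¬ u ≡ v → 1 ≤ len A
  distinct⇒1≤len (nil p) ne = ⊥-elim (ne p)
  distinct⇒1≤len (cons s p A) ne = s≤s z≤n

  <-of-+ : ∀ m k M → m + k ≡ M → 1 ≤ k → m < M
  <-of-+ m k M e l = subst (m <_) e (m<m+n m l)

  <-of-+-≤ : ∀ {N} m k M → m + k ≡ M → 1 ≤ k → M ≤ N → m < N
  <-of-+-≤ m k M e l b = <-≤-trans (subst (m <_) e (m<m+n m l)) b

  1≤+ʳ : ∀ {a} b → 1 ≤ a → 1 ≤ a + b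
  1≤+ʳ b l = ≤-trans l (m≤m+n _ b)
  1≤+ˡ : ∀ a {b} → 1 ≤ b → 1 ≤ a + b
  1≤+ˡ a l = ≤-trans l (m≤n+m _ a)

  module ClosedSubwalk {u a v} (X : Walk u v) (A : Walk u a) (B : Walk a a) (D : Walk a v)
                       (eq : steps X ≡ steps A ++ steps B ++ steps D) where
    open Split₃ X A B D eq public

    twisted-split₃ : τ (steps X) ≡ τ (steps A) ⊕ actS (sgn (steps A)) (τ (steps B) ⊕ actS (sgn (steps B)) (τ (steps D)))
    twisted-split₃ = trans (cong τ eq)
      (trans (twisted-++ f (steps A) _) (cong (λ z → τ (steps A) ⊕ actS (sgn (steps A)) z) (twisted-++ f (steps B) (steps D))))

    twisted-drop : τ (steps B) ≡ 0# → sgn (steps B) ≡ Sign.+ → τ (steps X) ≡ τ (steps (A ++ʷ D))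
    twisted-drop tB bB = begin
      τ (steps X)                                            ≡⟨ twisted-split₃ ⟩
      τ (steps A) ⊕ actS (sgn (steps A)) (τ (steps B) ⊕ actS (sgn (steps B)) (τ (steps D)))
        ≡⟨ cong₂ (λ t s → τ (steps A) ⊕ actS (sgn (steps A)) (t ⊕ actS s (τ (steps D)))) tB bB ⟩
      τ (steps A) ⊕ actS (sgn (steps A)) (0# ⊕ τ (steps D))  ≡⟨ cong (λ z → τ (steps A) ⊕ actS (sgn (steps A)) z) (identityˡ _) ⟩
      τ (steps A) ⊕ actS (sgn (steps A)) (τ (steps D))       ≡⟨ sym (twisted-++ f (steps A) (steps D)) ⟩
      τ (steps A ++ steps D)                                 ≡⟨ cong τ (sym (steps-++ʷ A D)) ⟩
      τ (steps (A ++ʷ D))                                    ∎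

    twisted-unbalanced-middle : sgn (steps B) ≡ Sign.- →
      τ (steps X) ≡ τ (steps A) ⊕ actS (sgn (steps A)) (τ (steps B) ⊕ ⊖ τ (steps D))
    twisted-unbalanced-middle uB =
      trans twisted-split₃ (cong (λ s → τ (steps A) ⊕ actS (sgn (steps A)) (τ (steps B) ⊕ actS s (τ (steps D)))) uB)

  -- Induction on length: if balanced closed walks shorter than N have twisted
  -- sum 0, then unbalanced closed walks at a common vertex of total length at
  -- most N have equal twisted sums (unbalanced-agree), and from this balanced
  -- closed walks of length N have twisted sum 0 (balanced-vanish).
  BalancedVanish : ℕ → Set
  BalancedVanish N = ∀ {x} (w : Walk x x) → len w < N → sgn (steps w) ≡ Sign.+ → τ (steps w) ≡ 0#

  module Induction (N : ℕ) (ih : BalancedVanish N) where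

    sameSign⇒sameTwisted : ∀ {x y} (A B : Walk x y) → len A + len B < N → sgn (steps A) ≡ sgn (steps B) →
      τ (steps A) ≡ τ (steps B)
    sameSign⇒sameTwisted A B lt e = proj₁ (twisted-cancel-reverse f (steps A) (steps B) vanishes balanced)
      where
      W = A ++ʷ reverseʷ B
      steps-W : steps W ≡ steps A ++ reverseSteps (steps B)
      steps-W = trans (steps-++ʷ A (reverseʷ B)) (cong (steps A ++_) (steps-reverseʷ B))
      balanced : sgn (steps A ++ reverseSteps (steps B)) ≡ Sign.+
      balanced = trans (sgn-++ (steps A) _) (trans (cong₂ _·_ e (sgn-reverseSteps (steps B))) (s*s≡+ (sgn (steps B))))
      vanishes : τ (steps A ++ reverseSteps (steps B)) ≡ 0#
      vanishes = subst (λ l → τ l ≡ 0#) steps-W (ih W (subst (_< N) (sym (trans (len-++ʷ A (reverseʷ B)) (cong (len A +_) (len-reverseʷ B)))) lt)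
             (trans (cong sgn steps-W) balanced))

    balanced-++-vanish : ∀ {x y} (A : Walk x y) (B : Walk y x) → len A + len B < N → sgn (steps A) · sgn (steps B) ≡ Sign.+ →
      τ (steps A ++ steps B) ≡ 0#
    balanced-++-vanish A B lt e = subst (λ l → τ l ≡ 0#) (steps-++ʷ A B)
      (ih (A ++ʷ B) (subst (_< N) (sym (len-++ʷ A B)) lt) (trans (cong sgn (steps-++ʷ A B)) (trans (sgn-++ (steps A) (steps B)) e)))

    -- C = A₁ A₂ and C' = B₁ B₂ meet again at y.  If A₁ and B₁ have the same sign,
    -- A₁ B₁⁻¹ and A₂ B₂⁻¹ are shorter balanced closed walks; otherwise A₁ B₂ and B₁ A₂ are.
    module MeetTwice {x y} (C C' : Walk x x) (uC : sgn (steps C) ≡ Sign.-) (uC' : sgn (steps C') ≡ Sign.-)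
                     (bound : len C + len C' ≤ N) (A₁ : Walk x y) (A₂ : Walk y x) (B₁ : Walk x y) (B₂ : Walk y x)
                     (eqC : steps C ≡ steps A₁ ++ steps A₂) (eqC' : steps C' ≡ steps B₁ ++ steps B₂)
                     (lA₁ : 1 ≤ len A₁) (lA₂ : 1 ≤ len A₂) where

      unbalanced-A : sgn (steps A₁) · sgn (steps A₂) ≡ Sign.-
      unbalanced-A = trans (sym (sgn-split C A₁ A₂ eqC)) uC

      unbalanced-B : sgn (steps B₁) · sgn (steps B₂) ≡ Sign.-
      unbalanced-B = trans (sym (sgn-split C' B₁ B₂ eqC')) uC'

      len-total : len C + len C' ≡ (len A₁ + len A₂) + (len B₁ + len B₂)
      len-total = cong₂ _+_ (len-split C A₁ A₂ eqC) (len-split C' B₁ B₂ eqC')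

      aligned : sgn (steps A₁) ≡ sgn (steps B₁) → τ (steps C) ≡ τ (steps C')
      aligned e = begin
        τ (steps C)                                           ≡⟨ τ-split C A₁ A₂ eqC ⟩
        τ (steps A₁) ⊕ actS (sgn (steps A₁)) (τ (steps A₂))   ≡⟨ cong₂ (λ a z → a ⊕ z) agree₁ (cong₂ actS e agree₂) ⟩
        τ (steps B₁) ⊕ actS (sgn (steps B₁)) (τ (steps B₂))   ≡⟨ sym (τ-split C' B₁ B₂ eqC') ⟩
        τ (steps C')                                          ∎
        where
        rearrange₁ : ∀ a b c d → (a + c) + (b + d) ≡ (a + b) + (c + d)
        rearrange₁ = solve-∀
        rearrange₂ : ∀ a b c d → (b + d) + (a + c) ≡ (a + b) + (c + d)
        rearrange₂ = solve-∀
        agree₁ = sameSign⇒sameTwisted A₁ B₁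
          (<-of-+-≤ _ (len A₂ + len B₂) _ (trans (rearrange₁ (len A₁) (len A₂) (len B₁) (len B₂)) (sym len-total)) (1≤+ʳ _ lA₂) bound) e
        agree₂ = sameSign⇒sameTwisted A₂ B₂
          (<-of-+-≤ _ (len A₁ + len B₁) _ (trans (rearrange₂ (len A₁) (len A₂) (len B₁) (len B₂)) (sym len-total)) (1≤+ʳ _ lA₁) bound)
          (trans (·≡-⇒≡opposite _ _ unbalanced-A) (trans (cong opposite e) (sym (·≡-⇒≡opposite _ _ unbalanced-B))))

      crossed : ¬ sgn (steps A₁) ≡ sgn (steps B₁) → τ (steps C) ≡ τ (steps C')
      crossed ne = begin
        τ (steps C)                                           ≡⟨ τ-split C A₁ A₂ eqC ⟩
        τ (steps A₁) ⊕ actS (sgn (steps A₁)) (τ (steps A₂))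
          ≡⟨ combine (sgn (steps A₁)) (sgn (steps B₁)) B₁-sign (τ (steps A₁)) (τ (steps A₂)) (τ (steps B₁)) (τ (steps B₂))
               (trans (sym (twisted-++ f (steps A₁) (steps B₂))) vanish₁) (trans (sym (twisted-++ f (steps B₁) (steps A₂))) vanish₂) ⟩
        τ (steps B₁) ⊕ actS (sgn (steps B₁)) (τ (steps B₂))   ≡⟨ sym (τ-split C' B₁ B₂ eqC') ⟩
        τ (steps C')                                          ∎
        where
        B₁-sign : sgn (steps B₁) ≡ opposite (sgn (steps A₁))
        B₁-sign = ≢⇒≡opposite (sgn (steps A₁)) (sgn (steps B₁)) ne
        balanced₁ : sgn (steps A₁) · sgn (steps B₂) ≡ Sign.+
        balanced₁ = trans (cong (sgn (steps A₁) ·_) (trans (·≡-⇒≡opposite _ _ unbalanced-B) (trans (cong opposite B₁-sign) (opposite-involutive _))))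
                          (s*s≡+ (sgn (steps A₁)))
        balanced₂ : sgn (steps B₁) · sgn (steps A₂) ≡ Sign.+
        balanced₂ = trans (cong₂ _·_ B₁-sign (·≡-⇒≡opposite _ _ unbalanced-A)) (s*s≡+ (opposite (sgn (steps A₁))))
        rearrange₁ : ∀ a b c d → (a + d) + (b + c) ≡ (a + b) + (c + d)
        rearrange₁ = solve-∀
        rearrange₂ : ∀ a b c d → (c + b) + (a + d) ≡ (a + b) + (c + d)
        rearrange₂ = solve-∀
        vanish₁ = balanced-++-vanish A₁ B₂
          (<-of-+-≤ _ (len A₂ + len B₁) _ (trans (rearrange₁ (len A₁) (len A₂) (len B₁) (len B₂)) (sym len-total)) (1≤+ʳ _ lA₂) bound) balanced₁
        vanish₂ = balanced-++-vanish B₁ A₂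
          (<-of-+-≤ _ (len A₁ + len B₂) _ (trans (rearrange₂ (len A₁) (len A₂) (len B₁) (len B₂)) (sym len-total)) (1≤+ʳ _ lA₁) bound) balanced₂
        combine : ∀ a₁ b₁ → b₁ ≡ opposite a₁ → ∀ t₁ t₂ s₁ s₂ → t₁ ⊕ actS a₁ s₂ ≡ 0# → s₁ ⊕ actS b₁ t₂ ≡ 0# →
          t₁ ⊕ actS a₁ t₂ ≡ s₁ ⊕ actS b₁ s₂
        combine Sign.+ .Sign.- refl t₁ t₂ s₁ s₂ X Y =
          cancel-0#ˡ₂ (prove (x0 :+ x1) (((x0 :+ x3) :+ :- (x2 :+ :- x1)) :+ (x2 :+ :- x3)) tt (t₁ ∷ t₂ ∷ s₁ ∷ s₂ ∷ [])) X Y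
        combine Sign.- .Sign.+ refl t₁ t₂ s₁ s₂ X Y =
          cancel-0#ˡ₂ (prove (x0 :+ :- x1) (((x0 :+ :- x3) :+ :- (x2 :+ x1)) :+ (x2 :+ x3)) tt (t₁ ∷ t₂ ∷ s₁ ∷ s₂ ∷ [])) X Y

      unbalanced-meetTwice : τ (steps C) ≡ τ (steps C')
      unbalanced-meetTwice with sgn (steps A₁) ≟ˢ sgn (steps B₁)
      ... | yes e  = aligned e
      ... | no ne = crossed ne

    -- Two unbalanced cycles at x meet again, or form a tight handcuff, or share an
    -- edge; in the last case that edge is a negative loop at x forming both cycles.
    unbalancedCycles-agree : ∀ {x} (C C' : Walk x x) → IsCycleʷ C → IsCycleʷ C' → sgn (steps C) ≡ Sign.- → sgn (steps C') ≡ Sign.- →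
      len C + len C' ≤ N → τ (steps C) ≡ τ (steps C')
    unbalancedCycles-agree {x} C C' cyc cyc' uC uC' bound with commonOtherThan? _≟_ x (sources C) (sources C')
    ... | inj₁ (y , m₁ , m₂ , ne) with splitAtSource C m₁ | splitAtSource C' m₂
    ...   | A₁ , A₂ , eqC , lA₂ | B₁ , B₂ , eqC' , _ =
      MeetTwice.unbalanced-meetTwice C C' uC uC' bound A₁ A₂ B₁ B₂ eqC eqC' (distinct⇒1≤len A₁ (λ e → ne (sym e))) lA₂
    unbalancedCycles-agree {x} C C' cyc cyc' uC uC' bound | inj₂ sh with common? _≟_ (edgesʷ C) (edgesʷ C')
    ...   | inj₂ ed = tight-agree (steps C) (steps C') uC (twisted-tightHandcuff C C' cyc cyc' uC uC' sh ed)
    ...   | inj₁ (e , me , me') with loop-cycle C (proj₁ (proj₂ cyc)) me lp | loop-cycle C' (proj₁ (proj₂ cyc')) me' lp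
      where
      lp : endpoint e false ≡ endpoint e true
      lp = trans (sh _ (endpoint∈sources C (proj₁ cyc) me false) (endpoint∈sources C' (proj₁ cyc') me' false))
                 (sym (sh _ (endpoint∈sources C (proj₁ cyc) me true) (endpoint∈sources C' (proj₁ cyc') me' true)))
    ...     | b , eC | b' , eC' = trans (cong τ eC) (trans (cong (λ s → actS (s · Sign.+) (lookup f e) ⊕ 0#) (wb b b'))
                                     (sym (cong τ eC')))
      where
      σneg : σ e ≡ Sign.-
      σneg = trans (sym (*-identityʳ (σ e))) (trans (cong sgn (sym eC)) uC)
      wb : ∀ b b' → ω e b ≡ ω e b'
      wb false false = refl
      wb true  true  = refl
      wb false true  = σ≡-⇒ω≡ e σneg
      wb true  false = sym (σ≡-⇒ω≡ e σneg)

    NormalForm : ∀ {y} → Walk y y → Set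
    NormalForm {y} X = Σ V λ w₁ → Σ (Walk y w₁) λ P → Σ (Walk w₁ w₁) λ C →
      IsCycleʷ C × (sgn (steps C) ≡ Sign.-) × (τ (steps X) ≡ conjAlong f (steps P) (τ (steps C))) × (len P + len C ≤ len X)

    normalForm : ∀ k {y} (X : Walk y y) → len X ≤ k → len X ≤ N → sgn (steps X) ≡ Sign.- → NormalForm X
    normalForm k (nil _) _ _ ()
    normalForm k X@(cons _ _ _) lk lN uX with sourcesUnique⊎closedSubwalk X
    ... | inj₁ uV with edgesUnique⊎backtrack X uV
    ...   | inj₁ uE = _ , nil refl , X , (s≤s z≤n , uV , uE) , uX , conjAlong-[] _ , ≤-refl
    ...   | inj₂ (e , b , eq) = ⊥-elim (+≢- (trans (sym (sgn-backtrack e b)) (trans (cong sgn (sym eq)) uX)))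
    normalForm (suc k) X@(cons _ _ _) lk lN uX | inj₂ (_ , A , B , D , eq , lB , lD) with sgn (steps B) ≟ˢ Sign.+
    ... | yes bB =
      let w , P , C , cyc , uC , tAD , l = normalForm k (A ++ʷ D) (≤-pred (≤-trans (len-outer< lB) lk)) (≤-trans (<⇒≤ (len-outer< lB)) lN)
                                             (trans (sgn-outer-balanced bB) uX)
      in  w , P , C , cyc , uC , trans (twisted-drop (ih B (<-≤-trans (len-middle< lD) lN) bB) bB) tAD , ≤-trans l (<⇒≤ (len-outer< lB))
      where open ClosedSubwalk X A B D eq
    ... | no ¬bB =
      let w , P , C , cyc , uC , tB , l = normalForm k B (≤-pred (≤-trans (len-middle< lD) lk)) (≤-trans (<⇒≤ (len-middle< lD)) lN) uB
      in  w , A ++ʷ P , C , cyc , uC , trans tX (trans (cong (conjAlong f (steps A)) tB) (sym (conjAlong-++ʷ A P _))) , lenOK P C l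
      where
      open ClosedSubwalk X A B D eq
      uB = ≢+⇒≡- ¬bB
      AD-vanish : τ (steps A) ⊕ actS (sgn (steps A)) (τ (steps D)) ≡ 0#
      AD-vanish = trans (sym (twisted-++ f (steps A) (steps D)))
        (balanced-++-vanish A D (<-≤-trans (subst (_< len X) (len-++ʷ A D) (len-outer< lB)) lN)
          (·-·-≡-⇒·≡+ (sgn (steps A)) (sgn (steps D)) (trans (cong (λ z → sgn (steps A) · (z · sgn (steps D))) (sym uB)) (trans (sym sgn-split₃) uX))))
      tX : τ (steps X) ≡ conjAlong f (steps A) (τ (steps B))
      tX = trans (twisted-unbalanced-middle uB)
        (cancel-0#ˡ₂ (regroup (sgn (steps A)) (τ (steps A)) (τ (steps B)) (τ (steps D))) refl AD-vanish)
        where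
        regroup : ∀ a ta tb td → ta ⊕ actS a (tb ⊕ ⊖ td) ≡ (0# ⊕ ⊖ (ta ⊕ actS a td)) ⊕ conj ta a tb
        regroup Sign.+ ta tb td = prove (x0 :+ (x1 :+ :- x2)) ((:0 :+ :- (x0 :+ x2)) :+ ((x0 :+ x0) :+ x1)) tt (ta ∷ tb ∷ td ∷ [])
        regroup Sign.- ta tb td = prove (x0 :+ :- (x1 :+ :- x2)) ((:0 :+ :- (x0 :+ :- x2)) :+ ((x0 :+ x0) :+ :- x1)) tt (ta ∷ tb ∷ td ∷ [])
      lenOK : ∀ {w} (P : Walk _ w) (C : Walk w w) → len P + len C ≤ len B → len (A ++ʷ P) + len C ≤ len X
      lenOK P C l = subst (_≤ len X) (sym (trans (cong (_+ len C) (len-++ʷ A P)) (+-assoc (len A) (len P) (len C))))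
        (≤-trans (+-monoʳ-≤ (len A) (≤-trans l (m≤m+n (len B) (len D)))) (≤-reflexive (sym len-split₃)))

    twisted-rotate-along : ∀ {x y} (C : Walk x x) (A₁ : Walk x y) (A₂ : Walk y x) (Q : Walk x y) →
      steps C ≡ steps A₁ ++ steps A₂ → sgn (steps C) ≡ Sign.- → len C + len Q < N →
      τ (steps C) ≡ conjAlong f (steps Q) (τ (steps (A₂ ++ʷ A₁)))
    twisted-rotate-along C A₁ A₂ Q eq uC lt with _≟ˢ_ (sgn (steps A₁)) (sgn (steps Q))
    ... | yes e = trans (cong τ eq) (trans (twisted-rotate (steps A₁) (steps A₂) (trans (sym (cong sgn eq)) uC))
           (trans (cong₂ (λ t s → conj t s (τ (steps A₂ ++ steps A₁))) (sameSign⇒sameTwisted A₁ Q bound′ e) e)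
             (cong (λ l → conjAlong f (steps Q) (τ l)) (sym (steps-++ʷ A₂ A₁)))))
      where
      len-C = len-split C A₁ A₂ eq
      bound′ : len A₁ + len Q < _
      bound′ = ≤-<-trans (+-monoˡ-≤ (len Q) (subst (len A₁ ≤_) (sym len-C) (m≤m+n _ _))) lt
    ... | no ne = trans (cong τ eq) (trans (twisted-rotate⁻¹ (steps A₁) (steps A₂) (trans (sym (cong sgn eq)) uC))
           (trans (cong₂ (λ t s → conj t s (τ (steps A₂ ++ steps A₁)))
                     (trans (sym (cong τ (steps-reverseʷ A₂))) (sameSign⇒sameTwisted (reverseʷ A₂) Q bound′ reverse-A₂-sign))
                     (trans (sgn-reverseSteps (steps A₂)) A₂-sign))
             (cong (λ l → conjAlong f (steps Q) (τ l)) (sym (steps-++ʷ A₂ A₁)))))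
      where
      len-C = len-split C A₁ A₂ eq
      bound′ : len (reverseʷ A₂) + len Q < _
      bound′ = ≤-<-trans (+-monoˡ-≤ (len Q) (subst (_≤ len C) (sym (len-reverseʷ A₂)) (subst (len A₂ ≤_) (sym len-C) (m≤n+m _ _)))) lt
      A₂-sign : sgn (steps A₂) ≡ sgn (steps Q)
      A₂-sign = trans (·≡-⇒≡opposite _ _ (trans (sym (sgn-split C A₁ A₂ eq)) uC)) (sym (≢⇒≡opposite _ _ ne))
      reverse-A₂-sign : sgn (steps (reverseʷ A₂)) ≡ sgn (steps Q)
      reverse-A₂-sign = trans (cong sgn (steps-reverseʷ A₂)) (trans (sgn-reverseSteps (steps A₂)) A₂-sign)

    -- The value of the unbalanced cycle C at w₁ is that of C' carried along Z.
    -- By induction on the length of Z: if Z repeats a vertex or meets C or C'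
    -- before its ends it can be shortened, otherwise C, Z and C' form a
    -- handcuff (or C and C' already meet).
    Transport : ℕ → Set
    Transport k = ∀ {w₁ w₂} (C : Walk w₁ w₁) (Z : Walk w₁ w₂) (C' : Walk w₂ w₂) → len Z ≤ k → IsCycleʷ C → IsCycleʷ C' →
      sgn (steps C) ≡ Sign.- → sgn (steps C') ≡ Sign.- → len C + len Z + len C' ≤ N →
      τ (steps C) ≡ conjAlong f (steps Z) (τ (steps C'))

    transport-sharedVertex : ∀ {w₁ w₂} (C : Walk w₁ w₁) (Z : Walk w₁ w₂) (C' : Walk w₂ w₂) → IsCycleʷ C → IsCycleʷ C' →
      sgn (steps C) ≡ Sign.- → sgn (steps C') ≡ Sign.- → len C + len Z + len C' ≤ N →
      ∀ y → y ∈ sources C → y ∈ sources C' → τ (steps C) ≡ conjAlong f (steps Z) (τ (steps C'))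
    transport-sharedVertex C Z C' cyc cyc' uC uC' bound y m₁ m₂ with splitAtSource C m₁ | splitAtSource C' m₂
    ... | A₁ , A₂ , eqC , lA₂ | B₁ , B₂ , eqC' , lB₂ = begin
        τ (steps C) ≡⟨ twisted-rotate-along C A₁ A₂ (Z ++ʷ B₁) eqC uC bound₁ ⟩
        conjAlong f (steps (Z ++ʷ B₁)) (τ (steps Cy)) ≡⟨ conjAlong-++ʷ Z B₁ _ ⟩
        conjAlong f (steps Z) (conjAlong f (steps B₁) (τ (steps Cy))) ≡⟨ cong (λ t → conjAlong f (steps Z) (conjAlong f (steps B₁) t)) rotations-agree ⟩
        conjAlong f (steps Z) (conjAlong f (steps B₁) (τ (steps C'y))) ≡⟨ cong (conjAlong f (steps Z)) (sym (twisted-rotateʷ C' B₁ B₂ eqC' uC')) ⟩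
        conjAlong f (steps Z) (τ (steps C')) ∎
      where
      Cy = A₂ ++ʷ A₁
      C'y = B₂ ++ʷ B₁
      len-C' = len-split C' B₁ B₂ eqC'
      rearrange : ∀ c z b₁ b2 → (c + (z + b₁)) + b2 ≡ c + z + (b₁ + b2)
      rearrange = solve-∀
      bound₁ : len C + len (Z ++ʷ B₁) < N
      bound₁ = <-of-+-≤ (len C + len (Z ++ʷ B₁)) (len B₂) (len C + len Z + len C')
              (trans (cong (λ t → len C + t + len B₂) (len-++ʷ Z B₁))
                (trans (rearrange (len C) (len Z) (len B₁) (len B₂)) (cong (λ t → len C + len Z + t) (sym len-C')))) lB₂ bound
      bound₂ : len Cy + len C'y ≤ N
      bound₂ = subst (_≤ N) (sym (cong₂ _+_ (Rotation.len-rotate C A₁ A₂ eqC) (Rotation.len-rotate C' B₁ B₂ eqC')))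
              (≤-trans (+-monoˡ-≤ (len C') (m≤m+n (len C) (len Z))) bound)
      rotations-agree : τ (steps Cy) ≡ τ (steps C'y)
      rotations-agree = unbalancedCycles-agree Cy C'y (Rotation.isCycle-rotate C A₁ A₂ eqC lA₂ cyc) (Rotation.isCycle-rotate C' B₁ B₂ eqC' lB₂ cyc')
             (trans (Rotation.sgn-rotate C A₁ A₂ eqC) uC) (trans (Rotation.sgn-rotate C' B₁ B₂ eqC') uC') bound₂

    transport-detour : ∀ {k} → Transport k → ∀ {a w₂} (L : Walk a a) (Z₂ : Walk a w₂) (C' : Walk w₂ w₂) →
      IsCycleʷ C' → sgn (steps C') ≡ Sign.- → len L + len Z₂ ≤ suc k → len L + len Z₂ + len C' ≤ N →
      conjAlong f (steps L) (conjAlong f (steps Z₂) (τ (steps C'))) ≡ conjAlong f (steps Z₂) (τ (steps C'))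
    transport-detour {k} rec L Z₂ C' cyc' uC' lk bound with sgn (steps L) ≟ˢ Sign.+
    ... | yes bL = conjAlong-trivial f (steps L) _ (ih L len-L<N bL) bL
      where
      len-L<N = ≤-<-trans (m≤m+n (len L) (len Z₂)) (<-of-+-≤ (len L + len Z₂) (len C') _ refl (proj₁ cyc') bound)
    ... | no ¬bL with normalForm (len L) L ≤-refl (<⇒≤ len-L<N) (≢+⇒≡- ¬bL)
      where
      len-L<N = ≤-<-trans (m≤m+n (len L) (len Z₂)) (<-of-+-≤ (len L + len Z₂) (len C') _ refl (proj₁ cyc') bound)
    ...   | _ , P , C'' , cyc'' , uC'' , eL , lPC = begin
        conj (τ (steps L)) (sgn (steps L)) y  ≡⟨ cong₂ (λ t s → conj t s y) tL (≢+⇒≡- ¬bL) ⟩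
        conj y Sign.- y                       ≡⟨ prove ((x0 :+ x0) :+ :- x0) x0 tt (y ∷ []) ⟩
        y                                     ∎
      where
      y = conjAlong f (steps Z₂) (τ (steps C'))
      Q = reverseʷ P ++ʷ Z₂
      len-Q : len Q ≡ len P + len Z₂
      len-Q = trans (len-++ʷ (reverseʷ P) Z₂) (cong (_+ len Z₂) (len-reverseʷ P))
      len-Q≤k : len Q ≤ k
      len-Q≤k = ≤-pred (≤-trans (subst (_< _) (sym len-Q) (+-monoˡ-< (len Z₂) (<-≤-trans (m<m+n (len P) (proj₁ cyc'')) lPC))) lk)
      bound-Q : len C'' + len Q + len C' ≤ N
      bound-Q = subst (_≤ N) (sym (trans (cong (λ t → len C'' + t + len C') len-Q) (rearrange (len C'') (len P) (len Z₂) (len C'))))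
        (≤-trans (+-monoˡ-≤ (len C') (+-monoˡ-≤ (len Z₂) lPC)) bound)
        where
        rearrange : ∀ c p z c' → c + (p + z) + c' ≡ (p + c) + z + c'
        rearrange = solve-∀
      tL : τ (steps L) ≡ y
      tL = begin
        τ (steps L)                                                   ≡⟨ eL ⟩
        conjAlong f (steps P) (τ (steps C''))                         ≡⟨ cong (conjAlong f (steps P)) (rec C'' Q C' len-Q≤k cyc'' cyc' uC'' uC' bound-Q) ⟩
        conjAlong f (steps P) (conjAlong f (steps Q) (τ (steps C')))  ≡⟨ cong (conjAlong f (steps P)) (conjAlong-++ʷ (reverseʷ P) Z₂ _) ⟩
        conjAlong f (steps P) (conjAlong f (steps (reverseʷ P)) y)    ≡⟨ cong (λ l → conjAlong f (steps P) (conjAlong f l y)) (steps-reverseʷ P) ⟩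
        conjAlong f (steps P) (conjAlong f (reverseSteps (steps P)) y) ≡⟨ conjAlong-reverse (steps P) y ⟩
        y                                                             ∎

    transport-shortcut : ∀ {k} → Transport k → ∀ {w₁ w₂ a} (C : Walk w₁ w₁) (Z : Walk w₁ w₂) (C' : Walk w₂ w₂) →
      len Z ≤ suc k → IsCycleʷ C → IsCycleʷ C' → sgn (steps C) ≡ Sign.- → sgn (steps C') ≡ Sign.- → len C + len Z + len C' ≤ N →
      (Z₁ : Walk w₁ a) (L : Walk a a) (Z₂ : Walk a w₂) → steps Z ≡ steps Z₁ ++ steps L ++ steps Z₂ → 1 ≤ len L →
      τ (steps C) ≡ conjAlong f (steps Z) (τ (steps C'))
    transport-shortcut {k} rec C Z C' lk cyc cyc' uC uC' bound Z₁ L Z₂ eqZ lL = begin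
      τ (steps C)                                                  ≡⟨ rec C (Z₁ ++ʷ Z₂) C' (≤-pred (≤-trans (len-outer< lL) lk)) cyc cyc' uC uC' bound′ ⟩
      conjAlong f (steps (Z₁ ++ʷ Z₂)) (τ (steps C'))               ≡⟨ conjAlong-++ʷ Z₁ Z₂ _ ⟩
      conjAlong f (steps Z₁) y
        ≡⟨ cong (conjAlong f (steps Z₁)) (sym (transport-detour rec L Z₂ C' cyc' uC' (≤-trans LZ₂≤Z lk) bound-detour)) ⟩
      conjAlong f (steps Z₁) (conjAlong f (steps L) y)             ≡⟨ cong (conjAlong f (steps Z₁)) (sym (conjAlong-++ f (steps L) (steps Z₂) _)) ⟩
      conjAlong f (steps Z₁) (conjAlong f (steps L ++ steps Z₂) (τ (steps C'))) ≡⟨ sym (conjAlong-++ f (steps Z₁) _ _) ⟩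
      conjAlong f (steps Z₁ ++ steps L ++ steps Z₂) (τ (steps C')) ≡⟨ cong (λ l → conjAlong f l (τ (steps C'))) (sym eqZ) ⟩
      conjAlong f (steps Z) (τ (steps C'))                         ∎
      where
      open Split₃ Z Z₁ L Z₂ eqZ
      y = conjAlong f (steps Z₂) (τ (steps C'))
      bound′ : len C + len (Z₁ ++ʷ Z₂) + len C' ≤ N
      bound′ = ≤-trans (+-monoˡ-≤ (len C') (+-monoʳ-≤ (len C) (<⇒≤ (len-outer< lL)))) bound
      LZ₂≤Z : len L + len Z₂ ≤ len Z
      LZ₂≤Z = subst (len L + len Z₂ ≤_) (sym len-split₃) (m≤n+m (len L + len Z₂) (len Z₁))
      bound-detour : len L + len Z₂ + len C' ≤ N
      bound-detour = ≤-trans (+-monoˡ-≤ (len C') (≤-trans LZ₂≤Z (m≤n+m (len Z) (len C)))) bound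

    transport-hitsFirst : ∀ {k} → Transport k → ∀ {w₁ w₂} (C : Walk w₁ w₁) (Z : Walk w₁ w₂) (C' : Walk w₂ w₂) →
      len Z ≤ suc k → IsCycleʷ C → IsCycleʷ C' → sgn (steps C) ≡ Sign.- → sgn (steps C') ≡ Sign.- → len C + len Z + len C' ≤ N →
      ∀ y → y ∈ targets Z → y ∈ sources C → τ (steps C) ≡ conjAlong f (steps Z) (τ (steps C'))
    transport-hitsFirst {k} rec C Z C' lk cyc cyc' uC uC' bound y mt mc with splitAtTarget Z mt | splitAtSource C mc
    ... | Z₁ , Z₂ , eqZ , lZ₁ | A₁ , A₂ , eqC , lA₂ = begin
        τ (steps C) ≡⟨ twisted-rotate-along C A₁ A₂ Z₁ eqC uC bound₁ ⟩
        conjAlong f (steps Z₁) (τ (steps Cy)) ≡⟨ cong (conjAlong f (steps Z₁)) transport-rest ⟩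
        conjAlong f (steps Z₁) (conjAlong f (steps Z₂) (τ (steps C'))) ≡⟨ sym (conjAlong-++ f (steps Z₁) (steps Z₂) _) ⟩
        conjAlong f (steps Z₁ ++ steps Z₂) (τ (steps C')) ≡⟨ cong (λ l → conjAlong f l (τ (steps C'))) (sym eqZ) ⟩
        conjAlong f (steps Z) (τ (steps C')) ∎
      where
      Cy = A₂ ++ʷ A₁
      len-Z = len-split Z Z₁ Z₂ eqZ
      bound₁ : len C + len Z₁ < N
      bound₁ = <-of-+-≤ (len C + len Z₁) (len Z₂ + len C') (len C + len Z + len C')
             (trans (rearrange (len C) (len Z₁) (len Z₂) (len C')) (cong (λ t → len C + t + len C') (sym len-Z))) (1≤+ˡ (len Z₂) (proj₁ cyc')) bound
        where
        rearrange : ∀ c a b c' → c + a + (b + c') ≡ c + (a + b) + c'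
        rearrange = solve-∀
      lZ₂ : len Z₂ < len Z
      lZ₂ = <-of-+ (len Z₂) (len Z₁) (len Z) (trans (+-comm (len Z₂) (len Z₁)) (sym len-Z)) lZ₁
      bound₂ : len Cy + len Z₂ + len C' ≤ N
      bound₂ = subst (λ t → t + len Z₂ + len C' ≤ N) (sym (Rotation.len-rotate C A₁ A₂ eqC))
              (≤-trans (+-monoˡ-≤ (len C') (+-monoʳ-≤ (len C) (<⇒≤ lZ₂))) bound)
      transport-rest : τ (steps Cy) ≡ conjAlong f (steps Z₂) (τ (steps C'))
      transport-rest = rec Cy Z₂ C' (≤-pred (≤-trans lZ₂ lk)) (Rotation.isCycle-rotate C A₁ A₂ eqC lA₂ cyc) cyc'
             (trans (Rotation.sgn-rotate C A₁ A₂ eqC) uC) uC' bound₂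

    transport-hitsSecond : ∀ {k} → Transport k → ∀ {w₁ w₂} (C : Walk w₁ w₁) (Z : Walk w₁ w₂) (C' : Walk w₂ w₂) →
      len Z ≤ suc k → IsCycleʷ C → IsCycleʷ C' → sgn (steps C) ≡ Sign.- → sgn (steps C') ≡ Sign.- → len C + len Z + len C' ≤ N →
      ∀ y → y ∈ sources Z → y ∈ sources C' → τ (steps C) ≡ conjAlong f (steps Z) (τ (steps C'))
    transport-hitsSecond {k} rec C Z C' lk cyc cyc' uC uC' bound y ms mc' with splitAtSource Z ms | splitAtSource C' mc'
    ... | Z₁ , Z₂ , eqZ , lZ₂ | B₁ , B₂ , eqC' , lB₂ = begin
        τ (steps C) ≡⟨ transport-rest ⟩
        conjAlong f (steps Z₁) (τ (steps C'y)) ≡⟨ cong (conjAlong f (steps Z₁)) (sym (conjAlong-reverse (steps Z₂) _)) ⟩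
        conjAlong f (steps Z₁) (conjAlong f (steps Z₂) (conjAlong f (reverseSteps (steps Z₂)) (τ (steps C'y))))
          ≡⟨ cong (λ l → conjAlong f (steps Z₁) (conjAlong f (steps Z₂) (conjAlong f l (τ (steps C'y))))) (sym (steps-reverseʷ Z₂)) ⟩
        conjAlong f (steps Z₁) (conjAlong f (steps Z₂) (conjAlong f (steps (reverseʷ Z₂)) (τ (steps C'y))))
          ≡⟨ cong (λ t → conjAlong f (steps Z₁) (conjAlong f (steps Z₂) t)) (sym rotate-C') ⟩
        conjAlong f (steps Z₁) (conjAlong f (steps Z₂) (τ (steps C'))) ≡⟨ sym (conjAlong-++ f (steps Z₁) (steps Z₂) _) ⟩
        conjAlong f (steps Z₁ ++ steps Z₂) (τ (steps C')) ≡⟨ cong (λ l → conjAlong f l (τ (steps C'))) (sym eqZ) ⟩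
        conjAlong f (steps Z) (τ (steps C')) ∎
      where
      C'y = B₂ ++ʷ B₁
      len-Z = len-split Z Z₁ Z₂ eqZ
      bound₁ : len C' + len (reverseʷ Z₂) < N
      bound₁ = <-of-+-≤ (len C' + len (reverseʷ Z₂)) (len C + len Z₁) (len C + len Z + len C')
             (trans (cong (λ t → len C' + t + (len C + len Z₁)) (len-reverseʷ Z₂))
               (trans (rearrange (len C) (len Z₁) (len Z₂) (len C')) (cong (λ t → len C + t + len C') (sym len-Z))))
             (1≤+ʳ (len Z₁) (proj₁ cyc)) bound
        where
        rearrange : ∀ c a b c' → c' + b + (c + a) ≡ c + (a + b) + c'
        rearrange = solve-∀
      rotate-C' : τ (steps C') ≡ conjAlong f (steps (reverseʷ Z₂)) (τ (steps C'y))
      rotate-C' = twisted-rotate-along C' B₁ B₂ (reverseʷ Z₂) eqC' uC' bound₁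
      lZ₁ : len Z₁ < len Z
      lZ₁ = <-of-+ (len Z₁) (len Z₂) (len Z) (sym len-Z) lZ₂
      bound₂ : len C + len Z₁ + len C'y ≤ N
      bound₂ = subst (λ t → len C + len Z₁ + t ≤ N) (sym (Rotation.len-rotate C' B₁ B₂ eqC'))
              (≤-trans (+-monoˡ-≤ (len C') (+-monoʳ-≤ (len C) (<⇒≤ lZ₁))) bound)
      transport-rest : τ (steps C) ≡ conjAlong f (steps Z₁) (τ (steps C'y))
      transport-rest = rec C Z₁ C'y (≤-pred (≤-trans lZ₁ lk)) cyc (Rotation.isCycle-rotate C' B₁ B₂ eqC' lB₂ cyc')
             uC (trans (Rotation.sgn-rotate C' B₁ B₂ eqC') uC') bound₂

    transport-looseHandcuff : ∀ {w₁ w₂} (C : Walk w₁ w₁) (Z : Walk w₁ w₂) (C' : Walk w₂ w₂) → IsCycleʷ C → IsCycleʷ C' →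
      sgn (steps C) ≡ Sign.- → sgn (steps C') ≡ Sign.- →
      (∀ a → a ∈ sources C → a ∈ sources C' → ⊥) → Unique (sources Z) → ¬ (w₂ ∈ sources Z) →
      (∀ a → a ∈ targets Z → a ∈ sources C → ⊥) → (∀ a → a ∈ sources Z → a ∈ sources C' → ⊥) →
      τ (steps C) ≡ conjAlong f (steps Z) (τ (steps C'))
    transport-looseHandcuff {w₁} {w₂} C Z C' cyc cyc' uC uC' disjoint uV w₂∉Z Z∩C Z∩C' =
      loose-agree (steps C) (steps Z) (steps C') uC uC' (twisted-looseHandcuff C C' Z cyc cyc' uC uC' disjoint 1≤len-Z path-unique meets-C meets-C')
      where
      1≤len-Z : 1 ≤ len Z
      1≤len-Z = distinct⇒1≤len Z (λ p → disjoint w₁ (start∈sources C (proj₁ cyc)) (subst (_∈ sources C') (sym p) (start∈sources C' (proj₁ cyc'))))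
      path-unique : Unique (sources Z ++ [ w₂ ])
      path-unique = ++⁺ uV ([] ∷ []) (λ { (m , here refl) → w₂∉Z m })
      meets-C : ∀ u → u ∈ sources Z ++ [ w₂ ] → u ∈ sources C → u ≡ w₁
      meets-C u m mc with subst (u ∈_) (sym (start∷targets Z)) m
      ... | here e = e
      ... | there m' = ⊥-elim (Z∩C u m' mc)
      meets-C' : ∀ u → u ∈ sources Z ++ [ w₂ ] → u ∈ sources C' → u ≡ w₂
      meets-C' u m mc with ∈-++⁻ (sources Z) m
      ... | inj₁ m' = ⊥-elim (Z∩C' u m' mc)
      ... | inj₂ (here e) = e

    transport : ∀ k → Transport k
    transport zero {w₁} C (nil p) C' lk cyc cyc' uC uC' bound =
      transport-sharedVertex C (nil p) C' cyc cyc' uC uC' bound w₁ (start∈sources C (proj₁ cyc)) (subst (_∈ sources C') (sym p) (start∈sources C' (proj₁ cyc')))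
    transport zero C (cons s p Z) C' () cyc cyc' uC uC' bound
    transport (suc k) {w₁} {w₂} C Z C' lk cyc cyc' uC uC' bound with common? _≟_ (sources C) (sources C')
    ... | inj₁ (y , m₁ , m₂) = transport-sharedVertex C Z C' cyc cyc' uC uC' bound y m₁ m₂
    ... | inj₂ disjoint with sourcesUnique⊎closedSubwalk Z
    ...   | inj₂ (a , Z₁ , L , Z₂ , eq , lL , _) = transport-shortcut (transport k) C Z C' lk cyc cyc' uC uC' bound Z₁ L Z₂ eq lL
    ...   | inj₁ uV with _∈?_ _≟_ w₂ (sources Z)
    ...     | yes m with splitAtSource Z m
    ...       | Z₁ , L , eq , lL = transport-shortcut (transport k) C Z C' lk cyc cyc' uC uC' bound Z₁ L (nil refl)
                                    (trans eq (cong (steps Z₁ ++_) (sym (++-identityʳ (steps L))))) lL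
    transport (suc k) {w₁} {w₂} C Z C' lk cyc cyc' uC uC' bound | inj₂ disjoint | inj₁ uV | no w₂∉Z with common? _≟_ (targets Z) (sources C)
    ... | inj₁ (y , mt , mc) = transport-hitsFirst (transport k) C Z C' lk cyc cyc' uC uC' bound y mt mc
    ... | inj₂ Z∩C with common? _≟_ (sources Z) (sources C')
    ...   | inj₁ (y , ms , mc') = transport-hitsSecond (transport k) C Z C' lk cyc cyc' uC uC' bound y ms mc'
    ...   | inj₂ Z∩C' = transport-looseHandcuff C Z C' cyc cyc' uC uC' disjoint uV w₂∉Z Z∩C Z∩C'

    unbalanced-agree : ∀ {y} (X Y : Walk y y) → sgn (steps X) ≡ Sign.- → sgn (steps Y) ≡ Sign.- →
      len X + len Y ≤ N → τ (steps X) ≡ τ (steps Y)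
    unbalanced-agree X Y uX uY bound
      with normalForm (len X) X ≤-refl (≤-trans (m≤m+n (len X) (len Y)) bound) uX
         | normalForm (len Y) Y ≤-refl (≤-trans (m≤n+m (len Y) (len X)) bound) uY
    ... | w₁ , P , C , cyc , uC , eX , lPC | w₂ , P' , C' , cyc' , uC' , eY , lPC' = begin
        τ (steps X) ≡⟨ eX ⟩
        conjAlong f (steps P) (τ (steps C)) ≡⟨ cong (conjAlong f (steps P)) transported ⟩
        conjAlong f (steps P) (conjAlong f (steps Z) (τ (steps C'))) ≡⟨ cong (conjAlong f (steps P)) (conjAlong-++ʷ (reverseʷ P) P' _) ⟩
        conjAlong f (steps P) (conjAlong f (steps (reverseʷ P)) (conjAlong f (steps P') (τ (steps C'))))
          ≡⟨ cong (λ l → conjAlong f (steps P) (conjAlong f l (conjAlong f (steps P') (τ (steps C'))))) (steps-reverseʷ P) ⟩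
        conjAlong f (steps P) (conjAlong f (reverseSteps (steps P)) (conjAlong f (steps P') (τ (steps C')))) ≡⟨ conjAlong-reverse (steps P) _ ⟩
        conjAlong f (steps P') (τ (steps C')) ≡⟨ sym eY ⟩
        τ (steps Y) ∎
      where
      Z = reverseʷ P ++ʷ P'
      len-Z : len Z ≡ len P + len P'
      len-Z = trans (len-++ʷ (reverseʷ P) P') (cong (_+ len P') (len-reverseʷ P))
      rearrange : ∀ c p p' c' → c + (p + p') + c' ≡ (p + c) + (p' + c')
      rearrange = solve-∀
      bound′ : len C + len Z + len C' ≤ N
      bound′ = subst (_≤ N) (sym (trans (cong (λ t → len C + t + len C') len-Z) (rearrange (len C) (len P) (len P') (len C'))))
              (≤-trans (+-mono-≤ lPC lPC') bound)
      transported : τ (steps C) ≡ conjAlong f (steps Z) (τ (steps C'))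
      transported = transport (len Z) C Z C' ≤-refl cyc cyc' uC uC' bound′

    -- A balanced closed walk that is not a cycle splits off a closed subwalk B; if B
    -- is unbalanced then so is the rest of the walk, and the two are compared.
    balanced-vanish : ∀ {x} (w : Walk x x) → len w ≤ N → sgn (steps w) ≡ Sign.+ → τ (steps w) ≡ 0#
    balanced-vanish (nil _) _ _ = refl
    balanced-vanish w@(cons _ _ _) lN bal with sourcesUnique⊎closedSubwalk w
    ... | inj₁ uV with edgesUnique⊎backtrack w uV
    ...   | inj₁ uE = twisted-balancedCycle w (s≤s z≤n , uV , uE) bal
    ...   | inj₂ (e , b , eq) = trans (cong τ eq) (twisted-backtrack f e b)
    balanced-vanish w@(cons _ _ _) lN bal | inj₂ (_ , A , B , D , eq , lB , lD) with sgn (steps B) ≟ˢ Sign.+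
    ... | yes bB = trans (twisted-drop (ih B (<-≤-trans (len-middle< lD) lN) bB) bB)
                         (ih (A ++ʷ D) (<-≤-trans (len-outer< lB) lN) (trans (sgn-outer-balanced bB) bal))
      where open ClosedSubwalk w A B D eq
    ... | no ¬bB = trans (twisted-unbalanced-middle uB) (cancel (sgn (steps A)) (τ (steps A)) (τ (steps B)) (τ (steps D)) tB)
      where
      open ClosedSubwalk w A B D eq
      uB = ≢+⇒≡- ¬bB
      D-sign : sgn (steps D) ≡ opposite (sgn (steps A))
      D-sign = ·-·-≡+⇒≡opposite (sgn (steps A)) (sgn (steps D))
        (trans (cong (λ z → sgn (steps A) · (z · sgn (steps D))) (sym uB)) (trans (sym sgn-split₃) bal))
      uDA : sgn (steps (D ++ʷ A)) ≡ Sign.-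
      uDA = trans (cong sgn (steps-++ʷ D A))
        (trans (sgn-++ (steps D) (steps A)) (trans (cong (_· sgn (steps A)) D-sign) (opposite[s]*s≡- (sgn (steps A)))))
      bound′ : len (D ++ʷ A) + len B ≤ N
      bound′ = subst (_≤ N) (sym (trans (cong (_+ len B) (len-++ʷ D A)) (trans (rearrange (len A) (len B) (len D)) (sym len-split₃)))) lN
        where
        rearrange : ∀ a b d → (d + a) + b ≡ a + (b + d)
        rearrange = solve-∀
      tB : τ (steps B) ≡ τ (steps D) ⊕ actS (opposite (sgn (steps A))) (τ (steps A))
      tB = trans (sym (unbalanced-agree (D ++ʷ A) B uDA uB bound′))
        (trans (cong τ (steps-++ʷ D A)) (trans (twisted-++ f (steps D) (steps A)) (cong (λ s → τ (steps D) ⊕ actS s (τ (steps A))) D-sign)))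
      cancel : ∀ a ta tb td → tb ≡ td ⊕ actS (opposite a) ta → ta ⊕ actS a (tb ⊕ ⊖ td) ≡ 0#
      cancel Sign.+ ta tb td refl = prove (x0 :+ ((x2 :+ :- x0) :+ :- x2)) :0 tt (ta ∷ tb ∷ td ∷ [])
      cancel Sign.- ta tb td refl = prove (x0 :+ :- ((x2 :+ x0) :+ :- x2)) :0 tt (ta ∷ tb ∷ td ∷ [])

  balancedVanishBelow : ∀ N → BalancedVanish N
  balancedVanishBelow zero w () bal
  balancedVanishBelow (suc N) w lt bal = Induction.balanced-vanish N (balancedVanishBelow N) w (≤-pred lt) bal

  twisted-balanced : ∀ {x} (w : Walk x x) → sgn (steps w) ≡ Sign.+ → τ (steps w) ≡ 0#
  twisted-balanced w bal = balancedVanishBelow (suc (len w)) w ≤-refl bal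

  twisted-unbalanced : ∀ {y} (X Y : Walk y y) → sgn (steps X) ≡ Sign.- → sgn (steps Y) ≡ Sign.- → τ (steps X) ≡ τ (steps Y)
  twisted-unbalanced X Y uX uY = Induction.unbalanced-agree (len X + len Y) (balancedVanishBelow (len X + len Y)) X Y uX uY ≤-refl

module Potentials (Σg : SignedGraph) (ω : Orientation Σg) (compat : Compatible Σg ω)
                  {n : ℕ} (plus : Fin n → Fin n → Fin n) (0# : Fin n) (neg : Fin n → Fin n)
                  (isAG : IsAbelianGroup _≡_ plus 0# neg) where

  open import Relation.Binary.PropositionalEquality hiding ([_])
  open import Data.Bool using (false; true; not)
  open import Data.Vec using (Vec; []; _∷_; lookup; tabulate)
  open import Data.Vec.Properties using (lookup∘tabulate)
  open import Data.Product using (_,_)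
  open import Data.Unit using (tt)
  open import Data.List using ([]; _∷_)
  open import Data.Sign using (Sign; opposite) renaming (_*_ to _·_)
  open import Data.Sign.Properties using (*-identityʳ)
  open TwistedSums Σg ω compat plus 0# neg isAG public

  open SignedGraph Σg
  open ≡-Reasoning

  ifNegative : Sign → G → G
  ifNegative Sign.+ x = 0#
  ifNegative Sign.- x = x

  actE : ∀ {k} → Sign → Expr k → Expr k
  actE Sign.+ e = e
  actE Sign.- e = :- e

  ifNegativeE : ∀ {k} → Sign → Expr k → Expr k
  ifNegativeE Sign.+ e = :0
  ifNegativeE Sign.- e = e

  telescope-lhs : Sign → Sign → Sign → Sign → Expr 4
  telescope-lhs a c s w = actE (a · s) ((actE a x0 :+ actE c x1) :+ ifNegativeE sg (actE a x3)) :+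
               ((actE (s · sg) x1 :- actE (s · sg · w) x2) :+ ifNegativeE w (actE (s · sg) x3))
    where sg = opposite (a · c)

  telescope-rhs : Sign → Sign → Sign → Sign → Expr 4
  telescope-rhs a c s w = (actE s x0 :- actE (s · (sg · w)) x2) :+ ifNegativeE (sg · w) (actE s x3)
    where sg = opposite (a · c)

  telescope-step : ∀ a c s w {sg} → sg ≡ opposite (a · c) → ∀ pu pc pv t →
    actS (a · s) ((actS a pu ⊕ actS c pc) ⊕ ifNegative sg (actS a t)) ⊕
      ((actS (s · sg) pc ⊕ ⊖ actS (s · sg · w) pv) ⊕ ifNegative w (actS (s · sg) t))
    ≡ (actS s pu ⊕ ⊖ actS (s · (sg · w)) pv) ⊕ ifNegative (sg · w) (actS s t)
  telescope-step Sign.+ Sign.+ Sign.+ Sign.+ refl pu pc pv t =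
    prove (telescope-lhs Sign.+ Sign.+ Sign.+ Sign.+) (telescope-rhs Sign.+ Sign.+ Sign.+ Sign.+) tt (pu ∷ pc ∷ pv ∷ t ∷ [])
  telescope-step Sign.+ Sign.+ Sign.+ Sign.- refl pu pc pv t =
    prove (telescope-lhs Sign.+ Sign.+ Sign.+ Sign.-) (telescope-rhs Sign.+ Sign.+ Sign.+ Sign.-) tt (pu ∷ pc ∷ pv ∷ t ∷ [])
  telescope-step Sign.+ Sign.+ Sign.- Sign.+ refl pu pc pv t =
    prove (telescope-lhs Sign.+ Sign.+ Sign.- Sign.+) (telescope-rhs Sign.+ Sign.+ Sign.- Sign.+) tt (pu ∷ pc ∷ pv ∷ t ∷ [])
  telescope-step Sign.+ Sign.+ Sign.- Sign.- refl pu pc pv t =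
    prove (telescope-lhs Sign.+ Sign.+ Sign.- Sign.-) (telescope-rhs Sign.+ Sign.+ Sign.- Sign.-) tt (pu ∷ pc ∷ pv ∷ t ∷ [])
  telescope-step Sign.+ Sign.- Sign.+ Sign.+ refl pu pc pv t =
    prove (telescope-lhs Sign.+ Sign.- Sign.+ Sign.+) (telescope-rhs Sign.+ Sign.- Sign.+ Sign.+) tt (pu ∷ pc ∷ pv ∷ t ∷ [])
  telescope-step Sign.+ Sign.- Sign.+ Sign.- refl pu pc pv t =
    prove (telescope-lhs Sign.+ Sign.- Sign.+ Sign.-) (telescope-rhs Sign.+ Sign.- Sign.+ Sign.-) tt (pu ∷ pc ∷ pv ∷ t ∷ [])
  telescope-step Sign.+ Sign.- Sign.- Sign.+ refl pu pc pv t =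
    prove (telescope-lhs Sign.+ Sign.- Sign.- Sign.+) (telescope-rhs Sign.+ Sign.- Sign.- Sign.+) tt (pu ∷ pc ∷ pv ∷ t ∷ [])
  telescope-step Sign.+ Sign.- Sign.- Sign.- refl pu pc pv t =
    prove (telescope-lhs Sign.+ Sign.- Sign.- Sign.-) (telescope-rhs Sign.+ Sign.- Sign.- Sign.-) tt (pu ∷ pc ∷ pv ∷ t ∷ [])
  telescope-step Sign.- Sign.+ Sign.+ Sign.+ refl pu pc pv t =
    prove (telescope-lhs Sign.- Sign.+ Sign.+ Sign.+) (telescope-rhs Sign.- Sign.+ Sign.+ Sign.+) tt (pu ∷ pc ∷ pv ∷ t ∷ [])
  telescope-step Sign.- Sign.+ Sign.+ Sign.- refl pu pc pv t =
    prove (telescope-lhs Sign.- Sign.+ Sign.+ Sign.-) (telescope-rhs Sign.- Sign.+ Sign.+ Sign.-) tt (pu ∷ pc ∷ pv ∷ t ∷ [])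
  telescope-step Sign.- Sign.+ Sign.- Sign.+ refl pu pc pv t =
    prove (telescope-lhs Sign.- Sign.+ Sign.- Sign.+) (telescope-rhs Sign.- Sign.+ Sign.- Sign.+) tt (pu ∷ pc ∷ pv ∷ t ∷ [])
  telescope-step Sign.- Sign.+ Sign.- Sign.- refl pu pc pv t =
    prove (telescope-lhs Sign.- Sign.+ Sign.- Sign.-) (telescope-rhs Sign.- Sign.+ Sign.- Sign.-) tt (pu ∷ pc ∷ pv ∷ t ∷ [])
  telescope-step Sign.- Sign.- Sign.+ Sign.+ refl pu pc pv t =
    prove (telescope-lhs Sign.- Sign.- Sign.+ Sign.+) (telescope-rhs Sign.- Sign.- Sign.+ Sign.+) tt (pu ∷ pc ∷ pv ∷ t ∷ [])
  telescope-step Sign.- Sign.- Sign.+ Sign.- refl pu pc pv t =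
    prove (telescope-lhs Sign.- Sign.- Sign.+ Sign.-) (telescope-rhs Sign.- Sign.- Sign.+ Sign.-) tt (pu ∷ pc ∷ pv ∷ t ∷ [])
  telescope-step Sign.- Sign.- Sign.- Sign.+ refl pu pc pv t =
    prove (telescope-lhs Sign.- Sign.- Sign.- Sign.+) (telescope-rhs Sign.- Sign.- Sign.- Sign.+) tt (pu ∷ pc ∷ pv ∷ t ∷ [])
  telescope-step Sign.- Sign.- Sign.- Sign.- refl pu pc pv t =
    prove (telescope-lhs Sign.- Sign.- Sign.- Sign.-) (telescope-rhs Sign.- Sign.- Sign.- Sign.-) tt (pu ∷ pc ∷ pv ∷ t ∷ [])

  -- The edge function induced by a potential p on the vertices and a value t
  -- that is constant on components: along every walk its twisted sum telescopes
  -- to the boundary terms of twistedFrom-induced.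
  module Induced (p t : Fin nV → G) (t-const : ∀ e → t (endpoint e false) ≡ t (endpoint e true)) where

    inducedOn : Fin nE → G
    inducedOn e = (actS (ω e false) (p (endpoint e false)) ⊕ actS (ω e true) (p (endpoint e true)))
             ⊕ ifNegative (σ e) (actS (ω e false) (t (endpoint e false)))

    induced : Vec G nE
    induced = tabulate inducedOn

    t-const′ : ∀ e b → t (endpoint e (not b)) ≡ t (endpoint e b)
    t-const′ e false = sym (t-const e)
    t-const′ e true = t-const e

    inducedOn-side : ∀ e b → inducedOn e ≡ (actS (ω e b) (p (endpoint e b)) ⊕ actS (ω e (not b)) (p (endpoint e (not b))))
                                 ⊕ ifNegative (σ e) (actS (ω e b) (t (endpoint e b)))
    inducedOn-side e false = refl
    inducedOn-side e true = cong₂ _⊕_ (comm _ _) (twist-side (σ e) refl)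
      where
      twist-side : ∀ s → σ e ≡ s →
        ifNegative s (actS (ω e false) (t (endpoint e false))) ≡ ifNegative s (actS (ω e true) (t (endpoint e true)))
      twist-side Sign.+ _ = refl
      twist-side Sign.- σe≡- = cong₂ actS (σ≡-⇒ω≡ e σe≡-) (t-const e)

    twistedFrom-induced : ∀ {u v} (W : Walk u v) s → twistedFrom induced s (steps W) ≡
      (actS s (p u) ⊕ ⊖ actS (s · sgn (steps W)) (p v)) ⊕ ifNegative (sgn (steps W)) (actS s (t u))
    twistedFrom-induced (nil refl) s = sym (trans (cong (λ z → (actS s (p _) ⊕ ⊖ actS z (p _)) ⊕ 0#) (*-identityʳ s)) (cancel (actS s (p _))))
      where
      cancel : ∀ x → (x ⊕ ⊖ x) ⊕ 0# ≡ 0#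
      cancel x = prove ((x0 :+ :- x0) :+ :0) :0 tt (x ∷ [])
    twistedFrom-induced {v = v} (cons (e , b) refl W) s = begin
      actS (ω e b · s) (lookup induced e) ⊕ twistedFrom induced (s · σ e) (steps W)
        ≡⟨ cong₂ _⊕_ (cong (actS (ω e b · s)) (trans (lookup∘tabulate inducedOn e) (inducedOn-side e b))) (twistedFrom-induced W (s · σ e)) ⟩
      actS (ω e b · s) ((actS (ω e b) (p (endpoint e b)) ⊕ actS (ω e (not b)) (p (endpoint e (not b))))
                                 ⊕ ifNegative (σ e) (actS (ω e b) (t (endpoint e b)))) ⊕
        ((actS (s · σ e) (p (endpoint e (not b))) ⊕ ⊖ actS (s · σ e · sgn (steps W)) (p v)) ⊕ ifNegative (sgn (steps W)) (actS (s · σ e) (t (endpoint e (not b)))))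
        ≡⟨ cong (λ z → actS (ω e b · s) ((actS (ω e b) (p (endpoint e b)) ⊕ actS (ω e (not b)) (p (endpoint e (not b))))
                                 ⊕ ifNegative (σ e) (actS (ω e b) (t (endpoint e b)))) ⊕
        ((actS (s · σ e) (p (endpoint e (not b))) ⊕ ⊖ actS (s · σ e · sgn (steps W)) (p v)) ⊕ ifNegative (sgn (steps W)) (actS (s · σ e) z))) (t-const′ e b) ⟩
      actS (ω e b · s) ((actS (ω e b) (p (endpoint e b)) ⊕ actS (ω e (not b)) (p (endpoint e (not b))))
                                 ⊕ ifNegative (σ e) (actS (ω e b) (t (endpoint e b)))) ⊕
        ((actS (s · σ e) (p (endpoint e (not b))) ⊕ ⊖ actS (s · σ e · sgn (steps W)) (p v)) ⊕ ifNegative (sgn (steps W)) (actS (s · σ e) (t (endpoint e b))))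
        ≡⟨ telescope-step (ω e b) (ω e (not b)) s (sgn (steps W)) (σ-via-ω e b) _ _ _ _ ⟩
      (actS s (p (endpoint e b)) ⊕ ⊖ actS (s · (σ e · sgn (steps W))) (p v)) ⊕ ifNegative (σ e · sgn (steps W)) (actS s (t (endpoint e b))) ∎

    induced-isTension : IsTension Σg ω plus 0# neg induced
    induced-isTension [] ()
    induced-isTension (s ∷ l) (cw , m , cm , h) with fromClosedWalk s l cw
    ... | w , eq = begin
      twistedFrom induced Sign.+ (s ∷ l) ≡⟨ cong (twistedFrom induced Sign.+) (sym eq) ⟩
      twistedFrom induced Sign.+ (steps w) ≡⟨ twistedFrom-induced w Sign.+ ⟩
      (p (srcS s) ⊕ ⊖ actS (sgn (steps w)) (p (srcS s))) ⊕ ifNegative (sgn (steps w)) (t (srcS s))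
        ≡⟨ cong (λ z → (p (srcS s) ⊕ ⊖ actS z (p (srcS s))) ⊕ ifNegative z (t (srcS s))) sgn-circuit ⟩
      (p (srcS s) ⊕ ⊖ p (srcS s)) ⊕ 0# ≡⟨ prove ((x0 :+ :- x0) :+ :0) :0 tt (p (srcS s) ∷ []) ⟩
      0# ∎
      where
      sgn-circuit : sgn (steps w) ≡ Sign.+
      sgn-circuit = trans (cong sgn eq) (circuitWalk-balanced m cm (s ∷ l) h)

module Components (Σg : SignedGraph) (Rb Ru : List (Vertex Σg)) (reps : ComponentReps Σg Rb Ru) where

  open import Data.Nat.Properties using (≤-refl)
  open import Function using (id)
  open import Data.Bool using (false; true; not)
  open import Data.Fin using (Fin; _≟_)
  open import Data.Fin.Properties using (any?)
  open import Data.Product using (∃; _×_; _,_; proj₁; proj₂)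
  open import Data.Sum using (inj₁; inj₂)
  open import Data.Empty using (⊥-elim)
  open import Data.List using ([]; _∷_; _++_; map)
  open import Data.List.Membership.Propositional using (_∈_)
  open import Data.List.Membership.Propositional.Properties using (∈-++⁺ˡ; ∈-++⁺ʳ)
  open import Data.Sign using (Sign) renaming (_*_ to _·_)
  open import Data.Sign.Properties using (*-comm; *-assoc; s*s≡+) renaming (_≟_ to _≟ˢ_)
  open import Relation.Nullary using (¬_; Dec; yes; no)
  open import Relation.Nullary.Decidable using (_×-dec_; ¬?)
  open import Relation.Binary.PropositionalEquality hiding ([_])
  open ListFacts
  open SignFacts
  open Cycles Σg

  open SignedGraph Σg

  R : List V
  R = Rb ++ Ru

  Rb⊆R : ∀ {r} → r ∈ Rb → r ∈ R
  Rb⊆R = ∈-++⁺ˡ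

  Ru⊆R : ∀ {r} → r ∈ Ru → r ∈ R
  Ru⊆R = ∈-++⁺ʳ Rb

  connected : ∀ {u v} → Walk u v → Connected Σg u v
  connected w = steps w , toWalkFromTo w

  walkOf : ∀ {u v} → Connected Σg u v → Walk u v
  walkOf (l , c) = proj₁ (fromWalkFromTo l c)

  rep : V → V
  rep v = proj₁ (proj₁ (proj₂ reps) v)

  rep∈R : ∀ v → rep v ∈ R
  rep∈R v = proj₁ (proj₂ (proj₁ (proj₂ reps) v))

  walkFromRep : ∀ v → Walk (rep v) v
  walkFromRep v = walkOf (proj₂ (proj₂ (proj₁ (proj₂ reps) v)))

  reps-equal : ∀ {r r'} → r ∈ R → r' ∈ R → Walk r r' → r ≡ r'
  reps-equal r∈ r'∈ w with allPairs-lookup (proj₁ reps) r∈ r'∈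
  ... | inj₁ r≡r'        = r≡r'
  ... | inj₂ (inj₁ ¬r~r') = ⊥-elim (¬r~r' (connected w))
  ... | inj₂ (inj₂ ¬r'~r) = ⊥-elim (¬r'~r (connected (reverseʷ w)))

  rep-walk : ∀ {u v} → Walk u v → rep u ≡ rep v
  rep-walk {u} {v} w = reps-equal (rep∈R u) (rep∈R v) (walkFromRep u ++ʷ w ++ʷ reverseʷ (walkFromRep v))

  rep-idem : ∀ {r} → r ∈ R → rep r ≡ r
  rep-idem {r} r∈ = reps-equal (rep∈R r) r∈ (walkFromRep r)

  stepWalk : ∀ e b → Walk (endpoint e b) (endpoint e (not b))
  stepWalk e b = cons (e , b) refl (nil refl)

  rep-edge : ∀ e → rep (endpoint e false) ≡ rep (endpoint e true)
  rep-edge e = rep-walk (stepWalk e false)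

  -- The walk from the representative, chosen empty at the representative itself.
  spanWalk : ∀ v → Walk (rep v) v
  spanWalk v with v ≟ rep v
  ... | yes v≡r = nil (sym v≡r)
  ... | no _    = walkFromRep v

  spanWalk-rep : ∀ v → v ≡ rep v → steps (spanWalk v) ≡ []
  spanWalk-rep v v≡r with v ≟ rep v
  ... | yes _   = refl
  ... | no v≢r = ⊥-elim (v≢r v≡r)

  spanWalk-nonrep : ∀ v → ¬ v ≡ rep v → spanWalk v ≡ walkFromRep v
  spanWalk-nonrep v v≢r with v ≟ rep v
  ... | yes v≡r = ⊥-elim (v≢r v≡r)
  ... | no _    = refl

  spanSign : V → Sign
  spanSign v = sgn (steps (spanWalk v))

  -- The component of r is balanced exactly when spanSign is a switching
  -- function for it, i.e. every edge of the component is consistent.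
  Consistent : V → Set
  Consistent r = ∀ e → rep (endpoint e false) ≡ r → σ e ≡ spanSign (endpoint e false) · spanSign (endpoint e true)

  sgn-consistent : ∀ {r} → Consistent r → ∀ {a b} (X : Walk a b) → rep a ≡ r → sgn (steps X) ≡ spanSign a · spanSign b
  sgn-consistent h {a} (nil refl) _ = sym (s*s≡+ (spanSign a))
  sgn-consistent {r} h {b = v} (cons (e , b) refl X) ra = begin
    σ e · sgn (steps X)                                     ≡⟨ cong (σ e ·_) (sgn-consistent h X (trans (sym (rep-walk (stepWalk e b))) ra)) ⟩
    σ e · (spanSign (endpoint e (not b)) · spanSign v)      ≡⟨ cong (_· (spanSign (endpoint e (not b)) · spanSign v)) (σ-consistent b) ⟩
    (spanSign (endpoint e b) · spanSign (endpoint e (not b))) · (spanSign (endpoint e (not b)) · spanSign v)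
      ≡⟨ cancel-middle (spanSign (endpoint e b)) (spanSign (endpoint e (not b))) (spanSign v) ⟩
    spanSign (endpoint e b) · spanSign v                    ∎
    where
    open ≡-Reasoning
    rep-e : rep (endpoint e false) ≡ r
    rep-e = from-side b ra
      where
      from-side : ∀ b → rep (endpoint e b) ≡ r → rep (endpoint e false) ≡ r
      from-side false = id
      from-side true  = trans (rep-edge e)
    σ-consistent : ∀ b → σ e ≡ spanSign (endpoint e b) · spanSign (endpoint e (not b))
    σ-consistent false = h e rep-e
    σ-consistent true  = trans (h e rep-e) (*-comm (spanSign (endpoint e false)) (spanSign (endpoint e true)))
    cancel-middle : ∀ a c w → (a · c) · (c · w) ≡ a · w
    cancel-middle a c w = begin
      (a · c) · (c · w)  ≡⟨ *-assoc a c (c · w) ⟩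
      a · (c · (c · w))  ≡⟨ cong (a ·_) (sym (*-assoc c c w)) ⟩
      a · ((c · c) · w)  ≡⟨ cong (λ z → a · (z · w)) (s*s≡+ c) ⟩
      a · w              ∎

  consistent⇒balanced : ∀ {r} → Consistent r → r ∈ R → BalancedComponent Σg r
  consistent⇒balanced {r} h r∈ (s ∷ l) cyc v v∈ r~v with fromClosedWalk s l (proj₁ cyc)
  ... | X , eq = trans (cong sgn (sym eq)) (trans (sgn-consistent h X rep-s) (s*s≡+ (spanSign (srcS s))))
    where
    rep-s : rep (srcS s) ≡ r
    rep-s = trans (rep-walk (proj₁ (splitAtSource X (subst (v ∈_) (cong (map srcS) (sym eq)) v∈))))
                  (trans (sym (rep-walk (walkOf r~v))) (rep-idem r∈))

  Inconsistent : V → Fin nE → Set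
  Inconsistent r e = (rep (endpoint e false) ≡ r) × ¬ (σ e ≡ spanSign (endpoint e false) · spanSign (endpoint e true))

  inconsistent? : ∀ r → Dec (∃ λ e → Inconsistent r e)
  inconsistent? r = any? λ e → (rep (endpoint e false) ≟ r) ×-dec ¬? (σ e ≟ˢ spanSign (endpoint e false) · spanSign (endpoint e true))

  ¬inconsistent⇒consistent : ∀ r → ¬ (∃ λ e → Inconsistent r e) → Consistent r
  ¬inconsistent⇒consistent r none e rep-e with σ e ≟ˢ spanSign (endpoint e false) · spanSign (endpoint e true)
  ... | yes c = c
  ... | no ¬c = ⊥-elim (none (e , rep-e , ¬c))

  -- The closed walk at r through the edge e: out along spanWalk, across e, and back.
  closedWalkVia : ∀ r e → rep (endpoint e false) ≡ r → Walk r r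
  closedWalkVia r e eq =
    castˡ (sym eq) (spanWalk (endpoint e false)) ++ʷ
    stepWalk e false ++ʷ reverseʷ (castˡ (sym (trans (sym (rep-edge e)) eq)) (spanWalk (endpoint e true)))

  steps-closedWalkVia : ∀ r e eq →
    steps (closedWalkVia r e eq) ≡ steps (spanWalk (endpoint e false)) ++ (e , false) ∷ reverseSteps (steps (spanWalk (endpoint e true)))
  steps-closedWalkVia r e eq = trans (steps-++ʷ (castˡ (sym eq) (spanWalk (endpoint e false))) _)
    (cong₂ _++_ (steps-castˡ (sym eq) _) (cong ((e , false) ∷_)
      (trans (steps-castˡ refl _) (trans (steps-reverseʷ (castˡ eq′ (spanWalk (endpoint e true))))
        (cong reverseSteps (steps-castˡ eq′ (spanWalk (endpoint e true))))))))
    where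
    eq′ = sym (trans (sym (rep-edge e)) eq)

  sgn-closedWalkVia : ∀ r e eq → ¬ (σ e ≡ spanSign (endpoint e false) · spanSign (endpoint e true)) →
    sgn (steps (closedWalkVia r e eq)) ≡ Sign.-
  sgn-closedWalkVia r e eq inconsistent = begin
    sgn (steps (closedWalkVia r e eq))      ≡⟨ cong sgn (steps-closedWalkVia r e eq) ⟩
    sgn (steps (spanWalk u) ++ (e , false) ∷ reverseSteps (steps (spanWalk w)))
      ≡⟨ sgn-++ (steps (spanWalk u)) _ ⟩
    spanSign u · (σ e · sgn (reverseSteps (steps (spanWalk w))))
      ≡⟨ cong (λ z → spanSign u · (σ e · z)) (sgn-reverseSteps (steps (spanWalk w))) ⟩
    spanSign u · (σ e · spanSign w)         ≡⟨ odd (σ e) (spanSign u) (spanSign w) inconsistent ⟩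
    Sign.-                                  ∎
    where
    open ≡-Reasoning
    u = endpoint e false
    w = endpoint e true
    odd : ∀ g a c → ¬ g ≡ a · c → a · (g · c) ≡ Sign.-
    odd Sign.+ Sign.+ Sign.- _ = refl
    odd Sign.+ Sign.- Sign.+ _ = refl
    odd Sign.- Sign.+ Sign.+ _ = refl
    odd Sign.- Sign.- Sign.- _ = refl
    odd Sign.+ Sign.+ Sign.+ g≢ac = ⊥-elim (g≢ac refl)
    odd Sign.+ Sign.- Sign.- g≢ac = ⊥-elim (g≢ac refl)
    odd Sign.- Sign.+ Sign.- g≢ac = ⊥-elim (g≢ac refl)
    odd Sign.- Sign.- Sign.+ g≢ac = ⊥-elim (g≢ac refl)

  Rb-consistent : ∀ {r} → r ∈ Rb → ¬ (∃ λ e → Inconsistent r e)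
  Rb-consistent {r} r∈ (e , eq , inconsistent)
    with unbalancedCycle _ (closedWalkVia r e eq) ≤-refl (sgn-closedWalkVia r e eq inconsistent)
  ... | y , C , cyc , unbalanced , C⊆ = +≢- (trans (sym balanced) unbalanced)
    where
    y∈ = C⊆ (start∈sources C (proj₁ cyc))
    balanced = proj₁ (proj₂ (proj₂ reps)) r r∈ (steps C) (isCycle-steps C cyc) y
      (start∈sources C (proj₁ cyc)) (connected (proj₁ (splitAtSource (closedWalkVia r e eq) y∈)))

  Ru-inconsistent : ∀ {r} → r ∈ Ru → ∃ λ e → Inconsistent r e
  Ru-inconsistent {r} r∈ with inconsistent? r
  ... | yes found = found
  ... | no none = ⊥-elim (proj₂ (proj₂ (proj₂ reps)) r r∈ (consistent⇒balanced (¬inconsistent⇒consistent r none) (Ru⊆R r∈)))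

module Counting where

  open import Defs using (HasSize; size2G)
  open import Data.Nat using (ℕ; zero; suc; _+_; _*_; _∸_; _^_; _≤_; NonZero)
  open import Data.Nat.Properties
    using (*-cancelʳ-≡; ^-distribˡ-+-*; m∸n+n≡m; *-assoc; *-comm; *-identityʳ; m^n≢0; ∸-+-assoc; m+n∸m≡n; ∸-monoˡ-≤)
  open import Data.Nat.Tactic.RingSolver using (solve-∀)
  open import Data.Fin using (Fin; zero; suc; _≟_)
  open import Data.Fin.Properties using (suc-injective; injective⇒≤; any?)
  open import Data.Vec using (Vec; []; _∷_; lookup; head; tail)
  open import Data.List using (List; []; [_]; _∷_; _++_; map; length; cartesianProductWith; filter; tabulate)
  import Data.List as List
  open import Data.List.Properties using (length-map; length-++; length-tabulate)
  open import Data.List.Membership.Propositional using (_∈_; _∉_)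
  open import Data.List.Membership.DecPropositional using (_∈?_)
  open import Data.List.Membership.Propositional.Properties
    using (∈-map⁺; ∈-map⁻; ∈-cartesianProductWith⁺; ∈-cartesianProductWith⁻; ∈-lookup; ∈-filter⁺; ∈-filter⁻; ∈-tabulate⁺)
  open import Data.List.Relation.Unary.Any using (here; there)
  open import Data.List.Relation.Unary.AllPairs using ([]; _∷_)
  open import Data.List.Relation.Unary.All using ([])
  open import Data.List.Relation.Unary.Unique.Propositional using (Unique)
  open import Data.List.Relation.Unary.Unique.Propositional.Properties
    using (Unique[x∷xs]⇒x∉xs; cartesianProductWith⁺; filter⁺; tabulate⁺)
  open import Data.Product using (∃; _×_; _,_; proj₁; proj₂)
  open import Data.Empty using (⊥; ⊥-elim)
  open import Data.Unit using (⊤; tt)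
  open import Function.Bundles using (mk⇔; Equivalence)
  open import Relation.Nullary using (¬_; yes; no)
  open import Relation.Unary using (Decidable)
  open import Relation.Binary.PropositionalEquality hiding ([_])
  open ListFacts

  module _ {A : Set} where

    HasSize-⇔ : ∀ {P Q : A → Set} {N} → HasSize A P N → (∀ a → P a → Q a) → (∀ a → Q a → P a) → HasSize A Q N
    HasSize-⇔ (l , u , mem , len) P⇒Q Q⇒P =
      l , u , (λ a → mk⇔ (λ a∈ → P⇒Q a (Equivalence.to (mem a) a∈)) (λ qa → Equivalence.from (mem a) (Q⇒P a qa))) , len

    HasSize-≡ : ∀ {P : A → Set} {N N'} → HasSize A P N → N ≡ N' → HasSize A P N'
    HasSize-≡ (l , u , mem , len) e = l , u , mem , trans len e

    HasSize-filter : ∀ {P : A → Set} (P? : Decidable P) (xs : List A) → Unique xs → (∀ a → a ∈ xs) →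
      HasSize A P (length (filter P? xs))
    HasSize-filter P? xs u all∈ =
      filter P? xs , filter⁺ P? u , (λ a → mk⇔ (λ a∈ → proj₂ (∈-filter⁻ P? {xs = xs} a∈)) (∈-filter⁺ P? (all∈ a))) , refl

  HasSize-singleton : ∀ {n} (z : Fin n) → HasSize (Fin n) (_≡ z) 1
  HasSize-singleton z = [ z ] , [] ∷ [] , (λ x → mk⇔ (λ { (here x≡z) → x≡z ; (there ()) }) here) , refl

  HasSize-Fin : ∀ n → HasSize (Fin n) (λ _ → ⊤) n
  HasSize-Fin n = tabulate (λ i → i) , tabulate⁺ (λ e → e) , (λ x → mk⇔ (λ _ → tt) (λ _ → ∈-tabulate⁺ x)) , length-tabulate (λ i → i)

  HasSize-2G : ∀ {n} (_∙_ : Fin n → Fin n → Fin n) → HasSize (Fin n) (λ x → ∃ λ y → x ≡ y ∙ y) (size2G _∙_)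
  HasSize-2G _∙_ = HasSize-filter (λ x → any? (λ y → x ≟ (y ∙ y))) _ (tabulate⁺ (λ e → e)) ∈-tabulate⁺

  module _ {A B : Set} where

    unique-map⁺ : ∀ (g : A → B) (l : List A) → Unique l → (∀ {a b} → a ∈ l → b ∈ l → g a ≡ g b → a ≡ b) → Unique (map g l)
    unique-map⁺ g []      _ _   = []
    unique-map⁺ g (x ∷ l) u inj =
      unique-∷ (λ gx∈ → let a , a∈ , gx≡ga = ∈-map⁻ g gx∈ in
                        Unique[x∷xs]⇒x∉xs u (subst (_∈ l) (sym (inj (here refl) (there a∈) gx≡ga)) a∈))
               (unique-map⁺ g l (unique-++⁻ʳ [ x ] u) (λ a∈ b∈ → inj (there a∈) (there b∈)))
      where open Data.List using ([_])

    HasSize-bijection : ∀ {P : A → Set} {Q : B → Set} {N} → HasSize A P N →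
      (φ : A → B) (ψ : B → A) → (∀ a → P a → Q (φ a)) → (∀ a → P a → ψ (φ a) ≡ a) →
      (∀ b → Q b → P (ψ b)) → (∀ b → Q b → φ (ψ b) ≡ b) → HasSize B Q N
    HasSize-bijection {Q = Q} (l , u , mem , len) φ ψ P⇒Q ψφ Q⇒P φψ =
      map φ l , unique-map⁺ φ l u injective , (λ b → mk⇔ (to b) (from b)) , trans (length-map φ l) len
      where
      injective : ∀ {a b} → a ∈ l → b ∈ l → φ a ≡ φ b → a ≡ b
      injective a∈ b∈ e =
        trans (sym (ψφ _ (Equivalence.to (mem _) a∈))) (trans (cong ψ e) (ψφ _ (Equivalence.to (mem _) b∈)))
      to : ∀ b → b ∈ map φ l → Q b
      to b b∈ with ∈-map⁻ φ b∈
      ... | a , a∈ , refl = P⇒Q a (Equivalence.to (mem a) a∈)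
      from : ∀ b → Q b → b ∈ map φ l
      from b qb = subst (_∈ map φ l) (φψ b qb) (∈-map⁺ φ (Equivalence.from (mem (ψ b)) (Q⇒P b qb)))

  length-cartesianProductWith : ∀ {A B C : Set} (f : A → B → C) xs ys →
    length (cartesianProductWith f xs ys) ≡ length xs * length ys
  length-cartesianProductWith f []       ys = refl
  length-cartesianProductWith f (x ∷ xs) ys =
    trans (length-++ (map (f x) ys)) (cong₂ _+_ (length-map (f x) ys) (length-cartesianProductWith f xs ys))

  HasSize-∷ : ∀ {A : Set} {m} {P : A → Set} {Q : Vec A m → Set} {a b} → HasSize A P a → HasSize (Vec A m) Q b →
    HasSize (Vec A (suc m)) (λ v → P (head v) × Q (tail v)) (a * b)
  HasSize-∷ {P = P} {Q} (la , ua , ma , lena) (lb , ub , mb , lenb) =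
    cartesianProductWith _∷_ la lb ,
    cartesianProductWith⁺ _∷_ ∷-injective ua ub ,
    (λ v → mk⇔ (to v) (from v)) ,
    trans (length-cartesianProductWith _∷_ la lb) (cong₂ _*_ lena lenb)
    where
    ∷-injective : ∀ {w x y z} → (Vec._∷_ w y) ≡ x ∷ z → w ≡ x × y ≡ z
    ∷-injective refl = refl , refl
    to : ∀ v → v ∈ cartesianProductWith _∷_ la lb → P (head v) × Q (tail v)
    to v v∈ with ∈-cartesianProductWith⁻ _∷_ la lb v∈
    ... | x , xs , x∈ , xs∈ , refl = Equivalence.to (ma x) x∈ , Equivalence.to (mb xs) xs∈
    from : ∀ v → P (head v) × Q (tail v) → v ∈ cartesianProductWith _∷_ la lb
    from (x ∷ xs) (px , qxs) = ∈-cartesianProductWith⁺ _∷_ (Equivalence.from (ma x) px) (Equivalence.from (mb xs) qxs)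

  ∏ : ∀ m → (Fin m → ℕ) → ℕ
  ∏ zero    c = 1
  ∏ (suc m) c = c zero * ∏ m (λ i → c (suc i))

  HasSize-Vec : ∀ {A : Set} m (P : Fin m → A → Set) (c : Fin m → ℕ) → (∀ i → HasSize A (P i) (c i)) →
    HasSize (Vec A m) (λ v → ∀ i → P i (lookup v i)) (∏ m c)
  HasSize-Vec zero P c h = [] ∷ [] , [] ∷ [] , (λ { [] → mk⇔ (λ _ ()) (λ _ → here refl) }) , refl
  HasSize-Vec (suc m) P c h =
    HasSize-⇔ (HasSize-∷ (h zero) (HasSize-Vec m (λ i → P (suc i)) (λ i → c (suc i)) (λ i → h (suc i))))
      (λ { (x ∷ xs) (px , pxs) → λ { zero → px ; (suc i) → pxs i } })
      (λ { (x ∷ xs) pv → pv zero , (λ i → pv (suc i)) })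

  ∏-cong : ∀ m (c c' : Fin m → ℕ) → (∀ i → c i ≡ c' i) → ∏ m c ≡ ∏ m c'
  ∏-cong zero    c c' h = refl
  ∏-cong (suc m) c c' h = cong₂ _*_ (h zero) (∏-cong m _ _ (λ i → h (suc i)))

  ∏-const : ∀ m k → ∏ m (λ _ → k) ≡ k ^ m
  ∏-const zero    k = refl
  ∏-const (suc m) k = cong (k *_) (∏-const m k)

  ∏-update : ∀ m (c c' : Fin m → ℕ) r → (∀ i → ¬ i ≡ r → c i ≡ c' i) → ∏ m c * c' r ≡ ∏ m c' * c r
  ∏-update (suc m) c c' zero h =
    trans (cong (λ t → c zero * t * c' zero) (∏-cong m _ _ (λ i → h (suc i) (λ ()))))
          (swap (c zero) (∏ m (λ i → c' (suc i))) (c' zero))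
    where
    swap : ∀ a b c → a * b * c ≡ c * b * a
    swap = solve-∀
  ∏-update (suc m) c c' (suc r) h = begin
    c zero * ∏ m (λ i → c (suc i)) * c' (suc r)     ≡⟨ *-assoc (c zero) _ _ ⟩
    c zero * (∏ m (λ i → c (suc i)) * c' (suc r))   ≡⟨ cong₂ _*_ (h zero (λ ())) (∏-update m _ _ r (λ i i≢r → h (suc i) (λ e → i≢r (suc-injective e)))) ⟩
    c' zero * (∏ m (λ i → c' (suc i)) * c (suc r))  ≡⟨ sym (*-assoc (c' zero) _ _) ⟩
    c' zero * ∏ m (λ i → c' (suc i)) * c (suc r)    ∎
    where open ≡-Reasoning

  unique⇒length≤ : ∀ {m} (xs : List (Fin m)) → Unique xs → length xs ≤ m
  unique⇒length≤ xs u = injective⇒≤ (lookup-injective xs u)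
    where
    lookup-injective : ∀ {m} (xs : List (Fin m)) → Unique xs → ∀ {i j} → List.lookup xs i ≡ List.lookup xs j → i ≡ j
    lookup-injective (x ∷ xs) u {zero}  {zero}  e = refl
    lookup-injective (x ∷ xs) u {zero}  {suc j} e = ⊥-elim (Unique[x∷xs]⇒x∉xs u (subst (_∈ xs) (sym e) (∈-lookup j)))
    lookup-injective (x ∷ xs) u {suc i} {zero}  e = ⊥-elim (Unique[x∷xs]⇒x∉xs u (subst (_∈ xs) e (∈-lookup i)))
    lookup-injective (x ∷ xs) (_ ∷ u) {suc i} {suc j} e = cong suc (lookup-injective xs u e)

  ^-∸-split : ∀ n {m} (R₁ R₂ : List (Fin m)) → Unique (R₁ ++ R₂) →
    n ^ (m ∸ (length R₁ + length R₂)) * n ^ length R₂ ≡ n ^ (m ∸ length R₁)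
  ^-∸-split n {m} R₁ R₂ u = trans (sym (^-distribˡ-+-* n (m ∸ (b + r)) r))
    (cong (n ^_) (trans (cong (_+ r) (sym (∸-+-assoc m b r))) (m∸n+n≡m (subst (_≤ m ∸ b) (m+n∸m≡n b r) (∸-monoˡ-≤ b b+r≤m)))))
    where
    b = length R₁
    r = length R₂
    b+r≤m : b + r ≤ m
    b+r≤m = subst (_≤ m) (length-++ R₁) (unique⇒length≤ (R₁ ++ R₂) u)

  -- Vectors over a set of size n whose entries are fixed at the positions in
  -- R₁ and restricted to a subset of size s at the positions in R₂.
  module ConstrainedVectors {m : ℕ} (n s : ℕ) where

    factor : List (Fin m) → List (Fin m) → Fin m → ℕ
    factor R₁ R₂ i with _∈?_ _≟_ i R₁ | _∈?_ _≟_ i R₂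
    ... | yes _ | _     = 1
    ... | no _  | yes _ = s
    ... | no _  | no _  = n

    factor-∈₁ : ∀ {i R₁ R₂} → i ∈ R₁ → factor R₁ R₂ i ≡ 1
    factor-∈₁ {i} {R₁} {R₂} i∈ with _∈?_ _≟_ i R₁ | _∈?_ _≟_ i R₂
    ... | yes _ | _ = refl
    ... | no i∉ | _ = ⊥-elim (i∉ i∈)

    factor-∈₂ : ∀ {i R₁ R₂} → i ∉ R₁ → i ∈ R₂ → factor R₁ R₂ i ≡ s
    factor-∈₂ {i} {R₁} {R₂} i∉₁ i∈₂ with _∈?_ _≟_ i R₁ | _∈?_ _≟_ i R₂
    ... | yes i∈₁ | _ = ⊥-elim (i∉₁ i∈₁)
    ... | no _ | yes _ = refl
    ... | no _ | no i∉₂ = ⊥-elim (i∉₂ i∈₂)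

    factor-∉ : ∀ {i R₁ R₂} → i ∉ R₁ → i ∉ R₂ → factor R₁ R₂ i ≡ n
    factor-∉ {i} {R₁} {R₂} i∉₁ i∉₂ with _∈?_ _≟_ i R₁ | _∈?_ _≟_ i R₂
    ... | yes i∈₁ | _ = ⊥-elim (i∉₁ i∈₁)
    ... | no _ | yes i∈₂ = ⊥-elim (i∉₂ i∈₂)
    ... | no _ | no _ = refl

    factor-resp : ∀ {i R₁ R₂ R₁' R₂'} → (i ∈ R₁ → i ∈ R₁') → (i ∈ R₁' → i ∈ R₁) → (i ∈ R₂ → i ∈ R₂') → (i ∈ R₂' → i ∈ R₂) →
      factor R₁ R₂ i ≡ factor R₁' R₂' i
    factor-resp {i} {R₁} {R₂} to₁ from₁ to₂ from₂ with _∈?_ _≟_ i R₁ | _∈?_ _≟_ i R₂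
    ... | yes i∈₁ | _      = sym (factor-∈₁ (to₁ i∈₁))
    ... | no i∉₁ | yes i∈₂ = sym (factor-∈₂ (λ i∈ → i∉₁ (from₁ i∈)) (to₂ i∈₂))
    ... | no i∉₁ | no i∉₂  = sym (factor-∉ (λ i∈ → i∉₁ (from₁ i∈)) (λ i∈ → i∉₂ (from₂ i∈)))

    ∈-∷-other : ∀ {i r : Fin m} {R} → ¬ i ≡ r → i ∈ r ∷ R → i ∈ R
    ∈-∷-other i≢r (here i≡r) = ⊥-elim (i≢r i≡r)
    ∈-∷-other i≢r (there i∈) = i∈

    ∏-factor-∷₁ : ∀ {r R₁ R₂} → r ∉ R₁ → r ∉ R₂ → ∏ m (factor (r ∷ R₁) R₂) * n ≡ ∏ m (factor R₁ R₂) * 1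
    ∏-factor-∷₁ {r} {R₁} {R₂} r∉₁ r∉₂ =
      trans (cong (∏ m (factor (r ∷ R₁) R₂) *_) (sym (factor-∉ r∉₁ r∉₂)))
        (trans (∏-update m (factor (r ∷ R₁) R₂) (factor R₁ R₂) r
                 (λ i i≢r → factor-resp (∈-∷-other i≢r) there (λ i∈ → i∈) (λ i∈ → i∈)))
               (cong (∏ m (factor R₁ R₂) *_) (factor-∈₁ (here refl))))

    ∏-factor-∷₂ : ∀ {r R₂} → r ∉ R₂ → ∏ m (factor [] (r ∷ R₂)) * n ≡ ∏ m (factor [] R₂) * s
    ∏-factor-∷₂ {r} {R₂} r∉₂ =
      trans (cong (∏ m (factor [] (r ∷ R₂)) *_) (sym (factor-∉ (λ ()) r∉₂)))
        (trans (∏-update m (factor [] (r ∷ R₂)) (factor [] R₂) r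
                 (λ i i≢r → factor-resp (λ ()) (λ ()) (∈-∷-other i≢r) there))
               (cong (∏ m (factor [] R₂) *_) (factor-∈₂ (λ ()) (here refl))))

    -- Each element of R₁ contributes a factor 1 instead of n, each element of R₂ a factor s instead of n.
    ∏-factor-scaled : ∀ R₁ R₂ → Unique R₁ → Unique R₂ → (∀ {a} → a ∈ R₁ → a ∈ R₂ → ⊥) →
      ∏ m (factor R₁ R₂) * n ^ (length R₁ + length R₂) ≡ n ^ m * s ^ length R₂
    ∏-factor-scaled [] [] _ _ _ = begin
      ∏ m (factor [] []) * 1   ≡⟨ *-identityʳ _ ⟩
      ∏ m (factor [] [])       ≡⟨ ∏-cong m _ _ (λ i → factor-∉ {i} {[]} {[]} (λ ()) (λ ())) ⟩
      ∏ m (λ _ → n)            ≡⟨ ∏-const m n ⟩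
      n ^ m                    ≡⟨ sym (*-identityʳ _) ⟩
      n ^ m * 1                ∎
      where open ≡-Reasoning
    ∏-factor-scaled [] (r ∷ R₂) u₁ u₂ _ = begin
      ∏ m (factor [] (r ∷ R₂)) * (n * n ^ length R₂)  ≡⟨ sym (*-assoc (∏ m (factor [] (r ∷ R₂))) n _) ⟩
      ∏ m (factor [] (r ∷ R₂)) * n * n ^ length R₂    ≡⟨ cong (_* n ^ length R₂) (∏-factor-∷₂ (Unique[x∷xs]⇒x∉xs u₂)) ⟩
      ∏ m (factor [] R₂) * s * n ^ length R₂          ≡⟨ swap (∏ m (factor [] R₂)) s (n ^ length R₂) ⟩
      ∏ m (factor [] R₂) * n ^ length R₂ * s          ≡⟨ cong (_* s) (∏-factor-scaled [] R₂ u₁ (unique-++⁻ʳ (r ∷ []) u₂) (λ ())) ⟩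
      n ^ m * s ^ length R₂ * s                       ≡⟨ *-assoc (n ^ m) _ s ⟩
      n ^ m * (s ^ length R₂ * s)                     ≡⟨ cong (n ^ m *_) (*-comm (s ^ length R₂) s) ⟩
      n ^ m * (s * s ^ length R₂)                     ∎
      where
      open ≡-Reasoning
      swap : ∀ a b c → a * b * c ≡ a * c * b
      swap = solve-∀
    ∏-factor-scaled (r ∷ R₁) R₂ u₁ u₂ disjoint = begin
      ∏ m (factor (r ∷ R₁) R₂) * (n * n ^ (length R₁ + length R₂))  ≡⟨ sym (*-assoc (∏ m (factor (r ∷ R₁) R₂)) n _) ⟩
      ∏ m (factor (r ∷ R₁) R₂) * n * n ^ (length R₁ + length R₂)
        ≡⟨ cong (_* n ^ (length R₁ + length R₂)) (∏-factor-∷₁ (Unique[x∷xs]⇒x∉xs u₁) (disjoint (here refl))) ⟩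
      ∏ m (factor R₁ R₂) * 1 * n ^ (length R₁ + length R₂)          ≡⟨ cong (_* n ^ (length R₁ + length R₂)) (*-identityʳ (∏ m (factor R₁ R₂))) ⟩
      ∏ m (factor R₁ R₂) * n ^ (length R₁ + length R₂)
        ≡⟨ ∏-factor-scaled R₁ R₂ (unique-++⁻ʳ (r ∷ []) u₁) u₂ (λ a∈ → disjoint (there a∈)) ⟩
      n ^ m * s ^ length R₂                                         ∎
      where
      open ≡-Reasoning

    ∏-factor : .{{_ : NonZero n}} → ∀ R₁ R₂ → Unique (R₁ ++ R₂) →
      ∏ m (factor R₁ R₂) ≡ n ^ (m ∸ (length R₁ + length R₂)) * s ^ length R₂
    ∏-factor R₁ R₂ u = *-cancelʳ-≡ _ _ (n ^ k) {{m^n≢0 n k}}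
      (trans (∏-factor-scaled R₁ R₂ (unique-++⁻ˡ R₁ u) (unique-++⁻ʳ R₁ u) (unique-++⇒disjoint R₁ u)) (begin
        n ^ m * s ^ length R₂                 ≡⟨ cong (λ t → n ^ t * s ^ length R₂) (sym (m∸n+n≡m k≤m)) ⟩
        n ^ (m ∸ k + k) * s ^ length R₂       ≡⟨ cong (_* s ^ length R₂) (^-distribˡ-+-* n (m ∸ k) k) ⟩
        n ^ (m ∸ k) * n ^ k * s ^ length R₂   ≡⟨ swap (n ^ (m ∸ k)) (n ^ k) (s ^ length R₂) ⟩
        n ^ (m ∸ k) * s ^ length R₂ * n ^ k   ∎))
      where
      open ≡-Reasoning
      k = length R₁ + length R₂
      k≤m : k ≤ m
      k≤m = subst (_≤ m) (length-++ R₁) (unique⇒length≤ (R₁ ++ R₂) u)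
      swap : ∀ a b c → a * b * c ≡ a * c * b
      swap = solve-∀

    HasSize-constrained : ∀ {A : Set} {z : A} {Q : A → Set} .{{_ : NonZero n}} →
      HasSize A (_≡ z) 1 → HasSize A (λ _ → ⊤) n → HasSize A Q s →
      ∀ R₁ R₂ → Unique (R₁ ++ R₂) →
      HasSize (Vec A m) (λ q → (∀ r → r ∈ R₁ → lookup q r ≡ z) × (∀ r → r ∈ R₂ → Q (lookup q r)))
              (n ^ (m ∸ (length R₁ + length R₂)) * s ^ length R₂)
    HasSize-constrained {A} {z} {Q} size-z size-all size-Q R₁ R₂ u =
      HasSize-≡ (HasSize-⇔ (HasSize-Vec m Allowed (factor R₁ R₂) size-Allowed)
                  (λ q h → (λ r r∈ → proj₁ (h r) r∈) , (λ r r∈ → proj₂ (h r) r∈))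
                  (λ q h i → proj₁ h i , proj₂ h i))
                (∏-factor R₁ R₂ u)
      where
      Allowed : Fin m → A → Set
      Allowed i x = (i ∈ R₁ → x ≡ z) × (i ∈ R₂ → Q x)
      size-Allowed : ∀ i → HasSize A (Allowed i) (factor R₁ R₂ i)
      size-Allowed i with _∈?_ _≟_ i R₁ | _∈?_ _≟_ i R₂
      ... | yes i∈₁ | _ = HasSize-⇔ size-z (λ x x≡z → (λ _ → x≡z) , (λ i∈₂ → ⊥-elim (unique-++⇒disjoint R₁ u i∈₁ i∈₂)))
                                           (λ x ok → proj₁ ok i∈₁)
      ... | no i∉₁ | yes i∈₂ = HasSize-⇔ size-Q (λ x qx → (λ i∈₁ → ⊥-elim (i∉₁ i∈₁)) , (λ _ → qx)) (λ x ok → proj₂ ok i∈₂)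
      ... | no i∉₁ | no i∉₂ = HasSize-⇔ size-all (λ x _ → (λ i∈₁ → ⊥-elim (i∉₁ i∈₁)) , (λ i∈₂ → ⊥-elim (i∉₂ i∈₂))) (λ x _ → tt)

module Parametrisation (Σg : SignedGraph) (ω : Orientation Σg) (compat : Compatible Σg ω)
                       {n : ℕ} (plus : Fin n → Fin n → Fin n) (0# : Fin n) (neg : Fin n → Fin n)
                       (isAG : IsAbelianGroup _≡_ plus 0# neg)
                       (Rb Ru : List (Vertex Σg)) (reps : ComponentReps Σg Rb Ru) where

  open import Relation.Binary.PropositionalEquality hiding ([_])
  open import Data.Nat.Properties using (≤-refl)
  open import Data.Bool using (false; true; not)
  open import Data.Fin using (_≟_)
  open import Data.Vec using (Vec; []; _∷_; lookup; tabulate)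
  open import Data.Vec.Properties using (lookup∘tabulate; tabulate∘lookup; tabulate-cong)
  open import Data.Product using (∃; _×_; _,_; proj₁)
  open import Data.Sum using (inj₁; inj₂)
  open import Data.Empty using (⊥-elim)
  open import Data.Unit using (tt)
  open import Data.List using ([]; _∷_)
  open import Data.List.Membership.Propositional using (_∈_)
  open import Data.List.Membership.Propositional.Properties using (∈-++⁻)
  open import Data.Sign using (Sign) renaming (_*_ to _·_)
  open import Data.Sign.Properties using (*-identityʳ; s*s≡+) renaming (_≟_ to _≟ˢ_)
  open import Relation.Nullary using (¬_; Dec; yes; no)
  open SignFacts
  open Potentials Σg ω compat plus 0# neg isAG public
  open Components Σg Rb Ru reps
  open Counting using (HasSize-bijection)

  module TW h (tension : IsTension Σg ω plus 0# neg h) = TensionWalks Σg ω compat plus 0# neg isAG h tension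

  open SignedGraph Σg
  open ≡-Reasoning

  -- The twisted sum of an unbalanced closed walk at r; for a tension it does not
  -- depend on the walk (twisted-unbalanced), and it is 0 on balanced components.
  cycleValue : Vec G nE → V → G
  cycleValue f r with inconsistent? r
  ... | yes (e , eq , _) = twisted f (steps (closedWalkVia r e eq))
  ... | no _ = 0#

  -- A vector q of vertex values describes the tension whose potential is q v at
  -- every vertex v other than a representative and whose cycle value at a
  -- representative r is q r.
  potentialOf : Vec G nV → V → G
  potentialOf q v with v ≟ rep v
  ... | yes _ = 0#
  ... | no _ = lookup q v

  twistOf : Vec G nV → V → G
  twistOf q v = lookup q (rep v)

  twistOf-const : ∀ q e → twistOf q (endpoint e false) ≡ twistOf q (endpoint e true)
  twistOf-const q e = cong (lookup q) (rep-edge e)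

  tensionOf : Vec G nV → Vec G nE
  tensionOf q = Induced.induced (potentialOf q) (twistOf q) (twistOf-const q)

  tensionOf-isTension : ∀ q → IsTension Σg ω plus 0# neg (tensionOf q)
  tensionOf-isTension q = Induced.induced-isTension (potentialOf q) (twistOf q) (twistOf-const q)

  repSign : V → Sign
  repSign v = sgn (steps (walkFromRep v))

  -- Solves the telescoping formula along walkFromRep v for the potential at v.
  coordinate : Vec G nE → V → G
  coordinate f v with v ≟ rep v
  ... | yes _ = cycleValue f (rep v)
  ... | no _ = actS (repSign v) (ifNegative (repSign v) (cycleValue f (rep v)) ⊕ ⊖ twisted f (steps (walkFromRep v)))

  coordinates : Vec G nE → Vec G nV
  coordinates f = tabulate (coordinate f)

  potentialOf-rep : ∀ q {r} → r ∈ R → potentialOf q r ≡ 0#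
  potentialOf-rep q {r} m with r ≟ rep r
  ... | yes _ = refl
  ... | no ne = ⊥-elim (ne (sym (rep-idem m)))

  potentialOf-nonrep : ∀ q {v} → ¬ v ≡ rep v → potentialOf q v ≡ lookup q v
  potentialOf-nonrep q {v} nv with v ≟ rep v
  ... | yes e = ⊥-elim (nv e)
  ... | no _ = refl

  VanishOnRb : Vec G nV → Set
  VanishOnRb q = ∀ r → r ∈ Rb → lookup q r ≡ 0#

  cycleValue-tensionOf : ∀ q → VanishOnRb q → ∀ {r} → r ∈ R → cycleValue (tensionOf q) r ≡ lookup q r
  cycleValue-tensionOf q pq {r} mr with inconsistent? r
  ... | yes (e , eq , ne) = begin
      twisted (tensionOf q) (steps (closedWalkVia r e eq)) ≡⟨ Induced.twistedFrom-induced (potentialOf q) (twistOf q) (twistOf-const q) (closedWalkVia r e eq) Sign.+ ⟩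
      (potentialOf q r ⊕ ⊖ actS (sgn (steps (closedWalkVia r e eq))) (potentialOf q r)) ⊕ ifNegative (sgn (steps (closedWalkVia r e eq))) (twistOf q r)
        ≡⟨ cong₂ (λ a s → (a ⊕ ⊖ actS s a) ⊕ ifNegative s (twistOf q r)) (potentialOf-rep q mr) (sgn-closedWalkVia r e eq ne) ⟩
      (0# ⊕ ⊖ ⊖ 0#) ⊕ twistOf q r ≡⟨ prove ((:0 :+ :- (:- :0)) :+ x0) x0 tt (twistOf q r ∷ []) ⟩
      lookup q (rep r) ≡⟨ cong (lookup q) (rep-idem mr) ⟩
      lookup q r ∎
  ... | no nb with ∈-++⁻ Rb mr
  ...   | inj₁ mb = sym (pq r mb)
  ...   | inj₂ mu = ⊥-elim (nb (Ru-inconsistent mu))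

  coordinate-tensionOf : ∀ q → VanishOnRb q → ∀ v → coordinate (tensionOf q) v ≡ lookup q v
  coordinate-tensionOf q pq v with v ≟ rep v
  ... | yes ev = trans (cycleValue-tensionOf q pq (rep∈R v)) (cong (lookup q) (sym ev))
  ... | no nv = begin
      actS (repSign v) (ifNegative (repSign v) (cycleValue (tensionOf q) (rep v)) ⊕ ⊖ twisted (tensionOf q) (steps (walkFromRep v)))
        ≡⟨ cong₂ (λ a b → actS (repSign v) (ifNegative (repSign v) a ⊕ ⊖ b)) (cycleValue-tensionOf q pq (rep∈R v))
                 (Induced.twistedFrom-induced (potentialOf q) (twistOf q) (twistOf-const q) (walkFromRep v) Sign.+) ⟩
      actS (repSign v) (ifNegative (repSign v) (lookup q (rep v)) ⊕
        ⊖ ((potentialOf q (rep v) ⊕ ⊖ actS (repSign v) (potentialOf q v)) ⊕ ifNegative (repSign v) (twistOf q (rep v))))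
        ≡⟨ cong₃ (potentialOf-rep q (rep∈R v)) (potentialOf-nonrep q nv) (cong (lookup q) (rep-idem (rep∈R v))) ⟩
      actS (repSign v) (ifNegative (repSign v) (lookup q (rep v)) ⊕ ⊖ ((0# ⊕ ⊖ actS (repSign v) (lookup q v)) ⊕ ifNegative (repSign v) (lookup q (rep v))))
        ≡⟨ solve-telescope (repSign v) (lookup q (rep v)) (lookup q v) ⟩
      lookup q v ∎
    where
    cong₃ : ∀ {a a' b b' c c'} → a ≡ a' → b ≡ b' → c ≡ c' →
      actS (repSign v) (ifNegative (repSign v) (lookup q (rep v)) ⊕ ⊖ ((a ⊕ ⊖ actS (repSign v) b) ⊕ ifNegative (repSign v) c)) ≡
      actS (repSign v) (ifNegative (repSign v) (lookup q (rep v)) ⊕ ⊖ ((a' ⊕ ⊖ actS (repSign v) b') ⊕ ifNegative (repSign v) c'))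
    cong₃ refl refl refl = refl
    solve-telescope : ∀ s x y → actS s (ifNegative s x ⊕ ⊖ ((0# ⊕ ⊖ actS s y) ⊕ ifNegative s x)) ≡ y
    solve-telescope Sign.+ x y = prove (:0 :+ :- ((:0 :+ :- x1) :+ :0)) x1 tt (x ∷ y ∷ [])
    solve-telescope Sign.- x y = prove (:- (x0 :+ :- ((:0 :+ :- (:- x1)) :+ x0))) x1 tt (x ∷ y ∷ [])

  coordinates-tensionOf : ∀ q → VanishOnRb q → coordinates (tensionOf q) ≡ q
  coordinates-tensionOf q vanish = begin
    tabulate (coordinate (tensionOf q))   ≡⟨ tabulate-cong (coordinate-tensionOf q vanish) ⟩
    tabulate (lookup q)                   ≡⟨ tabulate∘lookup q ⟩
    q                                     ∎

  coordinates-rep : ∀ f {r} → r ∈ R → lookup (coordinates f) r ≡ cycleValue f r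
  coordinates-rep f {r} m = trans (lookup∘tabulate (coordinate f) r) coordinate-r
    where
    coordinate-r : coordinate f r ≡ cycleValue f r
    coordinate-r with r ≟ rep r
    ... | yes _ = cong (cycleValue f) (rep-idem m)
    ... | no ne = ⊥-elim (ne (sym (rep-idem m)))

  coordinates-vanishOnRb : ∀ f → VanishOnRb (coordinates f)
  coordinates-vanishOnRb f r m = trans (coordinates-rep f (Rb⊆R m)) cycleValue-r
    where
    cycleValue-r : cycleValue f r ≡ 0#
    cycleValue-r with inconsistent? r
    ... | yes x = ⊥-elim (Rb-consistent m x)
    ... | no _ = refl

  coordinate-nonrep : ∀ f v → ¬ v ≡ rep v → coordinate f v ≡ actS (repSign v) (ifNegative (repSign v) (cycleValue f (rep v)) ⊕ ⊖ twisted f (steps (walkFromRep v)))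
  coordinate-nonrep f v nv with v ≟ rep v
  ... | yes e = ⊥-elim (nv e)
  ... | no _ = refl

  -- The tension built from the coordinates of f has the same twisted sums as f
  -- along the spanning walks and around the closed walk through each edge, hence
  -- the same value on every edge.
  module FromTension (f : Vec G nE) (tension : IsTension Σg ω plus 0# neg f) where
    q : Vec G nV
    q = coordinates f

    g : Vec G nE
    g = tensionOf q

    twisted-spanWalk : ∀ v → twisted g (steps (spanWalk v)) ≡ twisted f (steps (spanWalk v))
    twisted-spanWalk v = by-cases (v ≟ rep v)
     where
     by-cases : Dec (v ≡ rep v) → twisted g (steps (spanWalk v)) ≡ twisted f (steps (spanWalk v))
     by-cases (yes ev) = trans (cong (twisted g) (spanWalk-rep v ev)) (sym (cong (twisted f) (spanWalk-rep v ev)))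
     by-cases (no nv) = trans (cong (λ W → twisted g (steps W)) (spanWalk-nonrep v nv)) (trans twisted-walkFromRep (cong (λ W → twisted f (steps W)) (sym (spanWalk-nonrep v nv))))
      where
      twisted-walkFromRep : twisted g (steps (walkFromRep v)) ≡ twisted f (steps (walkFromRep v))
      twisted-walkFromRep = begin
        twisted g (steps (walkFromRep v)) ≡⟨ Induced.twistedFrom-induced (potentialOf q) (twistOf q) (twistOf-const q) (walkFromRep v) Sign.+ ⟩
        (potentialOf q (rep v) ⊕ ⊖ actS (repSign v) (potentialOf q v)) ⊕ ifNegative (repSign v) (twistOf q (rep v))
          ≡⟨ cong₃ (potentialOf-rep q (rep∈R v)) (trans (potentialOf-nonrep q nv) (lookup∘tabulate (coordinate f) v))
                   (trans (coordinates-rep f (rep∈R (rep v))) (cong (cycleValue f) (rep-idem (rep∈R v)))) ⟩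
        (0# ⊕ ⊖ actS (repSign v) (coordinate f v)) ⊕ ifNegative (repSign v) (cycleValue f (rep v)) ≡⟨ telescope-inverse ⟩
        twisted f (steps (walkFromRep v)) ∎
        where
        cong₃ : ∀ {a a' b b' c c'} → a ≡ a' → b ≡ b' → c ≡ c' →
          (a ⊕ ⊖ actS (repSign v) b) ⊕ ifNegative (repSign v) c ≡ (a' ⊕ ⊖ actS (repSign v) b') ⊕ ifNegative (repSign v) c'
        cong₃ refl refl refl = refl
        solve-telescope : ∀ s x y → (0# ⊕ ⊖ actS s (actS s (ifNegative s x ⊕ ⊖ y))) ⊕ ifNegative s x ≡ y
        solve-telescope Sign.+ x y = prove ((:0 :+ :- (:0 :+ :- x1)) :+ :0) x1 tt (x ∷ y ∷ [])
        solve-telescope Sign.- x y = prove ((:0 :+ :- (:- (:- (x0 :+ :- x1)))) :+ x0) x1 tt (x ∷ y ∷ [])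
        telescope-inverse : (0# ⊕ ⊖ actS (repSign v) (coordinate f v)) ⊕ ifNegative (repSign v) (cycleValue f (rep v)) ≡ twisted f (steps (walkFromRep v))
        telescope-inverse = trans (cong (λ z → (0# ⊕ ⊖ actS (repSign v) z) ⊕ ifNegative (repSign v) (cycleValue f (rep v))) (coordinate-nonrep f v nv))
                  (solve-telescope (repSign v) (cycleValue f (rep v)) (twisted f (steps (walkFromRep v))))

    module _ (e : Fin nE) where
      u w r : V
      u = endpoint e false
      w = endpoint e true
      r = rep u

      Z : Walk r r
      Z = closedWalkVia r e refl

      expand : ∀ h → twisted h (steps Z) ≡
        twisted h (steps (spanWalk u)) ⊕ actS (spanSign u) (actS (ω e false) (lookup h e) ⊕ actS (σ e) (⊖ actS (spanSign w) (twisted h (steps (spanWalk w)))))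
      expand h = trans (cong (twisted h) (steps-closedWalkVia r e refl)) (trans (twisted-++ h (steps (spanWalk u)) _)
        (cong (λ z → twisted h (steps (spanWalk u)) ⊕ actS (spanSign u) z)
          (cong₂ _⊕_ (cong (λ s → actS s (lookup h e)) (*-identityʳ (ω e false)))
            (trans (twistedFrom-sign h (σ e) (reverseSteps (steps (spanWalk w)))) (cong (actS (σ e)) (twisted-reverseSteps h (steps (spanWalk w))))))))

      cycleValue-closedWalkVia : ∀ h → IsTension Σg ω plus 0# neg h → sgn (steps Z) ≡ Sign.- → twisted h (steps Z) ≡ cycleValue h r
      cycleValue-closedWalkVia h th uZ with inconsistent? r
      ... | yes (e' , eq' , ne') = TW.twisted-unbalanced h th Z (closedWalkVia r e' eq') uZ (sgn-closedWalkVia r e' eq' ne')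
      ... | no none = ⊥-elim (+≢- (trans (sym balanced) uZ))
        where
        balanced = trans (sgn-consistent (¬inconsistent⇒consistent r none) Z (rep-idem (rep∈R u))) (s*s≡+ (spanSign r))

      twisted-agree : twisted f (steps Z) ≡ twisted g (steps Z)
      twisted-agree with sgn (steps Z) ≟ˢ Sign.+
      ... | yes bal = trans (TW.twisted-balanced f tension Z bal) (sym (TW.twisted-balanced g (tensionOf-isTension q) Z bal))
      ... | no unbal = begin
        twisted f (steps Z)        ≡⟨ cycleValue-closedWalkVia f tension uZ ⟩
        cycleValue f r             ≡⟨ sym (coordinates-rep f (rep∈R u)) ⟩
        lookup q r                 ≡⟨ sym (cycleValue-tensionOf q (coordinates-vanishOnRb f) (rep∈R u)) ⟩
        cycleValue g r             ≡⟨ sym (cycleValue-closedWalkVia g (tensionOf-isTension q) uZ) ⟩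
        twisted g (steps Z)        ∎
        where
        uZ = ≢+⇒≡- unbal

      agree-on-edge : lookup f e ≡ lookup g e
      agree-on-edge = cancel (spanSign u) (ω e false) (trans (sym (expand f)) (trans twisted-agree (trans (expand g)
        (cong₂ (λ a b → a ⊕ actS (spanSign u) (actS (ω e false) (lookup g e) ⊕ actS (σ e) (⊖ actS (spanSign w) b)))
               (twisted-spanWalk u) (twisted-spanWalk w)))))
        where
        actS-injective : ∀ s {x y} → actS s x ≡ actS s y → x ≡ y
        actS-injective Sign.+ eq = eq
        actS-injective Sign.- eq = trans (sym (⁻¹-involutive _)) (trans (cong ⊖_ eq) (⁻¹-involutive _))
        cancel : ∀ {x y y' z} s a → x ⊕ actS s (actS a y ⊕ z) ≡ x ⊕ actS s (actS a y' ⊕ z) → y ≡ y'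
        cancel {x} {z = z} s a eq = actS-injective a (∙-cancelʳ z _ _ (actS-injective s (∙-cancelˡ x _ _ eq)))

    tensionOf-coordinates : tensionOf (coordinates f) ≡ f
    tensionOf-coordinates = begin
      g                          ≡⟨ sym (tabulate∘lookup g) ⟩
      tabulate (lookup g)        ≡⟨ tabulate-cong (λ e → sym (agree-on-edge e)) ⟩
      tabulate (lookup f)        ≡⟨ tabulate∘lookup f ⟩
      f                          ∎

  _≈₂_ : G → G → Set
  x ≈₂ y = ∃ λ z → x ≡ y ⊕ (z ⊕ z)

  ≈₂-refl : ∀ x → x ≈₂ x
  ≈₂-refl x = 0# , sym (prove (x0 :+ (:0 :+ :0)) x0 tt (x ∷ []))

  ≈₂-trans : ∀ {x y w} → x ≈₂ y → y ≈₂ w → x ≈₂ w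
  ≈₂-trans {x} {y} {w} (z , e) (z' , e') = (z ⊕ z') , trans e (trans (cong (_⊕ (z ⊕ z)) e')
    (prove ((x0 :+ (x2 :+ x2)) :+ (x1 :+ x1)) (x0 :+ ((x1 :+ x2) :+ (x1 :+ x2))) tt (w ∷ z ∷ z' ∷ [])))

  ≈₂-cong : ∀ {x x' y y'} → x ≈₂ x' → y ≈₂ y' → (x ⊕ y) ≈₂ (x' ⊕ y')
  ≈₂-cong {x' = x'} {y' = y'} (z , e) (z' , e') = (z ⊕ z') , trans (cong₂ _⊕_ e e')
    (prove ((x0 :+ (x2 :+ x2)) :+ (x1 :+ (x3 :+ x3))) ((x0 :+ x1) :+ ((x2 :+ x3) :+ (x2 :+ x3))) tt (x' ∷ y' ∷ z ∷ z' ∷ []))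

  ≈₂-sym : ∀ {x y} → x ≈₂ y → y ≈₂ x
  ≈₂-sym {x} {y} (z , e) = ⊖ z , trans (sym (prove ((x0 :+ (x1 :+ x1)) :+ (:- x1 :+ :- x1)) x0 tt (y ∷ z ∷ []))) (cong (_⊕ (⊖ z ⊕ ⊖ z)) (sym e))

  ≈₂-actS : ∀ s x → actS s x ≈₂ x
  ≈₂-actS Sign.+ x = ≈₂-refl x
  ≈₂-actS Sign.- x = ⊖ x , sym (prove (x0 :+ (:- x0 :+ :- x0)) (:- x0) tt (x ∷ []))

  ≈₂-ifNegative : ∀ s {x y} → x ≈₂ y → ifNegative s x ≈₂ ifNegative s y
  ≈₂-ifNegative Sign.+ _ = ≈₂-refl 0#
  ≈₂-ifNegative Sign.- h = h

  ∈2G : G → Set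
  ∈2G = In2G Σg ω plus 0# neg

  ∈2G-resp-≈₂ : ∀ {x y} → x ≈₂ y → ∈2G y → ∈2G x
  ∈2G-resp-≈₂ {x} (z , e) (w , refl) = (w ⊕ z) , trans e (prove ((x0 :+ x0) :+ (x1 :+ x1)) ((x0 :+ x1) :+ (x0 :+ x1)) tt (w ∷ z ∷ []))

  0#∈2G : ∈2G 0#
  0#∈2G = 0# , sym (identityˡ 0#)

  plain : Vec G nE → List St → G
  plain = plainSum Σg ω plus 0# neg

  -- Modulo 2G the plain sum of an induced edge function ignores the orientation,
  -- so it telescopes like the twisted sum.
  module PlainInduced (p t : V → G) (tc : ∀ e → t (endpoint e false) ≡ t (endpoint e true)) where
    open Induced p t tc

    combine : ∀ s1 s2 pa pc pv x → (((pa ⊕ pc) ⊕ ifNegative s1 x) ⊕ ((pc ⊕ pv) ⊕ ifNegative s2 x)) ≈₂ ((pa ⊕ pv) ⊕ ifNegative (s1 · s2) x)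
    combine Sign.+ Sign.+ pa pc pv x = pc , prove (((x0 :+ x1) :+ :0) :+ ((x1 :+ x2) :+ :0)) ((x0 :+ x2) :+ :0 :+ (x1 :+ x1)) tt (pa ∷ pc ∷ pv ∷ x ∷ [])
    combine Sign.+ Sign.- pa pc pv x = pc , prove (((x0 :+ x1) :+ :0) :+ ((x1 :+ x2) :+ x3)) ((x0 :+ x2) :+ x3 :+ (x1 :+ x1)) tt (pa ∷ pc ∷ pv ∷ x ∷ [])
    combine Sign.- Sign.+ pa pc pv x = pc , prove (((x0 :+ x1) :+ x3) :+ ((x1 :+ x2) :+ :0)) ((x0 :+ x2) :+ x3 :+ (x1 :+ x1)) tt (pa ∷ pc ∷ pv ∷ x ∷ [])
    combine Sign.- Sign.- pa pc pv x = (pc ⊕ x) , prove (((x0 :+ x1) :+ x3) :+ ((x1 :+ x2) :+ x3)) ((x0 :+ x2) :+ :0 :+ ((x1 :+ x3) :+ (x1 :+ x3))) tt (pa ∷ pc ∷ pv ∷ x ∷ [])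

    plain-induced : ∀ {u v} (W : Walk u v) → plain induced (steps W) ≈₂ ((p u ⊕ p v) ⊕ ifNegative (sgn (steps W)) (t u))
    plain-induced {u} (nil refl) = ⊖ p u , sym (prove (((x0 :+ x0) :+ :0) :+ (:- x0 :+ :- x0)) :0 tt (p u ∷ []))
    plain-induced {v = v} (cons (e , b) refl W) =
      ≈₂-trans (≈₂-cong (subst (_≈₂ ((p (endpoint e b) ⊕ p (endpoint e (not b))) ⊕ ifNegative (σ e) (t (endpoint e b))))
                       (sym (trans (lookup∘tabulate inducedOn e) (inducedOn-side e b)))
                       (≈₂-cong (≈₂-cong (≈₂-actS (ω e b) _) (≈₂-actS (ω e (not b)) _)) (≈₂-ifNegative (σ e) (≈₂-actS (ω e b) _))))
                    (subst (λ z → plain induced (steps W) ≈₂ ((p (endpoint e (not b)) ⊕ p v) ⊕ ifNegative (sgn (steps W)) z)) (t-const′ e b) (plain-induced W)))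
        (combine (σ e) (sgn (steps W)) _ _ _ _)

    plain-induced-unbalanced : ∀ {x} (W : Walk x x) → sgn (steps W) ≡ Sign.- → plain induced (steps W) ≈₂ t x
    plain-induced-unbalanced {x} W u = ≈₂-trans (plain-induced W) (subst (λ s → ((p x ⊕ p x) ⊕ ifNegative s (t x)) ≈₂ t x) (sym u)
      (p x , prove ((x0 :+ x0) :+ x1) (x1 :+ (x0 :+ x0)) tt (p x ∷ t x ∷ [])))

  PDCoordinates : Vec G nV → Set
  PDCoordinates q = VanishOnRb q × (∀ r → r ∈ Ru → ∈2G (lookup q r))

  tensionOf-isPotentialDifference : ∀ q → PDCoordinates q → IsPotentialDifference Σg ω plus 0# neg (tensionOf q)
  tensionOf-isPotentialDifference q (vanish , Ru∈2G) = tensionOf-isTension q , plain-unbalanced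
    where
    plain-unbalanced : ∀ W → IsCycle Σg W → ¬ Balanced Σg W → ∈2G (plain (tensionOf q) W)
    plain-unbalanced [] (() , _) nb
    plain-unbalanced (s ∷ l) cyc nb with fromClosedWalk s l (proj₁ cyc)
    ... | X , eq = subst (λ W → ∈2G (plain (tensionOf q) W)) eq
      (∈2G-resp-≈₂ (PlainInduced.plain-induced-unbalanced (potentialOf q) (twistOf q) (twistOf-const q) X (trans (cong sgn eq) (sgn-unbalanced (s ∷ l) nb))) rep∈2G)
      where
      rep∈2G : ∈2G (lookup q (rep (srcS s)))
      rep∈2G with ∈-++⁻ Rb (rep∈R (srcS s))
      ... | inj₁ mb = subst ∈2G (sym (vanish _ mb)) 0#∈2G
      ... | inj₂ mu = Ru∈2G _ mu

  coordinates-PD : ∀ f → IsPotentialDifference Σg ω plus 0# neg f → PDCoordinates (coordinates f)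
  coordinates-PD f (tension , plain∈2G) = coordinates-vanishOnRb f , Ru∈2G
    where
    q = coordinates f
    Ru∈2G : ∀ r → r ∈ Ru → ∈2G (lookup q r)
    Ru∈2G r mu with Ru-inconsistent mu
    ... | e , eq , ne with unbalancedCycle (len (closedWalkVia r e eq)) (closedWalkVia r e eq) ≤-refl (sgn-closedWalkVia r e eq ne)
    ...   | y , C' , cy , uc , sub = subst ∈2G (cong (lookup q) rep-y)
            (∈2G-resp-≈₂ (≈₂-sym (PlainInduced.plain-induced-unbalanced (potentialOf q) (twistOf q) (twistOf-const q) C' uc))
              (subst (λ g → ∈2G (plain g (steps C'))) (sym (FromTension.tensionOf-coordinates f tension))
                     (plain∈2G (steps C') (isCycle-steps C' cy) (sgn≡-⇒unbalanced {steps C'} uc))))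
      where
      y∈ : y ∈ sources (closedWalkVia r e eq)
      y∈ = sub (start∈sources C' (proj₁ cy))
      rep-y : rep y ≡ r
      rep-y = trans (sym (rep-walk (proj₁ (splitAtSource (closedWalkVia r e eq) y∈)))) (rep-idem (Ru⊆R mu))

  HasSize-tensions : ∀ {N} → HasSize (Vec G nV) VanishOnRb N → HasSize (Vec G nE) (IsTension Σg ω plus 0# neg) N
  HasSize-tensions size = HasSize-bijection size tensionOf coordinates (λ q _ → tensionOf-isTension q) coordinates-tensionOf
    (λ f _ → coordinates-vanishOnRb f) FromTension.tensionOf-coordinates

  HasSize-potentialDifferences : ∀ {N} → HasSize (Vec G nV) PDCoordinates N →
    HasSize (Vec G nE) (IsPotentialDifference Σg ω plus 0# neg) N
  HasSize-potentialDifferences size = HasSize-bijection size tensionOf coordinates tensionOf-isPotentialDifference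
    (λ q pd → coordinates-tensionOf q (proj₁ pd)) coordinates-PD (λ f pd → FromTension.tensionOf-coordinates f (proj₁ pd))

open import Data.Nat using (zero; suc)
open import Data.List using ([]; _++_)
import Data.List.Relation.Unary.AllPairs as AllPairs
open import Data.List.Relation.Unary.Unique.Propositional using (Unique)
open import Data.Product using (_,_; proj₁)
open import Data.Unit using (tt)
open Counting

reps-unique : ∀ {Σg Rb Ru} → ComponentReps Σg Rb Ru → Unique (Rb ++ Ru)
reps-unique reps = AllPairs.map (λ ¬connected r≡r' → ¬connected ([] , r≡r')) (proj₁ reps)

theorem7p7 : (Σg : SignedGraph) (ω : Orientation Σg) → Compatible Σg ω →
    (n : ℕ) (_⊕_ : Fin n → Fin n → Fin n) (0# : Fin n) (⊖_ : Fin n → Fin n) →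
    IsAbelianGroup _≡_ _⊕_ 0# ⊖_ →
    (Rb Ru : List (Vertex Σg)) → ComponentReps Σg Rb Ru →
    HasSize (Vec (Fin n) (SignedGraph.nE Σg)) (IsTension Σg ω _⊕_ 0# ⊖_)
      (n ^ (SignedGraph.nV Σg ∸ length Rb))
    × HasSize (Vec (Fin n) (SignedGraph.nE Σg)) (IsPotentialDifference Σg ω _⊕_ 0# ⊖_)
      (n ^ (SignedGraph.nV Σg ∸ (length Rb + length Ru)) * size2G _⊕_ ^ length Ru)
theorem7p7 Σg ω compat zero    plus () neg isAG Rb Ru reps
theorem7p7 Σg ω compat (suc m) plus 0# neg isAG Rb Ru reps =
  HasSize-tensions (HasSize-≡ (HasSize-⇔ (ConstrainedVectors.HasSize-constrained n n zero-size (HasSize-Fin n) (HasSize-Fin n) Rb Ru unique)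
                                          (λ q → proj₁) (λ q vanish → vanish , λ _ _ → tt))
                              (^-∸-split n Rb Ru unique)) ,
  HasSize-potentialDifferences
    (ConstrainedVectors.HasSize-constrained n (size2G plus) zero-size (HasSize-Fin n) (HasSize-2G plus) Rb Ru unique)
  where
  open Parametrisation Σg ω compat plus 0# neg isAG Rb Ru reps using (HasSize-tensions; HasSize-potentialDifferences)
  n = suc m
  zero-size = HasSize-singleton 0#
  unique = reps-unique reps
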